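{- For any non-negative integer $g$, the category $\mathcal{G}_g^{\mathrm{op}}$ (the opposite of the category of graphs of genus $g$ with contractions) is quasi-Gröbner, and therefore the category $\mathrm{Rep}_k(\mathcal{G}_g^{\mathrm{op}})$ is locally Noetherian for any Noetherian commutative ring $k$.
   Context: Graphs. A graph is a finite CW complex of dimension at most 1; 0-cells are vertices, 1-cells are edges (loops and multiple edges are allowed). The genus of a non-empty connected graph is the rank of its first homology group; a "graph of genus $g$" is always non-empty and connected. A map of CW complexes between graphs is very cellular if it takes every vertex to a vertex and every edge to either a vertex or an edge. A graph morphism is an equivalence class of very cellular maps, two being equivalent if they are homotopic through very cellular maps. A smooshing is a surjective graph morphism with connected fibers; a contraction is a smooshing with contractible fibers (so a contraction amounts to collapsing a set of edges forming a forest, followed by a graph isomorphism). $\mathcal{G}_g$ is the category whose objects are graphs of genus $g$ and whose morphisms are contractions. Modules. For a category $\mathcal{C}$ and commutative ring $k$, $\mathrm{Rep}_k(\mathcal{C})$ is the category of functors from $\mathcal{C}$ to $k$-modules. $M\in \mathrm{Rep}_k(\mathcal{C})$ is finitely generated if there are finitely many objects $x_1,\dots,x_r$ and elements $v_i\in M(x_i)$ such that for every object $x$, $M(x)$ is spanned over $k$ by the images of the $v_i$ under the maps induced by all morphisms $x_i\to x$. $\mathrm{Rep}_k(\mathcal{C})$ is locally Noetherian if every submodule of a finitely generated module is finitely generated. Gröbner theory. Let $\mathcal{C}$ be essentially small and $x$ an object. $\mathcal{C}_x$ is the set of equivalence classes of morphisms out of $x$, where $f:x\to y$ is equivalent to $g:x\to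 y'$ if there is an isomorphism $h:y\to y'$ with $h\circ f=g$. It has the quasi-order $f\le g$ iff there is a morphism $h$ with $h\circ f=g$. An infinite sequence $f_0,f_1,\dots$ in $\mathcal{C}_x$ is bad if there is no pair $i<j$ with $f_i\le f_j$. (G2): for every $x$, $\mathcal{C}_x$ admits no bad sequences. (G1): for every $x$, $\mathcal{C}_x$ admits a linear order $\preceq$ such that if $f,g:x\to y$, $h:y\to z$ and $f\preceq g$, then $h\circ f\preceq h\circ g$. $\mathcal{C}$ is Gröbner if it satisfies (G1) and (G2) and has no endomorphisms other than identities. A functor $\Phi:\mathcal{C}'\to\mathcal{C}$ has property (F) if for every object $x$ of $\mathcal{C}$ there are finitely many objects $y_1,\dots,y_r$ of $\mathcal{C}'$ and morphisms $f_i:x\to\Phi(y_i)$ such that for any object $y$ of $\mathcal{C}'$ and any morphism $f:x\to\Phi(y)$ there are an index $i$ and a morphism $g:y_i\to y$ with $f=\Phi(g)\circ f_i$. $\mathcal{C}$ is quasi-Gröbner if there exist a Gröbner category $\mathcal{C}'$ and an essentially surjective functor $\Phi:\mathcal{C}'\to\mathcal{C}$ with property (F). -}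

module Defs where

open import Level using (Level; 0ℓ; _⊔_) renaming (suc to lsuc)
open import Algebra.Bundles using (CommutativeRing)
open import Algebra.Module.Bundles using (Module)
import Algebra.Module.Construct.TensorUnit as TensorUnit
open import Algebra.Module.Morphism.Structures using (module ModuleMorphisms)
import Algebra.Properties.Monoid.Sum as Sum
open import Data.Empty using (⊥)
open import Data.Fin.Base using (Fin)
open import Data.Fin.Properties using (_≟_)
open import Data.Integer.Base as ℤ using (ℤ; 0ℤ; 1ℤ)
import Data.Integer.Properties as ℤₚ
open import Data.Nat.Base using (ℕ; _<_)
open import Data.Product.Base using (Σ; Σ-syntax; ∃; ∃-syntax; _×_; _,_; proj₁; proj₂)
open import Data.Sign.Base using (Sign; opposite) renaming (_*_ to _·_)
import Data.Sign.Properties as Signₚ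
open import Data.Sum.Base using (_⊎_; inj₁; inj₂)
open import Data.Sum.Properties using (inj₁-injective; inj₂-injective)
open import Data.Vec.Functional using (Vector)
open import Relation.Binary.Core using (Rel)
open import Relation.Binary.Construct.Closure.ReflexiveTransitive using (Star; ε; _◅_; _◅◅_)
open import Relation.Binary.PropositionalEquality using (_≡_; refl; sym; trans; cong; subst)
open import Relation.Binary.Structures using (IsEquivalence; IsTotalOrder)
open import Relation.Nullary using (¬_; does; contradiction)
open import Relation.Unary using (Pred; _∈_)
open import Data.Bool.Base using (if_then_else_)

private
  variable
    o h e o′ h′ e′ c ℓ m ℓm p : Level

------------------------------------------------------------------------
-- Categories and functors, with hom-setoids

record Category (o h e : Level) : Set (lsuc (o ⊔ h ⊔ e)) where
  infix  4 _≈_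
  infixr 9 _∘_
  field
    Obj       : Set o
    Hom       : Obj → Obj → Set h
    _≈_       : ∀ {x y} → Rel (Hom x y) e
    id        : ∀ {x} → Hom x x
    _∘_       : ∀ {x y z} → Hom y z → Hom x y → Hom x z
    isEquiv   : ∀ {x y} → IsEquivalence (_≈_ {x} {y})
    ∘-resp-≈  : ∀ {x y z} {f f′ : Hom y z} {g g′ : Hom x y} →
                f ≈ f′ → g ≈ g′ → f ∘ g ≈ f′ ∘ g′
    identityˡ : ∀ {x y} (f : Hom x y) → id ∘ f ≈ f
    identityʳ : ∀ {x y} (f : Hom x y) → f ∘ id ≈ f
    assoc     : ∀ {w x y z} (f : Hom y z) (g : Hom x y) (k : Hom w x) →
                (f ∘ g) ∘ k ≈ f ∘ (g ∘ k)

  IsIso : ∀ {x y} → Hom x y → Set (h ⊔ e)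
  IsIso {x} {y} f = Σ[ g ∈ Hom y x ] (g ∘ f ≈ id) × (f ∘ g ≈ id)

  _≅_ : Obj → Obj → Set (h ⊔ e)
  x ≅ y = Σ[ f ∈ Hom x y ] IsIso f

_ᵒᵖ : Category o h e → Category o h e
C ᵒᵖ = record
  { Obj       = Obj
  ; Hom       = λ x y → Hom y x
  ; _≈_       = _≈_
  ; id        = id
  ; _∘_       = λ f g → g ∘ f
  ; isEquiv   = isEquiv
  ; ∘-resp-≈  = λ p q → ∘-resp-≈ q p
  ; identityˡ = identityʳ
  ; identityʳ = identityˡ
  ; assoc     = λ f g k → IsEquivalence.sym isEquiv (assoc k g f)
  } where open Category C

record Functor (C : Category o h e) (D : Category o′ h′ e′) :
               Set (o ⊔ h ⊔ e ⊔ o′ ⊔ h′ ⊔ e′) where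
  private
    module C = Category C
    module D = Category D
  field
    F₀           : C.Obj → D.Obj
    F₁           : ∀ {x y} → C.Hom x y → D.Hom (F₀ x) (F₀ y)
    F-resp-≈     : ∀ {x y} {f g : C.Hom x y} → f C.≈ g → F₁ f D.≈ F₁ g
    identity     : ∀ {x} → F₁ (C.id {x}) D.≈ D.id
    homomorphism : ∀ {x y z} (f : C.Hom y z) (g : C.Hom x y) →
                   F₁ (f C.∘ g) D.≈ F₁ f D.∘ F₁ g

------------------------------------------------------------------------
-- Gröbner and quasi-Gröbner categories

module Gröbner (C : Category o h e) where
  open Category C

  -- Representatives of the elements of C_x; the equivalence relation
  -- defining C_x is _~_.
  Under : Obj → Set (o ⊔ h)
  Under x = Σ[ y ∈ Obj ] Hom x y

  infix 4 _~_ _≤_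
  _~_ : ∀ {x} → Rel (Under x) (h ⊔ e)
  (y , f) ~ (y′ , g) = Σ[ k ∈ Hom y y′ ] IsIso k × (k ∘ f ≈ g)

  _≤_ : ∀ {x} → Rel (Under x) (h ⊔ e)
  (y , f) ≤ (y′ , g) = Σ[ k ∈ Hom y y′ ] (k ∘ f ≈ g)

  Bad : ∀ {x} → (ℕ → Under x) → Set (h ⊔ e)
  Bad f = ¬ (∃[ i ] ∃[ j ] i < j × f i ≤ f j)

  G2 : Set (o ⊔ h ⊔ e)
  G2 = ∀ x (f : ℕ → Under x) → ¬ Bad f

  record AdmissibleOrder (x : Obj) : Set (lsuc (o ⊔ h ⊔ e)) where
    infix 4 _≼_
    field
      _≼_          : Rel (Under x) (o ⊔ h ⊔ e)
      isTotalOrder : IsTotalOrder _~_ _≼_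
      compatible   : ∀ {y z} (f g : Hom x y) (k : Hom y z) →
                     (y , f) ≼ (y , g) → (z , k ∘ f) ≼ (z , k ∘ g)

  G1 : Set (lsuc (o ⊔ h ⊔ e))
  G1 = ∀ x → AdmissibleOrder x

  record IsGröbner : Set (lsuc (o ⊔ h ⊔ e)) where
    field
      g1             : G1
      g2             : G2
      noEndomorphism : ∀ {x} (f : Hom x x) → f ≈ id

open Gröbner public using (IsGröbner)

module _ {C′ : Category o h e} {C : Category o′ h′ e′} (Φ : Functor C′ C) where
  private
    module C′ = Category C′
    module C  = Category C
  open Functor Φ

  EssentiallySurjective : Set (o ⊔ o′ ⊔ h′ ⊔ e′)
  EssentiallySurjective = ∀ x → ∃[ y ] F₀ y C.≅ x

  PropertyF : Set (o ⊔ h ⊔ o′ ⊔ h′ ⊔ e′)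
  PropertyF = ∀ x →
    ∃[ r ] Σ[ y ∈ Vector C′.Obj r ] Σ[ f ∈ (∀ i → C.Hom x (F₀ (y i))) ]
      (∀ z (k : C.Hom x (F₀ z)) →
        ∃[ i ] Σ[ g ∈ C′.Hom (y i) z ] k C.≈ F₁ g C.∘ f i)

QuasiGröbner : Category o h e → Set (lsuc (o ⊔ h ⊔ e))
QuasiGröbner {o} {h} {e} C =
  Σ[ C′ ∈ Category o h e ] IsGröbner C′ ×
  (Σ[ Φ ∈ Functor C′ C ] EssentiallySurjective Φ × PropertyF Φ)

------------------------------------------------------------------------
-- Modules over a commutative ring

module _ {k : CommutativeRing c ℓ} where

  Span : (M : Module k m ℓm) → Pred (Module.Carrierᴹ M) p →
         Pred (Module.Carrierᴹ M) (c ⊔ m ⊔ ℓm ⊔ p)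
  Span M S x = ∃[ n ]
    Σ[ a ∈ Vector (CommutativeRing.Carrier k) n ] Σ[ s ∈ Vector Carrierᴹ n ]
      (∀ i → s i ∈ S) × x ≈ᴹ sum (λ i → a i *ₗ s i)
    where
    open Module M
    open Sum +ᴹ-monoid using (sum)

-- For k in (c , ℓ), ideals of k and k-modules are taken in the universe
-- c ⊔ ℓ.

module _ (k : CommutativeRing c ℓ) where
  open CommutativeRing k

  record Ideal : Set (lsuc (c ⊔ ℓ)) where
    field
      I        : Pred Carrier (c ⊔ ℓ)
      resp-≈   : ∀ {x y} → x ≈ y → x ∈ I → y ∈ I
      0∈       : 0# ∈ I
      +-closed : ∀ {x y} → x ∈ I → y ∈ I → x + y ∈ I
      *-closed : ∀ r {x} → x ∈ I → r * x ∈ I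

  FinitelyGeneratedIdeal : Ideal → Set (c ⊔ ℓ)
  FinitelyGeneratedIdeal J =
    ∃[ r ] Σ[ v ∈ Vector Carrier r ]
      (∀ i → v i ∈ I) ×
      (∀ x → x ∈ I → x ∈ Span (TensorUnit.⟨module⟩ {R = k}) (λ y → ∃[ i ] y ≡ v i))
    where open Ideal J

  IsNoetherian : Set (lsuc (c ⊔ ℓ))
  IsNoetherian = ∀ J → FinitelyGeneratedIdeal J

------------------------------------------------------------------------
-- Representations of a category

module _ (k : CommutativeRing c ℓ) (C : Category o h e) where
  open Category C

  record Rep : Set (o ⊔ h ⊔ e ⊔ lsuc (c ⊔ ℓ)) where
    field
      F₀ : Obj → Module k (c ⊔ ℓ) (c ⊔ ℓ)

    module F₀ x = Module (F₀ x)

    field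
      F₁           : ∀ {x y} → Hom x y → F₀.Carrierᴹ x → F₀.Carrierᴹ y
      isLinear     : ∀ {x y} (f : Hom x y) →
                     ModuleMorphisms.IsModuleHomomorphism
                       (F₀.rawModule x) (F₀.rawModule y) (F₁ f)
      F-resp-≈     : ∀ {x y} {f g : Hom x y} → f ≈ g →
                     ∀ v → F₀._≈ᴹ_ y (F₁ f v) (F₁ g v)
      identity     : ∀ {x} v → F₀._≈ᴹ_ x (F₁ id v) v
      homomorphism : ∀ {x y z} (f : Hom y z) (g : Hom x y) v →
                     F₀._≈ᴹ_ z (F₁ (f ∘ g) v) (F₁ f (F₁ g v))

  -- A submodule of M, as a subobject in the functor category.
  record Submodule (M : Rep) : Set (o ⊔ h ⊔ e ⊔ lsuc (c ⊔ ℓ)) where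
    private module M = Rep M
    field
      N : Rep
    private module N = Rep N
    field
      ι       : ∀ x → N.F₀.Carrierᴹ x → M.F₀.Carrierᴹ x
      isMono  : ∀ x → ModuleMorphisms.IsModuleMonomorphism
                        (N.F₀.rawModule x) (M.F₀.rawModule x) (ι x)
      natural : ∀ {x y} (f : Hom x y) v →
                M.F₀._≈ᴹ_ y (ι y (N.F₁ f v)) (M.F₁ f (ι x v))

  FinitelyGenerated : Rep → Set (o ⊔ h ⊔ c ⊔ ℓ)
  FinitelyGenerated M =
    ∃[ r ] Σ[ x ∈ Vector Obj r ] Σ[ v ∈ (∀ i → F₀.Carrierᴹ (x i)) ]
      (∀ y w → w ∈ Span (F₀ y) (λ u → ∃[ i ] Σ[ f ∈ Hom (x i) y ] u ≡ F₁ f (v i)))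
    where open Rep M

  RepLocallyNoetherian : Set (o ⊔ h ⊔ e ⊔ lsuc (c ⊔ ℓ))
  RepLocallyNoetherian =
    ∀ M → FinitelyGenerated M → (S : Submodule M) → FinitelyGenerated (Submodule.N S)

------------------------------------------------------------------------
-- Multigraphs

-- A CW complex of dimension at most 1, not necessarily finite, given by
-- its cells and attaching maps.  Every edge is given a reference
-- direction; traversing it along (Sign.+) or against (Sign.-) that
-- direction starts at `start e s` and ends at `start e (opposite s)`.
record Multigraph : Set₁ where
  field
    V     : Set
    E     : Set
    start : E → Sign → V

  -- Oriented edges.
  Dart : Set
  Dart = E × Sign

  record Step (u v : V) : Set where
    constructor step
    eta-equality
    field
      edge   : E
      sign   : Sign
      starts : start edge sign ≡ u
      ends   : start edge (opposite sign) ≡ v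

  reverse : ∀ {u v} → Step u v → Step v u
  reverse (step a s p q) =
    step a (opposite s) q (trans (cong (start a) (Signₚ.opposite-involutive s)) p)

  Walk : V → V → Set
  Walk = Star Step

  -- Homotopy of edge paths relative to their endpoints.
  infix 4 _∼_
  data _∼_ : ∀ {u v} → Walk u v → Walk u v → Set where
    ∼-refl   : ∀ {u v} {p : Walk u v} → p ∼ p
    ∼-sym    : ∀ {u v} {p q : Walk u v} → p ∼ q → q ∼ p
    ∼-trans  : ∀ {u v} {p q r : Walk u v} → p ∼ q → q ∼ r → p ∼ r
    ∼-cons   : ∀ {u v w} (s : Step u v) {p q : Walk v w} → p ∼ q → s ◅ p ∼ s ◅ q
    ∼-cancel : ∀ {u v w} (s : Step u v) (p : Walk u w) → s ◅ reverse s ◅ p ∼ p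

  Connected : Set
  Connected = ∀ u v → Walk u v

  -- A homotopy from the identity to the constant map at `centre`: the
  -- track of each vertex is an edge path, and for each oriented edge the
  -- square spanned by it and the tracks of its endpoints can be filled.
  record Contractible : Set where
    field
      centre : V
      track  : ∀ u → Walk u centre
      square : ∀ {u v} (s : Step u v) → s ◅ track v ∼ track u

-- Up to homotopy through very cellular maps, a very cellular map is
-- determined by the image of each vertex, and for each edge either the
-- vertex to which it is collapsed or the edge onto which it is mapped
-- together with the direction (same or opposite) in which it is mapped.
-- In particular flipping a loop is not the identity.
module _ (G : Multigraph) where
  open Multigraph G

  corner : V ⊎ Dart → Sign → V
  corner (inj₁ v)       s = v
  corner (inj₂ (a , t)) s = start a (t · s)

  twist : Sign → V ⊎ Dart → V ⊎ Dart
  twist r (inj₁ v)       = inj₁ v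
  twist r (inj₂ (a , t)) = inj₂ (a , r · t)

record Morphism (G H : Multigraph) : Set where
  private
    module G = Multigraph G
    module H = Multigraph H
  field
    vertex     : G.V → H.V
    edge       : G.E → H.V ⊎ H.Dart
    compatible : ∀ a s → vertex (G.start a s) ≡ corner H (edge a) s

  extend : G.V ⊎ G.Dart → H.V ⊎ H.Dart
  extend (inj₁ v)       = inj₁ (vertex v)
  extend (inj₂ (a , t)) = twist H t (edge a)

private
  variable
    G H K : Multigraph

corner-twist : (G : Multigraph) → ∀ r x s → corner G (twist G r x) s ≡ corner G x (r · s)
corner-twist G r (inj₁ v)       s = refl
corner-twist G r (inj₂ (a , t)) s = cong (Multigraph.start G a)
  (trans (cong (_· s) (Signₚ.*-comm r t)) (Signₚ.*-assoc t r s))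

corner-extend : (f : Morphism G H) → ∀ x s →
  Morphism.vertex f (corner G x s) ≡ corner H (Morphism.extend f x) s
corner-extend f (inj₁ v)       s = refl
corner-extend {H = H} f (inj₂ (a , t)) s =
  trans (Morphism.compatible f a (t · s)) (sym (corner-twist H t (Morphism.edge f a) s))

idᴹ : Morphism G G
idᴹ = record
  { vertex     = λ v → v
  ; edge       = λ a → inj₂ (a , Sign.+)
  ; compatible = λ a s → refl
  }

infixr 9 _∘ᴹ_
_∘ᴹ_ : Morphism H K → Morphism G H → Morphism G K
g ∘ᴹ f = record
  { vertex     = λ v → g.vertex (f.vertex v)
  ; edge       = λ a → g.extend (f.edge a)
  ; compatible = λ a s →
      trans (cong g.vertex (f.compatible a s)) (corner-extend g (f.edge a) s)
  } where
  module g = Morphism g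
  module f = Morphism f

infix 4 _≗ᴹ_
_≗ᴹ_ : Rel (Morphism G H) 0ℓ
f ≗ᴹ g = (∀ v → vertex f v ≡ vertex g v) × (∀ a → edge f a ≡ edge g a)
  where open Morphism

module _ {G H : Multigraph} (f : Morphism G H) where
  private
    module G = Multigraph G
    module H = Multigraph H
  open Morphism f

  VertexFiber : H.V → Multigraph
  VertexFiber w = record
    { V     = Σ[ v ∈ G.V ] vertex v ≡ w
    ; E     = Σ[ a ∈ G.E ] edge a ≡ inj₁ w
    ; start = λ (a , eq) s →
        G.start a s , trans (compatible a s) (cong (λ x → corner H x s) eq)
    }

  -- The fiber over an interior point of b is discrete, with one point in
  -- each edge mapped onto b.
  EdgeFiber : H.E → Multigraph
  EdgeFiber b = record
    { V     = Σ[ a ∈ G.E ] Σ[ t ∈ Sign ] edge a ≡ inj₂ (b , t)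
    ; E     = ⊥
    ; start = λ ()
    }

  record IsSmooshing : Set where
    field
      surjectiveᵛ : ∀ w → ∃[ v ] vertex v ≡ w
      surjectiveᵉ : ∀ b → ∃[ a ] ∃[ t ] edge a ≡ inj₂ (b , t)
      connectedᵛ  : ∀ w → Multigraph.Connected (VertexFiber w)
      connectedᵉ  : ∀ b → Multigraph.Connected (EdgeFiber b)

  record IsContraction : Set where
    field
      isSmooshing   : IsSmooshing
      contractibleᵛ : ∀ w → Multigraph.Contractible (VertexFiber w)
      contractibleᵉ : ∀ b → Multigraph.Contractible (EdgeFiber b)
    open IsSmooshing isSmooshing public

------------------------------------------------------------------------
-- Contractions are closed under composition

module WalkProperties (G : Multigraph) where
  open Multigraph G

  rev : ∀ {u v} → Walk u v → Walk v u
  rev ε       = ε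
  rev (s ◅ p) = rev p ◅◅ (reverse s ◅ ε)

  reflexive : ∀ {u v} {p q : Walk u v} → p ≡ q → p ∼ q
  reflexive refl = ∼-refl

  reverse-involutive : ∀ {u v} (s : Step u v) → reverse (reverse s) ≡ s
  reverse-involutive (step a Sign.+ refl refl) = refl
  reverse-involutive (step a Sign.- refl refl) = refl

  ◅◅-assoc : ∀ {u v w x} (p : Walk u v) (q : Walk v w) (r : Walk w x) →
             (p ◅◅ q) ◅◅ r ≡ p ◅◅ (q ◅◅ r)
  ◅◅-assoc ε       q r = refl
  ◅◅-assoc (s ◅ p) q r = cong (s ◅_) (◅◅-assoc p q r)

  ◅◅-identityʳ : ∀ {u v} (p : Walk u v) → p ◅◅ ε ≡ p
  ◅◅-identityʳ ε       = refl
  ◅◅-identityʳ (s ◅ p) = cong (s ◅_) (◅◅-identityʳ p)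

  ∼-++ˡ : ∀ {u v w} (p : Walk u v) {q q′ : Walk v w} → q ∼ q′ → p ◅◅ q ∼ p ◅◅ q′
  ∼-++ˡ ε       eq = eq
  ∼-++ˡ (s ◅ p) eq = ∼-cons s (∼-++ˡ p eq)

  ∼-++ʳ : ∀ {u v w} {p p′ : Walk u v} (q : Walk v w) → p ∼ p′ → p ◅◅ q ∼ p′ ◅◅ q
  ∼-++ʳ q ∼-refl         = ∼-refl
  ∼-++ʳ q (∼-sym r)      = ∼-sym (∼-++ʳ q r)
  ∼-++ʳ q (∼-trans r r′) = ∼-trans (∼-++ʳ q r) (∼-++ʳ q r′)
  ∼-++ʳ q (∼-cons s r)   = ∼-cons s (∼-++ʳ q r)
  ∼-++ʳ q (∼-cancel s p) = ∼-cancel s (p ◅◅ q)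

  ∼-cancel′ : ∀ {u v w} (s : Step u v) (p : Walk v w) → reverse s ◅ s ◅ p ∼ p
  ∼-cancel′ s p =
    subst (λ s′ → reverse s ◅ s′ ◅ p ∼ p) (reverse-involutive s) (∼-cancel (reverse s) p)

  rev-inverseʳ : ∀ {u v w} (p : Walk u v) (q : Walk u w) → p ◅◅ (rev p ◅◅ q) ∼ q
  rev-inverseʳ ε       q = ∼-refl
  rev-inverseʳ (s ◅ p) q = ∼-trans
    (∼-cons s (∼-trans (reflexive (cong (p ◅◅_) (◅◅-assoc (rev p) (reverse s ◅ ε) q)))
                       (rev-inverseʳ p (reverse s ◅ q))))
    (∼-cancel s q)

  rev-inverseˡ : ∀ {u v w} (p : Walk u v) (q : Walk v w) → rev p ◅◅ (p ◅◅ q) ∼ q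
  rev-inverseˡ ε       q = ∼-refl
  rev-inverseˡ (s ◅ p) q = ∼-trans
    (reflexive (◅◅-assoc (rev p) (reverse s ◅ ε) (s ◅ p ◅◅ q)))
    (∼-trans (∼-++ˡ (rev p) (∼-cancel′ s (p ◅◅ q))) (rev-inverseˡ p q))

  contractible⇒connected : Contractible → Connected
  contractible⇒connected c u v = track u ◅◅ rev (track v)
    where open Contractible c

  discrete-contractible : ¬ E → (x : V) → (∀ y → y ≡ x) → Contractible
  discrete-contractible ¬E x unique = record
    { centre = x
    ; track  = λ y → subst (λ z → Walk z x) (sym (unique y)) ε
    ; square = λ s → contradiction (Step.edge s) ¬E
    }

  discrete-unique : ¬ E → ∀ {u v} → Walk u v → u ≡ v
  discrete-unique ¬E ε       = refl
  discrete-unique ¬E (s ◅ p) = contradiction (Step.edge s) ¬E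

-- Extension to walks of a map sending steps to walks.
module Induced (G H : Multigraph)
  (φ : Multigraph.V G → Multigraph.V H)
  (ψ : ∀ {u v} → Multigraph.Step G u v → Multigraph.Walk H (φ u) (φ v)) where
  private
    module G = Multigraph G
    module H = Multigraph H
  open WalkProperties H

  walk : ∀ {u v} → G.Walk u v → H.Walk (φ u) (φ v)
  walk ε       = ε
  walk (s ◅ p) = ψ s ◅◅ walk p

  walk-resp-∼ : (∀ {u v w} (s : G.Step u v) (q : H.Walk (φ u) w) →
                   ψ s ◅◅ (ψ (G.reverse s) ◅◅ q) H.∼ q) →
                ∀ {u v} {p q : G.Walk u v} → p G.∼ q → walk p H.∼ walk q
  walk-resp-∼ inv G.∼-refl         = H.∼-refl
  walk-resp-∼ inv (G.∼-sym r)      = H.∼-sym (walk-resp-∼ inv r)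
  walk-resp-∼ inv (G.∼-trans r r′) = H.∼-trans (walk-resp-∼ inv r) (walk-resp-∼ inv r′)
  walk-resp-∼ inv (G.∼-cons s r)   = ∼-++ˡ (ψ s) (walk-resp-∼ inv r)
  walk-resp-∼ inv (G.∼-cancel s p) = inv s (walk p)

·-cancel : ∀ s t → s · (s · t) ≡ t
·-cancel s t = trans (sym (Signₚ.*-assoc s s t)) (cong (_· t) (Signₚ.s*s≡+ s))

·-opposite : ∀ s t → s · opposite t ≡ opposite (s · t)
·-opposite Sign.+ t = refl
·-opposite Sign.- t = refl

uip : {A : Set} {x y : A} (p q : x ≡ y) → p ≡ q
uip refl refl = refl

twist-inj₁ : (G : Multigraph) → ∀ r x {v} → twist G r x ≡ inj₁ v → x ≡ inj₁ v
twist-inj₁ G r (inj₁ v) eq = eq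

twist-inj₂ : (G : Multigraph) → ∀ r x {a t} → twist G r x ≡ inj₂ (a , t) → x ≡ inj₂ (a , r · t)
twist-inj₂ G r (inj₂ (a , t)) refl = cong (λ s → inj₂ (a , s)) (sym (·-cancel r t))

module Composite (g : Morphism H K) (f : Morphism G H)
                 (gᶜ : IsContraction g) (fᶜ : IsContraction f) where
  private
    module G = Multigraph G
    module H = Multigraph H
    module K = Multigraph K
    module g = Morphism g
    module f = Morphism f
    module gᶜ = IsContraction gᶜ
    module fᶜ = IsContraction fᶜ
    gf : Morphism G K
    gf = g ∘ᴹ f

  edgeUnique : ∀ {a a′ b t t′} → f.edge a ≡ inj₂ (b , t) → f.edge a′ ≡ inj₂ (b , t′) → a ≡ a′
  edgeUnique {b = b} p q = cong proj₁
    (WalkProperties.discrete-unique (EdgeFiber f b) (λ ())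
      (fᶜ.connectedᵉ b (_ , _ , p) (_ , _ , q)))

  surjectiveᵛ : ∀ w → ∃[ v ] Morphism.vertex gf v ≡ w
  surjectiveᵛ w with gᶜ.surjectiveᵛ w
  ... | x , refl with fᶜ.surjectiveᵛ x
  ...   | v , refl = v , refl

  surjectiveᵉ : ∀ b → ∃[ a ] ∃[ t ] Morphism.edge gf a ≡ inj₂ (b , t)
  surjectiveᵉ b with gᶜ.surjectiveᵉ b
  ... | a′ , t , p with fᶜ.surjectiveᵉ a′
  ...   | a , r , q = a , r · t , trans (cong g.extend q) (cong (twist K r) p)

  factor : ∀ x {b t} → g.extend x ≡ inj₂ (b , t) →
           ∃[ c ] ∃[ r ] x ≡ inj₂ (c , r) × g.edge c ≡ inj₂ (b , r · t)
  factor (inj₂ (c , r)) eq = c , r , refl , twist-inj₂ K r (g.edge c) eq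

  edgeUniqueᵍ : ∀ {a a′ b t t′} → g.edge a ≡ inj₂ (b , t) → g.edge a′ ≡ inj₂ (b , t′) → a ≡ a′
  edgeUniqueᵍ {b = b} p q = cong proj₁
    (WalkProperties.discrete-unique (EdgeFiber g b) (λ ())
      (gᶜ.connectedᵉ b (_ , _ , p) (_ , _ , q)))

  edgeFiberUnique : ∀ b (x y : Multigraph.V (EdgeFiber gf b)) → x ≡ y
  edgeFiberUnique b (a , t , p) (a′ , t′ , p′)
    with factor (f.edge a) p | factor (f.edge a′) p′
  ... | c , r , eq , q | c′ , r′ , eq′ , q′ with edgeUniqueᵍ q q′
  ...   | refl = finish (edgeUnique eq eq′) p p′
    where
    finish : ∀ {a a′ t t′} → a ≡ a′ →
      (p : Morphism.edge gf a ≡ inj₂ (b , t)) (p′ : Morphism.edge gf a′ ≡ inj₂ (b , t′)) →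
      (a , t , p) ≡ (a′ , t′ , p′)
    finish refl p p′ with cong proj₂ (inj₂-injective (trans (sym p) p′))
    ... | refl = cong (λ z → _ , _ , z) (uip p p′)

  contractibleᵉ : ∀ b → Multigraph.Contractible (EdgeFiber gf b)
  contractibleᵉ b = WalkProperties.discrete-contractible (EdgeFiber gf b) (λ ())
    (surjectiveᵉ b) (λ y → edgeFiberUnique b y (surjectiveᵉ b))

  module _ (w : K.V) where
    private
      A = VertexFiber gf w
      B = VertexFiber g w
      module A = Multigraph A
      module B = Multigraph B
      module F x = Multigraph (VertexFiber f x)
      module C x = Multigraph.Contractible (fᶜ.contractibleᵛ x)
      open WalkProperties A

    A-vertex : ∀ {v v′} {p : g.vertex (f.vertex v) ≡ w} {p′ : g.vertex (f.vertex v′) ≡ w} →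
               v ≡ v′ → (v , p) ≡ (v′ , p′)
    A-vertex refl = cong (_ ,_) (uip _ _)

    B-vertex : ∀ {v v′} {p : g.vertex v ≡ w} {p′ : g.vertex v′ ≡ w} →
               v ≡ v′ → (v , p) ≡ (v′ , p′)
    B-vertex refl = cong (_ ,_) (uip _ _)

    A-step : ∀ {u v} (s s′ : A.Step u v) → proj₁ (A.Step.edge s) ≡ proj₁ (A.Step.edge s′) →
             A.Step.sign s ≡ A.Step.sign s′ → s ≡ s′
    A-step (A.step (a , p) t st en) (A.step (.a , p′) .t st′ en′) refl refl
      with uip p p′
    ... | refl with uip st st′ | uip en en′
    ...   | refl | refl = refl

    image : A.V → B.V
    image (v , q) = f.vertex v , q

    incl : ∀ {x} → g.vertex x ≡ w → F.V x → A.V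
    incl q (v , p) = v , trans (cong g.vertex p) q

    inclStep : ∀ {x} (q : g.vertex x ≡ w) {α α′ : F.V x} → F.Step x α α′ → A.Step (incl q α) (incl q α′)
    inclStep {x} q s = A.step
      (proj₁ (S.edge s) , trans (cong g.extend (proj₂ (S.edge s))) (cong inj₁ q))
      (S.sign s)
      (A-vertex (cong proj₁ (S.starts s)))
      (A-vertex (cong proj₁ (S.ends s)))
      where module S = F.Step x

    module I {x} (q : g.vertex x ≡ w) =
      Induced (VertexFiber f x) A (incl q) (λ s → inclStep q s ◅ ε)

    incl-∼ : ∀ {x} (q : g.vertex x ≡ w) {α α′} {p p′ : F.Walk x α α′} →
             F._∼_ x p p′ → I.walk q p A.∼ I.walk q p′
    incl-∼ {x} q = I.walk-resp-∼ q λ s r →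
      A.∼-trans (A.∼-cons _ (reflexive (cong (_◅ r) (A-step _ _ refl refl))))
                (A.∼-cancel (inclStep q s) r)

    base : B.V → A.V
    base (x , q) = incl q (C.centre x)

    η : ∀ {x} (q : g.vertex x ≡ w) (α : F.V x) → A.Walk (incl q α) (base (x , q))
    η {x} q α = I.walk q (C.track x α)

    ηᴬ : (u : A.V) → A.Walk u (base (image u))
    ηᴬ (v , q) = η q (v , refl)

    η-natural : ∀ {x} (q : g.vertex x ≡ w) (α α′ : F.V x) (s : A.Step (incl q α) (incl q α′)) →
                f.edge (proj₁ (A.Step.edge s)) ≡ inj₁ x → s ◅ η q α′ A.∼ η q α
    η-natural {x} q (v , r) (v′ , r′) s eq =
      A.∼-trans (reflexive (cong (_◅ η q (v′ , r′)) (A-step s (inclStep q s′) refl refl)))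
                (incl-∼ q (C.square x s′))
      where
      F-vertex : ∀ {v v′} {p : f.vertex v ≡ x} {p′ : f.vertex v′ ≡ x} →
                 v ≡ v′ → (v , p) ≡ (v′ , p′)
      F-vertex refl = cong (_ ,_) (uip _ _)
      s′ : F.Step x (v , r) (v′ , r′)
      s′ = F.step (proj₁ (A.Step.edge s) , eq) (A.Step.sign s)
             (F-vertex (cong proj₁ (A.Step.starts s)))
             (F-vertex (cong proj₁ (A.Step.ends s)))

    bridge : ∀ {a a′ b b′} → A.Step a a′ → image a ≡ b → image a′ ≡ b′ →
             A.Walk (base b) (base b′)
    bridge {a} {a′} s refl refl = rev (ηᴬ a) ◅◅ (s ◅ ηᴬ a′)

    bridge-unique : ∀ {a a′ c c′ b b′} (s : A.Step a a′) (s′ : A.Step c c′)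
                    (p : image a ≡ b) (p′ : image a′ ≡ b′) (q : image c ≡ b) (q′ : image c′ ≡ b′) →
                    proj₁ (A.Step.edge s) ≡ proj₁ (A.Step.edge s′) →
                    A.Step.sign s ≡ A.Step.sign s′ → bridge s p p′ ≡ bridge s′ q q′
    bridge-unique (A.step (a , m) t refl refl) (A.step (.a , m′) .t refl refl) refl refl q q′ refl refl
      with uip m m′
    ... | refl with q | q′
    ...   | refl | refl = refl

    bridge-inverse : ∀ {a a′ b b′ c} (s : A.Step a a′) (p : image a ≡ b) (p′ : image a′ ≡ b′)
                     (r : A.Walk (base b) c) →
                     bridge s p p′ ◅◅ (bridge (A.reverse s) p′ p ◅◅ r) A.∼ r
    bridge-inverse {a} {a′} s refl refl r =
      A.∼-trans (reflexive (◅◅-assoc (rev (ηᴬ a)) (s ◅ ηᴬ a′) _))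
      (A.∼-trans (∼-++ˡ (rev (ηᴬ a)) (A.∼-cons s (∼-++ˡ (ηᴬ a′)
                   (reflexive (◅◅-assoc (rev (ηᴬ a′)) (A.reverse s ◅ ηᴬ a) r)))))
      (A.∼-trans (∼-++ˡ (rev (ηᴬ a)) (A.∼-cons s (rev-inverseʳ (ηᴬ a′) _)))
      (A.∼-trans (∼-++ˡ (rev (ηᴬ a)) (A.∼-cancel s _))
                 (rev-inverseˡ (ηᴬ a) r))))

    liftEdge : (b : B.E) → Σ[ a ∈ A.E ] ∃[ r ] f.edge (proj₁ a) ≡ inj₂ (proj₁ b , r)
    liftEdge (b , p) with fᶜ.surjectiveᵉ b
    ... | a , r , eq = (a , trans (cong g.extend eq) (cong (twist K r) p)) , r , eq

    lift-start : ∀ b t →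
      image (A.start (proj₁ (liftEdge b)) (proj₁ (proj₂ (liftEdge b)) · t)) ≡ B.start b t
    lift-start b t = let (a , _) , r , eq = liftEdge b in B-vertex
      (trans (f.compatible a (r · t))
      (trans (cong (λ z → corner H z (r · t)) eq)
             (cong (H.start (proj₁ b)) (·-cancel r t))))

    liftSign : B.E → Sign → Sign
    liftSign b t = proj₁ (proj₂ (liftEdge b)) · t

    liftStep : ∀ b t → A.Step (A.start (proj₁ (liftEdge b)) (liftSign b t))
                              (A.start (proj₁ (liftEdge b)) (liftSign b (opposite t)))
    liftStep b t = A.step (proj₁ (liftEdge b)) (liftSign b t) refl
      (cong (A.start (proj₁ (liftEdge b))) (sym (·-opposite (proj₁ (proj₂ (liftEdge b))) t)))

    lift-starts : ∀ {u v} (s : B.Step u v) →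
      image (A.start (proj₁ (liftEdge (B.Step.edge s))) (liftSign (B.Step.edge s) (B.Step.sign s))) ≡ u
    lift-starts (B.step b t p q) = trans (lift-start b t) p

    lift-ends : ∀ {u v} (s : B.Step u v) →
      image (A.start (proj₁ (liftEdge (B.Step.edge s)))
                     (liftSign (B.Step.edge s) (opposite (B.Step.sign s)))) ≡ v
    lift-ends (B.step b t p q) = trans (lift-start b (opposite t)) q

    lift : ∀ {u v} → B.Step u v → A.Walk (base u) (base v)
    lift s = bridge (liftStep (B.Step.edge s) (B.Step.sign s)) (lift-starts s) (lift-ends s)

    lift-inverse : ∀ {u v c} (s : B.Step u v) (r : A.Walk (base u) c) →
                   lift s ◅◅ (lift (B.reverse s) ◅◅ r) A.∼ r
    lift-inverse s@(B.step b t p q) r = A.∼-trans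
      (∼-++ˡ (lift s) (reflexive (cong (_◅◅ r)
        (bridge-unique (liftStep b (opposite t)) (A.reverse (liftStep b t))
           (lift-starts (B.reverse s)) (lift-ends (B.reverse s)) (lift-ends s) (lift-starts s)
           refl (·-opposite (proj₁ (proj₂ (liftEdge b))) t)))))
      (bridge-inverse (liftStep b t) (lift-starts s) (lift-ends s) r)

    module L = Induced B A base lift
    module Cᴮ = Multigraph.Contractible (gᶜ.contractibleᵛ w)

    track : ∀ u → A.Walk u (base Cᴮ.centre)
    track u = ηᴬ u ◅◅ L.walk (Cᴮ.track (image u))

    track-incl : ∀ {x} (q : g.vertex x ≡ w) (α : F.V x) →
                 track (incl q α) ≡ η q α ◅◅ L.walk (Cᴮ.track (x , q))
    track-incl q (v , refl) = refl

    square-collapsed : ∀ {x} (q : g.vertex x ≡ w) {u v} (s : A.Step u v) (α α′ : F.V x) →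
                       u ≡ incl q α → v ≡ incl q α′ →
                       f.edge (proj₁ (A.Step.edge s)) ≡ inj₁ x → s ◅ track v A.∼ track u
    square-collapsed {x} q s α α′ refl refl eq =
      A.∼-trans (A.∼-cons s (reflexive (track-incl q α′)))
      (A.∼-trans (∼-++ʳ (L.walk (Cᴮ.track (x , q))) (η-natural q α α′ s eq))
                 (reflexive (sym (track-incl q α))))

    square-lifted : ∀ {u v} (s : A.Step u v) (s′ : B.Step (image u) (image v)) →
                    bridge s refl refl ≡ lift s′ → s ◅ track v A.∼ track u
    square-lifted {u} {v} s s′ eq =
      A.∼-trans (A.∼-sym (rev-inverseʳ (ηᴬ u) (s ◅ track v)))
      (∼-++ˡ (ηᴬ u)
        (A.∼-trans (reflexive (sym (◅◅-assoc (rev (ηᴬ u)) (s ◅ ηᴬ v) _)))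
        (A.∼-trans (reflexive (cong (_◅◅ L.walk (Cᴮ.track (image v))) eq))
                   (L.walk-resp-∼ lift-inverse (Cᴮ.square s′)))))

    square : ∀ {u v} (s : A.Step u v) → s ◅ track v A.∼ track u
    square {u} {v} s@(A.step (a , p) t st en) = go (f.edge a) refl
      where
      go : ∀ y → f.edge a ≡ y → s ◅ track v A.∼ track u
      go (inj₁ x) eq = square-collapsed (inj₁-injective (trans (sym (cong g.extend eq)) p)) s
              (proj₁ u , trans (cong (λ z → f.vertex (proj₁ z)) (sym st)) (at t))
              (proj₁ v , trans (cong (λ z → f.vertex (proj₁ z)) (sym en)) (at (opposite t)))
              (A-vertex refl) (A-vertex refl) eq
        where
        at : ∀ t → f.vertex (G.start a t) ≡ x
        at t = trans (f.compatible a t) (cong (λ z → corner H z t) eq)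
      go (inj₂ (b , r)) eq = square-lifted s s′
              (bridge-unique s (liftStep b′ (r · t)) refl refl (lift-starts s′) (lift-ends s′) same
                (trans (sym (·-cancel r t)) (cong (_· (r · t)) sameSign)))
        where
        b′ : B.E
        b′ = b , twist-inj₁ K r (g.edge b) (trans (sym (cong g.extend eq)) p)
        at : ∀ t → f.vertex (G.start a t) ≡ H.start b (r · t)
        at t = trans (f.compatible a t) (cong (λ z → corner H z t) eq)
        s′ : B.Step (image u) (image v)
        s′ = B.step b′ (r · t)
          (B-vertex (trans (sym (at t)) (cong (λ z → f.vertex (proj₁ z)) st)))
          (B-vertex (trans (cong (H.start b) (sym (·-opposite r t)))
                    (trans (sym (at (opposite t))) (cong (λ z → f.vertex (proj₁ z)) en))))
        same : a ≡ proj₁ (proj₁ (liftEdge b′))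
        same = edgeUnique eq (proj₂ (proj₂ (liftEdge b′)))
        sameSign : r ≡ proj₁ (proj₂ (liftEdge b′))
        sameSign = cong proj₂ (inj₂-injective
          (trans (sym eq) (trans (cong f.edge same) (proj₂ (proj₂ (liftEdge b′))))))

    contractibleᵛ : A.Contractible
    contractibleᵛ = record { centre = base Cᴮ.centre ; track = track ; square = square }

  isContraction : IsContraction gf
  isContraction = record
    { isSmooshing = record
      { surjectiveᵛ = surjectiveᵛ
      ; surjectiveᵉ = surjectiveᵉ
      ; connectedᵛ  = λ w → WalkProperties.contractible⇒connected (VertexFiber gf w) (contractibleᵛ w)
      ; connectedᵉ  = λ b → WalkProperties.contractible⇒connected (EdgeFiber gf b) (contractibleᵉ b)
      }
    ; contractibleᵛ = contractibleᵛ
    ; contractibleᵉ = contractibleᵉ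
    }

id-isContraction : IsContraction (idᴹ {G})
id-isContraction {G} = record
  { isSmooshing = record
    { surjectiveᵛ = λ w → w , refl
    ; surjectiveᵉ = λ b → b , Sign.+ , refl
    ; connectedᵛ  = λ w → WalkProperties.contractible⇒connected (VertexFiber (idᴹ {G}) w) (contractibleᵛ w)
    ; connectedᵉ  = λ b → WalkProperties.contractible⇒connected (EdgeFiber (idᴹ {G}) b) (contractibleᵉ b)
    }
  ; contractibleᵛ = contractibleᵛ
  ; contractibleᵉ = contractibleᵉ
  }
  where
  contractibleᵛ : ∀ w → Multigraph.Contractible (VertexFiber (idᴹ {G}) w)
  contractibleᵛ w = WalkProperties.discrete-contractible (VertexFiber (idᴹ {G}) w)
    (λ ()) (w , refl) (λ { (_ , refl) → refl })
  contractibleᵉ : ∀ b → Multigraph.Contractible (EdgeFiber (idᴹ {G}) b)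
  contractibleᵉ b = WalkProperties.discrete-contractible (EdgeFiber (idᴹ {G}) b)
    (λ ()) (b , Sign.+ , refl) (λ { (_ , _ , refl) → refl })

------------------------------------------------------------------------
-- Finite graphs and their genus

record Graph : Set where
  field
    #V    : ℕ
    #E    : ℕ
    start : Fin #E → Sign → Fin #V

  multigraph : Multigraph
  multigraph = record { V = Fin #V ; E = Fin #E ; start = start }

  open Multigraph multigraph public hiding (start)

  -- Cellular 1-chains; as there are no 2-cells, H₁ is the group of
  -- 1-chains with zero boundary.
  Chain : Set
  Chain = Vector ℤ #E

  open Sum ℤₚ.+-0-monoid using (sum)

  ∂ : Chain → Vector ℤ #V
  ∂ z v = sum λ a → z a ℤ.* (at (start a Sign.-) ℤ.- at (start a Sign.+))
    where
    at : Fin #V → ℤ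
    at u = if does (u ≟ v) then 1ℤ else 0ℤ

  IsCycle : Chain → Set
  IsCycle z = ∀ v → ∂ z v ≡ 0ℤ

  combination : ∀ {n} → Vector ℤ n → Vector Chain n → Chain
  combination x b a = sum λ i → x i ℤ.* b i a

  -- H₁ is free, and its rank is the number of elements of a ℤ-basis.
  record HasH₁Rank (r : ℕ) : Set where
    field
      basis       : Vector Chain r
      isCycle     : ∀ i → IsCycle (basis i)
      independent : ∀ x → (∀ a → combination x basis a ≡ 0ℤ) → ∀ i → x i ≡ 0ℤ
      spanning    : ∀ z → IsCycle z → ∃[ x ] (∀ a → z a ≡ combination x basis a)

record GraphOfGenus (g : ℕ) : Set where
  field
    graph     : Graph
    nonEmpty  : Graph.V graph
    connected : Graph.Connected graph
    hasH₁Rank : Graph.HasH₁Rank graph g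

  open Graph graph public using (multigraph)

------------------------------------------------------------------------
-- The contraction category

extend-id : (x : Multigraph.V G ⊎ Multigraph.Dart G) → Morphism.extend (idᴹ {G}) x ≡ x
extend-id (inj₁ v)       = refl
extend-id (inj₂ (a , t)) = cong (λ s → inj₂ (a , s)) (Signₚ.*-identityʳ t)

twist-+ : (x : Multigraph.V G ⊎ Multigraph.Dart G) → twist G Sign.+ x ≡ x
twist-+ (inj₁ v) = refl
twist-+ (inj₂ d) = refl

extend-twist : (f : Morphism G H) → ∀ r x →
  Morphism.extend f (twist G r x) ≡ twist H r (Morphism.extend f x)
extend-twist f r (inj₁ v) = refl
extend-twist {H = H} f r (inj₂ (a , t)) = twist-· (Morphism.edge f a)
  where
  twist-· : ∀ y → twist H (r · t) y ≡ twist H r (twist H t y)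
  twist-· (inj₁ v)       = refl
  twist-· (inj₂ (b , s)) = cong (λ z → inj₂ (b , z)) (Signₚ.*-assoc r t s)

extend-∘ : (f : Morphism H K) (g : Morphism G H) → ∀ x →
  Morphism.extend (f ∘ᴹ g) x ≡ Morphism.extend f (Morphism.extend g x)
extend-∘ f g (inj₁ v)       = refl
extend-∘ f g (inj₂ (a , t)) = sym (extend-twist f t (Morphism.edge g a))

extend-cong : {f f′ : Morphism G H} → f ≗ᴹ f′ → ∀ x →
  Morphism.extend f x ≡ Morphism.extend f′ x
extend-cong (p , q) (inj₁ v) = cong inj₁ (p v)
extend-cong {H = H} (p , q) (inj₂ (a , t)) = cong (twist H t) (q a)

Contraction : Multigraph → Multigraph → Set
Contraction G H = Σ[ f ∈ Morphism G H ] IsContraction f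

𝒢 : ℕ → Category 0ℓ 0ℓ 0ℓ
𝒢 g = record
  { Obj       = GraphOfGenus g
  ; Hom       = λ G H → Contraction (multigraph G) (multigraph H)
  ; _≈_       = λ f f′ → proj₁ f ≗ᴹ proj₁ f′
  ; id        = idᴹ , id-isContraction
  ; _∘_       = λ { (f , fᶜ) (f′ , f′ᶜ) → f ∘ᴹ f′ , Composite.isContraction f f′ fᶜ f′ᶜ }
  ; isEquiv   = record
    { refl  = (λ _ → refl) , (λ _ → refl)
    ; sym   = λ (p , q) → (λ v → sym (p v)) , (λ a → sym (q a))
    ; trans = λ (p , q) (p′ , q′) → (λ v → trans (p v) (p′ v)) , (λ a → trans (q a) (q′ a))
    }
  ; ∘-resp-≈  = λ {_} {_} {_} {f} {f′} {k} {k′} p q →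
      (λ v → trans (proj₁ p _) (cong (Morphism.vertex (proj₁ f′)) (proj₁ q v))) ,
      (λ a → trans (extend-cong {f = proj₁ f} {f′ = proj₁ f′} p (Morphism.edge (proj₁ k) a))
                   (cong (Morphism.extend (proj₁ f′)) (proj₂ q a)))
  ; identityˡ = λ f → (λ _ → refl) , (λ a → extend-id (Morphism.edge (proj₁ f) a))
  ; identityʳ = λ f → (λ _ → refl) , (λ a → twist-+ (Morphism.edge (proj₁ f) a))
  ; assoc     = λ (f , _) (f′ , _) (k , _) →
      (λ _ → refl) , (λ a → extend-∘ f f′ (Morphism.edge k a))
  }
  where open GraphOfGenus

{-# OPTIONS --safe #-}

-- Choose in a graph of genus g a planar rooted spanning tree and number and
-- direct the g remaining edges: this is a planar tree with g pairs of marked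
-- vertices, an object of 𝓕 g.  A contraction collapsing tree edges only is
-- determined by the edges that it keeps, so that in the opposite category
-- morphisms become embeddings of the edge sets which preserve preorder,
-- ancestry and marks.  With the tree coded as a binary tree (first child, next
-- sibling) and each node labelled by its preimage and its marks, a homeomorphic
-- embedding of codes yields a factorisation of embeddings, so (G2) is Kruskal's
-- theorem for binary trees; (G1) compares embeddings lexicographically.
--
-- For property (F), let Φ z → x be a contraction.  Collapsing those tree edges
-- of z that it collapses leaves a tree with at most as many edges as x, and
-- there are finitely many contractions to x from such trees.
--
-- The submodules of a finitely generated module over 𝓕 g are finitely
-- generated by Gröbner's argument: the ideals of leading coefficients increase
-- along the well-quasi-order, so finitely many of them determine all others.
-- The classical reasoning needed is supplied by the hypothesis on k, which
-- yields the law of excluded middle with 1 ≈ 0 in place of falsity.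

module Submission where

open import Defs
import Level
open import Level using (0ℓ; _⊔_)
open import Algebra.Bundles using (CommutativeRing; module CommutativeMonoid)
open import Algebra.Module.Bundles using (Module)
import Algebra.Module.Construct.TensorUnit as TensorUnit
open import Algebra.Module.Morphism.Structures using (module ModuleMorphisms)
import Algebra.Properties.CommutativeSemigroup as CommutativeSemigroup
import Algebra.Properties.Monoid.Sum as Sum
open import Data.Bool.Base using (Bool; true; false; if_then_else_; not)
import Data.Bool.Properties as Boolₚ
open import Data.Empty using (⊥; ⊥-elim)
open import Data.Fin.Base as Fin using (Fin; zero; suc; toℕ; _↑ˡ_; _↑ʳ_; splitAt)
import Data.Fin.Permutation as Permutation
import Data.Fin.Properties as Finₚ
open import Data.Integer.Base as ℤ using (ℤ; 0ℤ; 1ℤ)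
import Data.Integer.Properties as ℤₚ
open import Data.Integer.Tactic.RingSolver using (solve-∀)
open import Data.List.Base as List using (List; []; _∷_)
open import Data.List.Membership.Propositional using () renaming (_∈_ to _∈ˡ_)
import Data.List.Membership.Propositional.Properties as ∈ₚ
import Data.List.Relation.Binary.Lex.Strict as Lex
open import Data.List.Relation.Binary.Pointwise as Pointwise using (Pointwise)
import Data.List.Relation.Unary.Any as Any
import Data.List.Relation.Unary.Any.Properties as Anyₚ
open import Data.Maybe.Base as Maybe using (Maybe; just; nothing)
open import Data.Nat.Base as ℕ using (ℕ; zero; suc; z≤n; s≤s)
import Data.Nat.Properties as ℕₚ
open import Data.Product.Base using (Σ; Σ-syntax; ∃; ∃-syntax; _×_; _,_; proj₁; proj₂)
open import Data.Sign.Base using (Sign; opposite) renaming (_*_ to _·_)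
import Data.Sign.Properties as Signₚ
open import Data.Sum.Base as ⊎ using (_⊎_; inj₁; inj₂; [_,_]′)
open import Data.Sum.Properties using (inj₂-injective)
open import Data.Unit.Base using (⊤; tt)
open import Data.Vec.Base using (Vec; []; _∷_; lookup; tabulate)
open import Data.Vec.Functional using (insertAt)
import Data.Vec.Functional.Properties as Vectorₚ
import Data.Vec.Properties as Vecₚ
open import Function.Base using (case_of_)
open import Relation.Binary.Construct.Closure.ReflexiveTransitive using (ε; _◅_; _◅◅_)
open import Relation.Binary.Definitions using (tri<; tri≈; tri>)
open import Relation.Binary.PropositionalEquality
  using (_≡_; _≢_; refl; sym; trans; cong; cong₂; subst; subst₂; module ≡-Reasoning)
import Relation.Binary.Reasoning.Setoid as ≈-Reasoning
open import Relation.Binary.Structures using (IsEquivalence; IsTotalOrder)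
open import Relation.Nullary
open import Relation.Nullary.Decidable using (decidable-stable; map′; _→-dec_)
open import Relation.Unary using (Pred)

open import Algebra.Properties.CommutativeMonoid.Sum ℤₚ.+-0-commutativeMonoid
  using (∑-distrib-+; ∑-comm; sum-remove; sum-permute)
open import Algebra.Properties.Semiring.Sum ℤₚ.+-*-semiring
  using (sum; sum-cong-≗; *-distribˡ-sum)

-- Well-quasi-orders

-- Graphs have automorphisms, while a Gröbner category has only identities as endomorphisms. The
-- planar order, the numbering and the directions are there to remove them: an increasing map
-- between equally many edges is the identity. The argument is constructive, and this shapes it in
-- two places. (G2) only denies bad sequences and gives no induction, so well-quasi-orders are
-- defined inductively; the same definition then produces good pairs and supports the recursion that
-- builds finite bases of leading ideals. Property (F) calls for an actual list of contractions, so
-- being a contraction has to be decided. This is done by collapsing one edge at a time and rests on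
-- a cancellation law: if `f ∘ᴹ q` and `q` are contractions, so is `f`. The same law shows that what
-- remains of a contraction after its tree edges have been collapsed is again a contraction. The
-- genus is given by a basis of cycles. That a spanning tree misses exactly g edges follows by
-- comparing that basis with the fundamental cycles of the tree.

record DecRel : Set₁ where
  infix 4 _≤_ _≤?_
  field
    Carrier : Set
    _≤_     : Carrier → Carrier → Set
    _≤?_    : ∀ x y → Dec (x ≤ y)

open DecRel using (Carrier)

infixl 6 _∖_
_∖_ : (X : DecRel) → Carrier X → DecRel
X ∖ x = record
  { Carrier = Σ[ y ∈ Carrier X ] ¬ DecRel._≤_ X x y
  ; _≤_     = λ y z → DecRel._≤_ X (proj₁ y) (proj₁ z)
  ; _≤?_    = λ y z → DecRel._≤?_ X (proj₁ y) (proj₁ z)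
  }

-- The tree of bad sequences is well-founded.
data WQO (X : DecRel) : Set where
  wqo : (∀ x → WQO (X ∖ x)) → WQO X

wqo-comap : ∀ {X Y} (f : Carrier Y → Carrier X) →
            (∀ {y z} → DecRel._≤_ X (f y) (f z) → DecRel._≤_ Y y z) → WQO X → WQO Y
wqo-comap f reflect (wqo h) = wqo λ y →
  wqo-comap (λ (z , y≰z) → f z , λ le → y≰z (reflect le)) reflect (h (f y))

-- Monotone images of well-quasi-orders are well-quasi-ordered, because a choice of preimages
-- reflects the order. Only the elements not above `t` have to be covered, so each inductive step
-- below reduces to coding these by a simpler order.
wqo-remainder : ∀ {X Z} t (d : Carrier X → Carrier Z) →
                (∀ {x y} → DecRel._≤_ X x y → DecRel._≤_ Z (d x) (d y)) →
                (∀ z → ¬ DecRel._≤_ Z t z → ∃[ x ] d x ≡ z) →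
                WQO X → WQO (Z ∖ t)
wqo-remainder {X} {Z} t d mono cover = wqo-comap (λ (z , t≰z) → proj₁ (cover z t≰z))
  λ {(y , p)} {(z , q)} le → subst₂ (DecRel._≤_ Z) (proj₂ (cover y p)) (proj₂ (cover z q)) (mono le)

data SumRel {A B : Set} (R : A → A → Set) (S : B → B → Set) : A ⊎ B → A ⊎ B → Set where
  inj₁ : ∀ {a a′} → R a a′ → SumRel R S (inj₁ a) (inj₁ a′)
  inj₂ : ∀ {b b′} → S b b′ → SumRel R S (inj₂ b) (inj₂ b′)

infixr 5 _⊎ᴿ_
_⊎ᴿ_ : DecRel → DecRel → DecRel
X ⊎ᴿ Y = record { Carrier = X.Carrier ⊎ Y.Carrier ; _≤_ = SumRel X._≤_ Y._≤_ ; _≤?_ = dec }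
  where
  module X = DecRel X
  module Y = DecRel Y
  dec : ∀ x y → Dec (SumRel X._≤_ Y._≤_ x y)
  dec (inj₁ a) (inj₁ b) with a X.≤? b
  ... | yes p = yes (inj₁ p)
  ... | no ¬p = no λ { (inj₁ p) → ¬p p }
  dec (inj₂ a) (inj₂ b) with a Y.≤? b
  ... | yes p = yes (inj₂ p)
  ... | no ¬p = no λ { (inj₂ p) → ¬p p }
  dec (inj₁ a) (inj₂ b) = no λ ()
  dec (inj₂ a) (inj₁ b) = no λ ()

infixr 6 _×ᴿ_
_×ᴿ_ : DecRel → DecRel → DecRel
X ×ᴿ Y = record
  { Carrier = X.Carrier × Y.Carrier
  ; _≤_     = λ x y → proj₁ x X.≤ proj₁ y × proj₂ x Y.≤ proj₂ y
  ; _≤?_    = λ x y → (proj₁ x X.≤? proj₁ y) ×-dec (proj₂ x Y.≤? proj₂ y)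
  }
  where
  module X = DecRel X
  module Y = DecRel Y

wqo-⊎ : ∀ {X Y} → WQO X → WQO Y → WQO (X ⊎ᴿ Y)
wqo-⊎ hX@(wqo h) hY@(wqo k) = wqo λ
  { (inj₁ x) → wqo-remainder (inj₁ x)
      (λ { (inj₁ (a , _)) → inj₁ a ; (inj₂ b) → inj₂ b })
      (λ { (inj₁ p) → inj₁ p ; (inj₂ p) → inj₂ p })
      (λ { (inj₁ a) n → inj₁ (a , λ p → n (inj₁ p)) , refl ; (inj₂ b) n → inj₂ b , refl })
      (wqo-⊎ (h x) hY)
  ; (inj₂ y) → wqo-remainder (inj₂ y)
      (λ { (inj₁ a) → inj₁ a ; (inj₂ (b , _)) → inj₂ b })
      (λ { (inj₁ p) → inj₁ p ; (inj₂ p) → inj₂ p })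
      (λ { (inj₁ a) n → inj₁ a , refl ; (inj₂ b) n → inj₂ (b , λ p → n (inj₂ p)) , refl })
      (wqo-⊎ hX (k y))
  }

-- A pair not above `(x , y)` fails in one of the coordinates, so the pairs left over are covered by
-- two products, each with one factor made smaller.
wqo-× : ∀ {X Y} → WQO X → WQO Y → WQO (X ×ᴿ Y)
wqo-× {X} {Y} hX@(wqo h) hY@(wqo k) = wqo λ (x , y) → wqo-remainder (x , y)
  (λ { (inj₁ ((a , _) , b)) → a , b ; (inj₂ (a , (b , _))) → a , b })
  (λ { (inj₁ p) → p ; (inj₂ p) → p })
  (λ (a , b) n → case DecRel._≤?_ X x a of λ
    { (yes p) → inj₂ (a , (b , λ q → n (p , q))) , refl
    ; (no ¬p) → inj₁ ((a , ¬p) , b) , refl })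
  (wqo-⊎ (wqo-× (h x) hY) (wqo-× hX (k y)))

≡-rel : (A : Set) → (∀ (x y : A) → Dec (x ≡ y)) → DecRel
≡-rel A _≟_ = record { Carrier = A ; _≤_ = _≡_ ; _≤?_ = _≟_ }

⊥ᴿ ⊤ᴿ : DecRel
⊥ᴿ = ≡-rel ⊥ λ ()
⊤ᴿ = ≡-rel ⊤ λ _ _ → yes refl

wqo-⊥ : WQO ⊥ᴿ
wqo-⊥ = wqo λ ()

wqo-⊤ : WQO ⊤ᴿ
wqo-⊤ = wqo λ _ → wqo λ (_ , n) → ⊥-elim (n refl)

Finᴿ : ℕ → DecRel
Finᴿ n = ≡-rel (Fin n) Finₚ._≟_

wqo-Fin : ∀ n → WQO (Finᴿ n)
wqo-Fin zero    = wqo λ ()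
wqo-Fin (suc n) = wqo-comap (λ { zero → inj₁ tt ; (suc i) → inj₂ i })
  (λ { {zero} {zero} _ → refl ; {suc i} {suc j} (inj₂ p) → cong suc p
     ; {zero} {suc j} () ; {suc i} {zero} () })
  (wqo-⊎ wqo-⊤ (wqo-Fin n))

-- Goodness of a pair is expressed by its yielding an answer in Q, and the
-- sequence may itself break off with an answer.
Pair : (X : DecRel) (Q : Set) → Carrier X ⊎ Q → Carrier X ⊎ Q → Set
Pair X Q (inj₁ a) (inj₁ b) = DecRel._≤_ X a b → Q
Pair X Q (inj₁ _) (inj₂ _) = ⊤
Pair X Q (inj₂ _) _        = ⊤

-- Once the first entry `x` has been read, the rest of the sequence lives in `X ∖ x`, except that an
-- entry above `x` completes a good pair and is replaced by its answer. The recursion is on the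
-- proof of `WQO`.
wqo-search : ∀ {X} {Q : Set} → WQO X → (s : ℕ → Carrier X ⊎ Q) →
             (∀ i j → i ℕ.< j → Pair X Q (s i) (s j)) → Q
wqo-search {X} {Q} (wqo h) s pairs with s 0 | pairs 0
... | inj₂ q | _ = q
... | inj₁ x | pairs₀ = wqo-search (h x) (λ n → next (s (suc n)) (pairs₀ (suc n) (s≤s z≤n)))
    (λ i j i<j → restrict (s (suc i)) (s (suc j)) _ _ (pairs (suc i) (suc j) (s≤s i<j)))
  where
  next : ∀ y → Pair X Q (inj₁ x) y → Carrier (X ∖ x) ⊎ Q
  next (inj₂ q) _ = inj₂ q
  next (inj₁ y) p with DecRel._≤?_ X x y
  ... | yes x≤y = inj₂ (p x≤y)
  ... | no  x≰y = inj₁ (y , x≰y)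
  restrict : ∀ y z p q → Pair X Q y z → Pair (X ∖ x) Q (next y p) (next z q)
  restrict (inj₂ _) _ _ _ _ = tt
  restrict (inj₁ y) (inj₂ _) _ _ _ with DecRel._≤?_ X x y
  ... | yes _ = tt
  ... | no  _ = tt
  restrict (inj₁ y) (inj₁ z) _ _ r with DecRel._≤?_ X x y | DecRel._≤?_ X x z
  ... | yes _ | _     = tt
  ... | no  _ | yes _ = tt
  ... | no  _ | no  _ = r

wqo-goodPair : ∀ {X} → WQO X → (s : ℕ → Carrier X) →
               ∃[ i ] ∃[ j ] i ℕ.< j × DecRel._≤_ X (s i) (s j)
wqo-goodPair h s = wqo-search h (λ n → inj₁ (s n)) (λ i j i<j le → i , j , i<j , le)

-- Kruskal's theorem for trees with branching at most two

data Tree (A U B : Set) : Set where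
  leaf   : A → Tree A U B
  unary  : U → Tree A U B → Tree A U B
  binary : B → Tree A U B → Tree A U B → Tree A U B

module _ (𝔸 𝕌 𝔹 : DecRel) where
  private
    module A = DecRel 𝔸
    module U = DecRel 𝕌
    module B = DecRel 𝔹
    T : Set
    T = Tree A.Carrier U.Carrier B.Carrier

  infix 4 _⊴_
  data _⊴_ : T → T → Set where
    leaf      : ∀ {a a′} → a A.≤ a′ → leaf a ⊴ leaf a′
    unary     : ∀ {u u′ t t′} → u U.≤ u′ → t ⊴ t′ → unary u t ⊴ unary u′ t′
    binary    : ∀ {b b′ l l′ r r′} → b B.≤ b′ → l ⊴ l′ → r ⊴ r′ → binary b l r ⊴ binary b′ l′ r′
    belowᵘ    : ∀ {t u t′} → t ⊴ t′ → t ⊴ unary u t′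
    belowˡ    : ∀ {t b l r} → t ⊴ l → t ⊴ binary b l r
    belowʳ    : ∀ {t b l r} → t ⊴ r → t ⊴ binary b l r

  infix 4 _⊴?_
  _⊴?_ : ∀ s t → Dec (s ⊴ t)
  leaf a ⊴? leaf a′ with a A.≤? a′
  ... | yes p = yes (leaf p)
  ... | no ¬p = no λ { (leaf p) → ¬p p }
  leaf a ⊴? unary u t with leaf a ⊴? t
  ... | yes p = yes (belowᵘ p)
  ... | no ¬p = no λ { (belowᵘ p) → ¬p p }
  leaf a ⊴? binary b l r with leaf a ⊴? l | leaf a ⊴? r
  ... | yes p | _     = yes (belowˡ p)
  ... | no _  | yes p = yes (belowʳ p)
  ... | no ¬p | no ¬q = no λ { (belowˡ p) → ¬p p ; (belowʳ q) → ¬q q }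
  unary u s ⊴? leaf a = no λ ()
  unary u s ⊴? unary u′ t with unary u s ⊴? t | (u U.≤? u′) ×-dec (s ⊴? t)
  ... | yes p | _             = yes (belowᵘ p)
  ... | no _  | yes (p , q)   = yes (unary p q)
  ... | no ¬p | no ¬q         = no λ { (belowᵘ p) → ¬p p ; (unary p q) → ¬q (p , q) }
  unary u s ⊴? binary b l r with unary u s ⊴? l | unary u s ⊴? r
  ... | yes p | _     = yes (belowˡ p)
  ... | no _  | yes p = yes (belowʳ p)
  ... | no ¬p | no ¬q = no λ { (belowˡ p) → ¬p p ; (belowʳ q) → ¬q q }
  binary b l r ⊴? leaf a = no λ ()
  binary b l r ⊴? unary u t with binary b l r ⊴? t
  ... | yes p = yes (belowᵘ p)
  ... | no ¬p = no λ { (belowᵘ p) → ¬p p }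
  binary b l r ⊴? binary b′ l′ r′
    with binary b l r ⊴? l′ | binary b l r ⊴? r′ | (b B.≤? b′) ×-dec ((l ⊴? l′) ×-dec (r ⊴? r′))
  ... | yes p | _     | _                 = yes (belowˡ p)
  ... | no _  | yes p | _                 = yes (belowʳ p)
  ... | no _  | no _  | yes (p , q , s)   = yes (binary p q s)
  ... | no ¬p | no ¬q | no ¬s             =
    no λ { (belowˡ p) → ¬p p ; (belowʳ q) → ¬q q ; (binary p q s) → ¬s (p , q , s) }

  Treeᴿ : DecRel
  Treeᴿ = record { Carrier = T ; _≤_ = _⊴_ ; _≤?_ = _⊴?_ }

-- A tree s with t ⋬ s is coded by a tree over labels preceding those of t:
-- a node whose label dominates the root label of t has a child outside the
-- upward closure of a child of t, and that child is made part of the label.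
-- This uses up one arity, so the induction is lexicographic on the labels
-- of binary nodes, of unary nodes, of leaves, and on t.
mutual
  wqo-tree : ∀ {𝔸 𝕌 𝔹} → WQO 𝔹 → WQO 𝕌 → WQO 𝔸 → WQO (Treeᴿ 𝔸 𝕌 𝔹)
  wqo-tree hB hU hA = wqo λ t → wqo-tree∖ hB hU hA t

  wqo-tree∖ : ∀ {𝔸 𝕌 𝔹} → WQO 𝔹 → WQO 𝕌 → WQO 𝔸 → ∀ t → WQO (Treeᴿ 𝔸 𝕌 𝔹 ∖ t)
  wqo-tree∖ {𝔸} {𝕌} {𝔹} hB hU (wqo ha) (leaf a₀) =
    wqo-remainder (leaf a₀) d mono cover (wqo-tree hB hU (ha a₀))
    where
    d : Tree (Carrier (𝔸 ∖ a₀)) (Carrier 𝕌) (Carrier 𝔹) → Carrier (Treeᴿ 𝔸 𝕌 𝔹)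
    d (leaf (a , _)) = leaf a
    d (unary u t)    = unary u (d t)
    d (binary b l r) = binary b (d l) (d r)
    mono : ∀ {s t} → _⊴_ (𝔸 ∖ a₀) 𝕌 𝔹 s t → _⊴_ 𝔸 𝕌 𝔹 (d s) (d t)
    mono (leaf p)       = leaf p
    mono (unary p q)    = unary p (mono q)
    mono (binary p q r) = binary p (mono q) (mono r)
    mono (belowᵘ p)     = belowᵘ (mono p)
    mono (belowˡ p)     = belowˡ (mono p)
    mono (belowʳ p)     = belowʳ (mono p)
    cover : ∀ s → ¬ _⊴_ 𝔸 𝕌 𝔹 (leaf a₀) s → ∃[ x ] d x ≡ s
    cover (leaf a) n = leaf (a , λ p → n (leaf p)) , refl
    cover (unary u s) n with cover s (λ p → n (belowᵘ p))
    ... | x , refl = unary u x , refl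
    cover (binary b l r) n with cover l (λ p → n (belowˡ p)) | cover r (λ p → n (belowʳ p))
    ... | x , refl | y , refl = binary b x y , refl
  wqo-tree∖ {𝔸} {𝕌} {𝔹} hB hU@(wqo hu) hA (unary u₀ t₀) =
    wqo-remainder (unary u₀ t₀) d mono cover
      (wqo-tree hB (hu u₀) (wqo-⊎ hA (wqo-× hU (wqo-tree∖ hB hU hA t₀))))
    where
    𝔸′ : DecRel
    𝔸′ = 𝔸 ⊎ᴿ 𝕌 ×ᴿ (Treeᴿ 𝔸 𝕌 𝔹 ∖ t₀)
    d : Tree (Carrier 𝔸′) (Carrier (𝕌 ∖ u₀)) (Carrier 𝔹) → Carrier (Treeᴿ 𝔸 𝕌 𝔹)
    d (leaf (inj₁ a))             = leaf a
    d (leaf (inj₂ (u , (s , _)))) = unary u s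
    d (unary (u , _) t)           = unary u (d t)
    d (binary b l r)              = binary b (d l) (d r)
    mono : ∀ {s t} → _⊴_ 𝔸′ (𝕌 ∖ u₀) 𝔹 s t → _⊴_ 𝔸 𝕌 𝔹 (d s) (d t)
    mono (leaf (inj₁ p))       = leaf p
    mono (leaf (inj₂ (p , q))) = unary p q
    mono (unary p q)           = unary p (mono q)
    mono (binary p q r)        = binary p (mono q) (mono r)
    mono (belowᵘ p)            = belowᵘ (mono p)
    mono (belowˡ p)            = belowˡ (mono p)
    mono (belowʳ p)            = belowʳ (mono p)
    cover : ∀ s → ¬ _⊴_ 𝔸 𝕌 𝔹 (unary u₀ t₀) s → ∃[ x ] d x ≡ s
    cover (leaf a) n = leaf (inj₁ a) , refl
    cover (unary u s) n with DecRel._≤?_ 𝕌 u₀ u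
    ... | yes p = leaf (inj₂ (u , (s , λ q → n (unary p q)))) , refl
    ... | no ¬p with cover s (λ p → n (belowᵘ p))
    ...   | x , refl = unary (u , ¬p) x , refl
    cover (binary b l r) n with cover l (λ p → n (belowˡ p)) | cover r (λ p → n (belowʳ p))
    ... | x , refl | y , refl = binary b x y , refl
  wqo-tree∖ {𝔸} {𝕌} {𝔹} hB@(wqo hb) hU hA (binary b₀ l₀ r₀) =
    wqo-remainder (binary b₀ l₀ r₀) d mono cover
      (wqo-tree (hb b₀) (wqo-⊎ hU (wqo-⊎ (wqo-× hB (wqo-tree∖ hB hU hA l₀))
                                          (wqo-× hB (wqo-tree∖ hB hU hA r₀)))) hA)
    where
    𝕌′ : DecRel
    𝕌′ = 𝕌 ⊎ᴿ 𝔹 ×ᴿ (Treeᴿ 𝔸 𝕌 𝔹 ∖ l₀) ⊎ᴿ 𝔹 ×ᴿ (Treeᴿ 𝔸 𝕌 𝔹 ∖ r₀)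
    d : Tree (Carrier 𝔸) (Carrier 𝕌′) (Carrier (𝔹 ∖ b₀)) → Carrier (Treeᴿ 𝔸 𝕌 𝔹)
    d (leaf a)                                = leaf a
    d (unary (inj₁ u) t)                      = unary u (d t)
    d (unary (inj₂ (inj₁ (b , (s , _)))) t)   = binary b s (d t)
    d (unary (inj₂ (inj₂ (b , (s , _)))) t)   = binary b (d t) s
    d (binary (b , _) l r)                    = binary b (d l) (d r)
    mono : ∀ {s t} → _⊴_ 𝔸 𝕌′ (𝔹 ∖ b₀) s t → _⊴_ 𝔸 𝕌 𝔹 (d s) (d t)
    mono (leaf p)                          = leaf p
    mono (unary (inj₁ p) q)                = unary p (mono q)
    mono (unary (inj₂ (inj₁ (p , q))) r)   = binary p q (mono r)
    mono (unary (inj₂ (inj₂ (p , q))) r)   = binary p (mono r) q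
    mono (binary p q r)                    = binary p (mono q) (mono r)
    mono (belowᵘ {u = inj₁ _} p)           = belowᵘ (mono p)
    -- Such a unary node codes a binary one whose left child is stored in the label, so the tree
    -- below it is the right child; in the next clause the roles are exchanged.
    mono (belowᵘ {u = inj₂ (inj₁ _)} p)    = belowʳ (mono p)
    mono (belowᵘ {u = inj₂ (inj₂ _)} p)    = belowˡ (mono p)
    mono (belowˡ p)                        = belowˡ (mono p)
    mono (belowʳ p)                        = belowʳ (mono p)
    cover : ∀ s → ¬ _⊴_ 𝔸 𝕌 𝔹 (binary b₀ l₀ r₀) s → ∃[ x ] d x ≡ s
    cover (leaf a) n = leaf a , refl
    cover (unary u s) n with cover s (λ p → n (belowᵘ p))
    ... | x , refl = unary (inj₁ u) x , refl
    cover (binary b l r) n with cover l (λ p → n (belowˡ p)) | cover r (λ p → n (belowʳ p))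
    ... | x , eq | y , eq′ with DecRel._≤?_ 𝔹 b₀ b
    ...   | no ¬p = binary (b , ¬p) x y , cong₂ (binary b) eq eq′
    ...   | yes p with _⊴?_ 𝔸 𝕌 𝔹 l₀ l
    ...     | no ¬q = unary (inj₂ (inj₁ (b , (l , ¬q)))) y , cong (binary b l) eq′
    ...     | yes q = unary (inj₂ (inj₂ (b , (r , λ q′ → n (binary p q q′))))) x ,
                      cong (λ z → binary b z r) eq

-- Planar rooted forests

-- A forest is the list of the edges leaving the root; `node A B` is an edge
-- whose far end carries A, followed by B.  Nodes stand both for edges and
-- for their far ends, and are listed in preorder.
data Forest : Set where
  []   : Forest
  node : (A B : Forest) → Forest

data Node : Forest → Set where
  here  : ∀ {A B} → Node (node A B)
  down  : ∀ {A B} → Node A → Node (node A B)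
  right : ∀ {A B} → Node B → Node (node A B)

private
  variable
    A B F F′ : Forest

size : Forest → ℕ
size []         = 0
size (node A B) = suc (size A ℕ.+ size B)

enc : Node F → Fin (size F)
enc here                    = zero
enc (down {A} {B} x)        = suc (enc x ↑ˡ size B)
enc (right {A} {B} x)       = suc (size A ↑ʳ enc x)

dec : Fin (size F) → Node F
dec {node A B} zero    = here
dec {node A B} (suc i) = [ (λ j → down (dec j)) , (λ j → right (dec j)) ]′ (splitAt (size A) i)

dec-enc : (x : Node F) → dec (enc x) ≡ x
dec-enc here = refl
dec-enc (down {A} {B} x) rewrite Finₚ.splitAt-↑ˡ (size A) (enc x) (size B) = cong down (dec-enc x)
dec-enc (right {A} {B} x) rewrite Finₚ.splitAt-↑ʳ (size A) (size B) (enc x) = cong right (dec-enc x)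

enc-dec : (i : Fin (size F)) → enc (dec {F} i) ≡ i
enc-dec {node A B} zero = refl
enc-dec {node A B} (suc i) with splitAt (size A) i in eq
... | inj₁ j = cong suc (trans (cong (_↑ˡ size B) (enc-dec j)) (Finₚ.splitAt⁻¹-↑ˡ eq))
... | inj₂ j = cong suc (trans (cong (size A ↑ʳ_) (enc-dec j)) (Finₚ.splitAt⁻¹-↑ʳ eq))

infix 4 _≺_ _⊑ᴺ_

data _≺_ : Node F → Node F → Set where
  here≺down  : ∀ {x : Node A} → here {A} {B} ≺ down x
  here≺right : ∀ {x : Node B} → here {A} {B} ≺ right x
  down≺right : ∀ {x : Node A} {y : Node B} → down x ≺ right y
  down       : ∀ {x y : Node A} → x ≺ y → down {A} {B} x ≺ down y
  right      : ∀ {x y : Node B} → x ≺ y → right {A} {B} x ≺ right y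

-- Ancestor or equal. No constructor leads from `here` to `right`: the first edges of `B` start at
-- the same vertex as `here` and do not hang from it.
data _⊑ᴺ_ : Node F → Node F → Set where
  here⊑here : here {A} {B} ⊑ᴺ here
  here⊑down : ∀ {x : Node A} → here {A} {B} ⊑ᴺ down x
  down      : ∀ {x y : Node A} → x ⊑ᴺ y → down {A} {B} x ⊑ᴺ down y
  right     : ∀ {x y : Node B} → x ⊑ᴺ y → right {A} {B} x ⊑ᴺ right y

⊑ᴺ-refl : (x : Node F) → x ⊑ᴺ x
⊑ᴺ-refl here      = here⊑here
⊑ᴺ-refl (down x)  = down (⊑ᴺ-refl x)
⊑ᴺ-refl (right x) = right (⊑ᴺ-refl x)

≺-trichotomy : (x y : Node F) → x ≺ y ⊎ x ≡ y ⊎ y ≺ x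
≺-trichotomy here here           = inj₂ (inj₁ refl)
≺-trichotomy here (down y)       = inj₁ here≺down
≺-trichotomy here (right y)      = inj₁ here≺right
≺-trichotomy (down x) here       = inj₂ (inj₂ here≺down)
≺-trichotomy (down x) (right y)  = inj₁ down≺right
≺-trichotomy (right x) here      = inj₂ (inj₂ here≺right)
≺-trichotomy (right x) (down y)  = inj₂ (inj₂ down≺right)
≺-trichotomy (down x) (down y) with ≺-trichotomy x y
... | inj₁ p        = inj₁ (down p)
... | inj₂ (inj₁ p) = inj₂ (inj₁ (cong down p))
... | inj₂ (inj₂ p) = inj₂ (inj₂ (down p))
≺-trichotomy (right x) (right y) with ≺-trichotomy x y
... | inj₁ p        = inj₁ (right p)
... | inj₂ (inj₁ p) = inj₂ (inj₁ (cong right p))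
... | inj₂ (inj₂ p) = inj₂ (inj₂ (right p))

enc-mono : {x y : Node F} → x ≺ y → enc x Fin.< enc y
enc-mono here≺down  = s≤s z≤n
enc-mono here≺right = s≤s z≤n
enc-mono (down≺right {A} {B} {x} {y}) = s≤s (subst₂ ℕ._<_
  (sym (Finₚ.toℕ-↑ˡ (enc x) (size B))) (sym (Finₚ.toℕ-↑ʳ (size A) (enc y)))
  (ℕₚ.<-≤-trans (Finₚ.toℕ<n (enc x)) (ℕₚ.m≤m+n (size A) _)))
enc-mono (down {A} {B} {x} {y} p) = s≤s (subst₂ ℕ._<_
  (sym (Finₚ.toℕ-↑ˡ (enc x) (size B))) (sym (Finₚ.toℕ-↑ˡ (enc y) (size B))) (enc-mono p))
enc-mono (right {B} {A} {x} {y} p) = s≤s (subst₂ ℕ._<_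
  (sym (Finₚ.toℕ-↑ʳ (size A) (enc x))) (sym (Finₚ.toℕ-↑ʳ (size A) (enc y)))
  (ℕₚ.+-monoʳ-< (size A) (enc-mono p)))

dec-mono : {i j : Fin (size F)} → i Fin.< j → dec i ≺ dec j
dec-mono {F} {i} {j} i<j with ≺-trichotomy (dec {F} i) (dec j)
... | inj₁ p = p
... | inj₂ (inj₁ p) = contradiction i<j (ℕₚ.<-irrefl
        (cong toℕ (trans (sym (enc-dec i)) (trans (cong enc p) (enc-dec j)))))
... | inj₂ (inj₂ p) = contradiction i<j (ℕₚ.<-asym (subst₂ Fin._<_ (enc-dec j) (enc-dec i) (enc-mono p)))

-- Vertices of the tree: `nothing` is the root.
inDown : Maybe (Node A) → Maybe (Node (node A B))
inDown nothing  = just here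
inDown (just x) = just (down x)

inRight : Maybe (Node B) → Maybe (Node (node A B))
inRight nothing  = nothing
inRight (just x) = just (right x)

parent : Node F → Maybe (Node F)
parent here      = nothing
parent (down x)  = inDown (parent x)
parent (right x) = inRight (parent x)

encᵛ : Maybe (Node F) → Fin (suc (size F))
encᵛ nothing  = zero
encᵛ (just x) = suc (enc x)

parent-≤ : (x : Node F) → toℕ (encᵛ (parent x)) ℕ.≤ toℕ (enc x)
parent-≤ here = z≤n
parent-≤ (down {A} {B} x) with parent x | parent-≤ x
... | nothing | p = s≤s z≤n
... | just y  | p = s≤s (subst₂ ℕ._≤_
  (cong suc (sym (Finₚ.toℕ-↑ˡ (enc y) (size B)))) (sym (Finₚ.toℕ-↑ˡ (enc x) (size B))) p)
parent-≤ (right {A} {B} x) with parent x | parent-≤ x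
... | nothing | p = z≤n
... | just y  | p = s≤s (subst₂ ℕ._≤_
  (trans (ℕₚ.+-suc (size A) _) (cong suc (sym (Finₚ.toℕ-↑ʳ (size A) (enc y)))))
  (sym (Finₚ.toℕ-↑ʳ (size A) (enc x))) (ℕₚ.+-monoʳ-≤ (size A) p))

-- Rooted trees with vertices Fin (suc n), root zero, and an edge from each
-- vertex suc j to its parent.
record ParentArray (n : ℕ) : Set where
  field
    par  : Fin n → Fin (suc n)
    par≤ : ∀ j → toℕ (par j) ℕ.≤ toℕ j

  infix 4 _⊑_
  -- Membership of an edge in the path from the root to a vertex. Edges and vertices are numbered
  -- apart, edge `j` ending at vertex `suc j`.
  data _⊑_ : Fin n → Fin (suc n) → Set where
    self : ∀ {i} → i ⊑ suc i
    up   : ∀ {i j} → i ⊑ par j → i ⊑ suc j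

  ⊑⇒< : ∀ {i v} → i ⊑ v → toℕ i ℕ.< toℕ v
  ⊑⇒< self         = ℕₚ.≤-refl
  ⊑⇒< (up {j = j} p) = s≤s (ℕₚ.<⇒≤ (ℕₚ.<-≤-trans (⊑⇒< p) (par≤ j)))

  ⊑-par⇒≢ : ∀ {i j} → i ⊑ par j → i ≢ j
  ⊑-par⇒≢ {j = j} p refl = ℕₚ.<-irrefl refl (ℕₚ.<-≤-trans (⊑⇒< p) (par≤ j))

  ⊑-suc⁻¹ : ∀ {i j} → i ⊑ suc j → i ≡ j ⊎ i ⊑ par j
  ⊑-suc⁻¹ self   = inj₁ refl
  ⊑-suc⁻¹ (up p) = inj₂ p

  -- Numbers grow away from the root, so the edge ending at a vertex has the largest number on its
  -- path. A vertex is therefore known from the edges above it, which is why morphisms can be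
  -- described by edges alone.
  ⊑-antisym : ∀ {v w} → (∀ i → i ⊑ v → i ⊑ w) → (∀ i → i ⊑ w → i ⊑ v) → v ≡ w
  ⊑-antisym {zero}  {zero}  f g = refl
  ⊑-antisym {zero}  {suc j} f g = case g j self of λ ()
  ⊑-antisym {suc i} {zero}  f g = case f i self of λ ()
  ⊑-antisym {suc i} {suc j} f g = cong suc (Finₚ.toℕ-injective
    (ℕₚ.≤-antisym (ℕₚ.≤-pred (⊑⇒< (f i self))) (ℕₚ.≤-pred (⊑⇒< (g j self)))))

  vertex-rec : (P : Fin (suc n) → Set) → P zero → (∀ j → P (par j) → P (suc j)) → ∀ v → P v
  vertex-rec P z s v = go (toℕ v) v ℕₚ.≤-refl
    where
    go : ∀ k v → toℕ v ℕ.≤ k → P v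
    go _       zero    _       = z
    go (suc k) (suc j) (s≤s q) = s j (go k (par j) (ℕₚ.≤-trans (par≤ j) q))

  _⊑?_ : ∀ i v → Dec (i ⊑ v)
  i ⊑? v = vertex-rec (λ v → Dec (i ⊑ v)) (no λ ()) step v
    where
    step : ∀ j → Dec (i ⊑ par j) → Dec (i ⊑ suc j)
    step j (yes p) = yes (up p)
    step j (no ¬p) with i Finₚ.≟ j
    ... | yes refl = yes self
    ... | no  i≢j  = no λ p → case ⊑-suc⁻¹ p of λ { (inj₁ q) → i≢j q ; (inj₂ q) → ¬p q }

parents : (F : Forest) → ParentArray (size F)
parents F = record
  { par  = λ i → encᵛ (parent (dec {F} i))
  ; par≤ = λ i → subst (λ j → toℕ (encᵛ (parent (dec {F} i))) ℕ.≤ toℕ j) (enc-dec i)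
             (parent-≤ (dec {F} i))
  }

⊑ᴺ-parent : {x : Node F} (y : Node F) → ∀ {z} → parent y ≡ just z → x ⊑ᴺ z → x ⊑ᴺ y
⊑ᴺ-parent (down y) eq p with parent y in eq′
⊑ᴺ-parent (down y) refl here⊑here | nothing = here⊑down
⊑ᴺ-parent (down y) refl here⊑down | just z  = here⊑down
⊑ᴺ-parent (down y) refl (down p)  | just z  = down (⊑ᴺ-parent y eq′ p)
⊑ᴺ-parent (right y) eq p with parent y in eq′
⊑ᴺ-parent (right y) refl (right p) | just z = right (⊑ᴺ-parent y eq′ p)

⊑ᴺ-step : {x y : Node F} → x ⊑ᴺ y → x ≡ y ⊎ (∃[ z ] parent y ≡ just z × x ⊑ᴺ z)
⊑ᴺ-step here⊑here = inj₁ refl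
⊑ᴺ-step (here⊑down {x = x}) with parent x
... | nothing = inj₂ (_ , refl , here⊑here)
... | just y  = inj₂ (_ , refl , here⊑down)
⊑ᴺ-step (down p) with ⊑ᴺ-step p
... | inj₁ refl          = inj₁ refl
... | inj₂ (z , eq , q)  = inj₂ (down z , cong inDown eq , down q)
⊑ᴺ-step (right p) with ⊑ᴺ-step p
... | inj₁ refl          = inj₁ refl
... | inj₂ (z , eq , q)  = inj₂ (right z , cong inRight eq , right q)

module _ {F : Forest} where
  open ParentArray (parents F)

  par-enc : (x : Node F) → par (enc x) ≡ encᵛ (parent x)
  par-enc x = cong (λ y → encᵛ (parent y)) (dec-enc x)

  ⊑ᴺ⇒⊑ : {x y : Node F} → x ⊑ᴺ y → enc x ⊑ suc (enc y)
  ⊑ᴺ⇒⊑ {x} {y} = go (suc (toℕ (enc y))) y ℕₚ.≤-refl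
    where
    go : ∀ k y → toℕ (enc y) ℕ.< k → x ⊑ᴺ y → enc x ⊑ suc (enc y)
    go (suc k) y (s≤s q) p with ⊑ᴺ-step p
    ... | inj₁ refl        = self
    ... | inj₂ (z , eq , r) = up (subst (enc x ⊑_) (sym par≡)
            (go k z (ℕₚ.≤-trans (subst (λ v → toℕ v ℕ.≤ toℕ (enc y)) (cong encᵛ eq) (parent-≤ y)) q) r))
      where
      par≡ : par (enc y) ≡ suc (enc z)
      par≡ = trans (par-enc y) (cong encᵛ eq)

  ⊑⇒⊑ᴺ : {x y : Node F} → enc x ⊑ suc (enc y) → x ⊑ᴺ y
  ⊑⇒⊑ᴺ p = go p refl refl
    where
    go : ∀ {x y : Node F} {i v} → i ⊑ v → i ≡ enc x → v ≡ suc (enc y) → x ⊑ᴺ y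
    go {x} {y} self eq eq′ = subst (x ⊑ᴺ_)
      (trans (sym (dec-enc x)) (trans (cong dec (trans (sym eq) (Finₚ.suc-injective eq′))) (dec-enc y))) (⊑ᴺ-refl x)
    go {x} {y} (up {j = j} p) eq eq′ with parent y in eq″
    ... | nothing = case subst (_ ⊑_) par≡ p of λ ()
      where
      par≡ : par j ≡ zero
      par≡ = trans (cong par (Finₚ.suc-injective eq′)) (trans (par-enc y) (cong encᵛ eq″))
    ... | just z = ⊑ᴺ-parent y eq″ (go {x} {z} p eq par≡)
      where
      par≡ : par j ≡ suc (enc z)
      par≡ = trans (cong par (Finₚ.suc-injective eq′)) (trans (par-enc y) (cong encᵛ eq″))

-- Embeddings of forests

record NodeEmbedding (F F′ : Forest) : Set where
  field
    ι    : Node F → Node F′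
    ≺⁺   : ∀ {x y} → x ≺ y → ι x ≺ ι y
    ⊑⁺   : ∀ {x y} → x ⊑ᴺ y → ι x ⊑ᴺ ι y
    ⊑⁻   : ∀ {x y} → ι x ⊑ᴺ ι y → x ⊑ᴺ y

open NodeEmbedding

emptyᴱ : NodeEmbedding [] F
emptyᴱ = record { ι = λ () ; ≺⁺ = λ { {()} } ; ⊑⁺ = λ { {()} } ; ⊑⁻ = λ { {()} } }

nodeᴱ : ∀ {A′ B′} → NodeEmbedding A A′ → NodeEmbedding B B′ →
        NodeEmbedding (node A B) (node A′ B′)
nodeᴱ α β = record
  { ι  = λ { here → here ; (down x) → down (ι α x) ; (right x) → right (ι β x) }
  ; ≺⁺ = λ { here≺down → here≺down ; here≺right → here≺right ; down≺right → down≺right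
           ; (down p) → down (≺⁺ α p) ; (right p) → right (≺⁺ β p) }
  ; ⊑⁺ = λ { here⊑here → here⊑here ; here⊑down → here⊑down
           ; (down p) → down (⊑⁺ α p) ; (right p) → right (⊑⁺ β p) }
  ; ⊑⁻ = λ { {here} {here} p → here⊑here ; {here} {down y} p → here⊑down
           ; {down x} {down y} (down p) → down (⊑⁻ α p)
           ; {right x} {right y} (right p) → right (⊑⁻ β p)
           ; {here} {right y} () ; {down x} {here} () ; {down x} {right y} ()
           ; {right x} {here} () ; {right x} {down y} () }
  }

downᴱ : NodeEmbedding F A → NodeEmbedding F (node A B)
downᴱ α = record
  { ι = λ x → down (ι α x) ; ≺⁺ = λ p → down (≺⁺ α p) ; ⊑⁺ = λ p → down (⊑⁺ α p)
  ; ⊑⁻ = λ { (down p) → ⊑⁻ α p } }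

rightᴱ : NodeEmbedding F B → NodeEmbedding F (node A B)
rightᴱ β = record
  { ι = λ x → right (ι β x) ; ≺⁺ = λ p → right (≺⁺ β p) ; ⊑⁺ = λ p → right (⊑⁺ β p)
  ; ⊑⁻ = λ { (right p) → ⊑⁻ β p } }

module _ (𝕃 : DecRel) where
  private module L = DecRel 𝕃

  labelled : (F : Forest) → (Node F → L.Carrier) → Tree ⊤ ⊥ L.Carrier
  labelled []         ℓ = leaf tt
  labelled (node A B) ℓ =
    binary (ℓ here) (labelled A (λ x → ℓ (down x))) (labelled B (λ x → ℓ (right x)))

  -- In the first child, next sibling code the proper descendants of a node form its left subtree. A
  -- homeomorphic embedding of codes sends left to left and right to right, hence preserves
  -- preorder, and both preserves and reflects ancestry.
  labelled-⊴ : ∀ F F′ (ℓ : Node F → L.Carrier) (ℓ′ : Node F′ → L.Carrier) →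
               _⊴_ ⊤ᴿ ⊥ᴿ 𝕃 (labelled F ℓ) (labelled F′ ℓ′) →
               Σ[ e ∈ NodeEmbedding F F′ ] (∀ x → ℓ x L.≤ ℓ′ (ι e x))
  labelled-⊴ [] F′ ℓ ℓ′ _ = emptyᴱ , λ ()
  labelled-⊴ (node A B) (node A′ B′) ℓ ℓ′ (binary p q r)
    with labelled-⊴ A A′ _ _ q | labelled-⊴ B B′ _ _ r
  ... | α , pα | β , pβ = nodeᴱ α β , λ { here → p ; (down x) → pα x ; (right x) → pβ x }
  labelled-⊴ F@(node _ _) (node A′ B′) ℓ ℓ′ (belowˡ p) with labelled-⊴ F A′ ℓ _ p
  ... | α , pα = downᴱ α , pα
  labelled-⊴ F@(node _ _) (node A′ B′) ℓ ℓ′ (belowʳ p) with labelled-⊴ F B′ ℓ _ p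
  ... | β , pβ = rightᴱ β , pβ

-- The category of marked planar trees

-- Each of the g pairs of marks is to become an edge outside the tree.
record MarkedForest (g : ℕ) : Set where
  field
    forest : Forest
    marks  : Vec (Fin (suc (size forest)) × Fin (suc (size forest))) g

  n : ℕ
  n = size forest

  shape : ParentArray n
  shape = parents forest

  open ParentArray shape public

  mark : Fin g → Sign → Fin (suc n)
  mark a Sign.+ = proj₁ (lookup marks a)
  mark a Sign.- = proj₂ (lookup marks a)

suc⁺ : ∀ {m n} → (Fin m → Fin n) → Fin (suc m) → Fin (suc n)
suc⁺ κ zero    = zero
suc⁺ κ (suc i) = suc (κ i)

module _ {m n} (P : ParentArray m) (Q : ParentArray n) (κ : Fin m → Fin n) where
  private
    module P = ParentArray P
    module Q = ParentArray Q

  -- Expresses that collapsing all edges outside the image of `κ` takes `w` to `v`: the retained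
  -- edges above `w` are those that come from edges above `v`.
  SameAncestors : Fin (suc m) → Fin (suc n) → Set
  SameAncestors v w = ∀ i → (i P.⊑ v → κ i Q.⊑ w) × (κ i Q.⊑ w → i P.⊑ v)

  sameAncestors-suc⁺ : (∀ j → SameAncestors (suc j) (suc (κ j))) → ∀ v → SameAncestors v (suc⁺ κ v)
  sameAncestors-suc⁺ h zero    i = (λ ()) , (λ ())
  sameAncestors-suc⁺ h (suc j) i = h j i

module _ {m n} {κ : Fin m → Fin n} (mono : ∀ {i j} → i Fin.< j → κ i Fin.< κ j) where

  mono⇒injective : ∀ {i j} → κ i ≡ κ j → i ≡ j
  mono⇒injective {i} {j} eq with Finₚ.<-cmp i j
  ... | tri< i<j _ _ = contradiction (mono i<j) (ℕₚ.<-irrefl (cong toℕ eq))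
  ... | tri≈ _ i≡j _ = i≡j
  ... | tri> _ _ j<i = contradiction (mono j<i) (ℕₚ.<-irrefl (cong toℕ (sym eq)))

  mono⇒≥ : ∀ i → toℕ i ℕ.≤ toℕ (κ i)
  mono⇒≥ i = go (toℕ i) i refl
    where
    go : ∀ k i → toℕ i ≡ k → k ℕ.≤ toℕ (κ i)
    go zero    i eq = z≤n
    go (suc k) i eq = ℕₚ.≤-<-trans (go k j j≡k) (mono (subst₂ ℕ._<_ (sym j≡k) (sym eq) ℕₚ.≤-refl))
      where
      k<m : k ℕ.< m
      k<m = ℕₚ.<-trans (ℕₚ.≤-reflexive (sym eq)) (Finₚ.toℕ<n i)
      j : Fin m
      j = Fin.fromℕ< k<m
      j≡k : toℕ j ≡ k
      j≡k = Finₚ.toℕ-fromℕ< k<m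

  mono⇒room : ∀ d i → toℕ i ℕ.+ d ℕ.< m → toℕ (κ i) ℕ.+ d ℕ.< n
  mono⇒room zero    i p = subst (ℕ._< n) (sym (ℕₚ.+-identityʳ _)) (Finₚ.toℕ<n (κ i))
  mono⇒room (suc d) i p = subst (ℕ._< n) (sym (ℕₚ.+-suc (toℕ (κ i)) d))
    (ℕₚ.<-≤-trans (s≤s (ℕₚ.+-monoˡ-< d (mono i<j))) (mono⇒room d j j+d<m))
    where
    p′ : suc (toℕ i ℕ.+ d) ℕ.< m
    p′ = subst (ℕ._< m) (ℕₚ.+-suc (toℕ i) d) p
    i+1<m : suc (toℕ i) ℕ.< m
    i+1<m = ℕₚ.≤-<-trans (s≤s (ℕₚ.m≤m+n (toℕ i) d)) p′
    j : Fin m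
    j = Fin.fromℕ< i+1<m
    j≡ : toℕ j ≡ suc (toℕ i)
    j≡ = Finₚ.toℕ-fromℕ< i+1<m
    i<j : i Fin.< j
    i<j = subst (toℕ i ℕ.<_) (sym j≡) ℕₚ.≤-refl
    j+d<m : toℕ j ℕ.+ d ℕ.< m
    j+d<m = subst (λ k → k ℕ.+ d ℕ.< m) (sym j≡) p′

  -- `κ i` has at least as many indices before it and after it as `i` has, and `n ≤ m` leaves no
  -- slack on either side.
  mono⇒toℕ≡ : n ℕ.≤ m → ∀ i → toℕ (κ i) ≡ toℕ i
  mono⇒toℕ≡ n≤m i = ℕₚ.≤-antisym (ℕₚ.+-cancelʳ-≤ d _ _ (ℕₚ.≤-pred room)) (mono⇒≥ i)
    where
    d : ℕ
    d = m ℕ.∸ suc (toℕ i)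
    i+d : suc (toℕ i ℕ.+ d) ≡ m
    i+d = ℕₚ.m+[n∸m]≡n (Finₚ.toℕ<n i)
    room : toℕ (κ i) ℕ.+ d ℕ.< suc (toℕ i ℕ.+ d)
    room = ℕₚ.<-≤-trans (mono⇒room d i (ℕₚ.≤-reflexive i+d)) (subst (n ℕ.≤_) (sym i+d) n≤m)

module _ {g : ℕ} where

  -- A mark of `y` is only required to collapse onto the corresponding mark of `x`; it may sit at
  -- any vertex of the fiber, not just at the end of a retained edge.
  record Embedding (x y : MarkedForest g) : Set where
    private
      module x = MarkedForest x
      module y = MarkedForest y
    field
      κ     : Fin x.n → Fin y.n
      mono  : ∀ {i j} → i Fin.< j → κ i Fin.< κ j
    _≋_ : Fin (suc x.n) → Fin (suc y.n) → Set
    _≋_ = SameAncestors x.shape y.shape κ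
    field
      nodes : ∀ j → suc j ≋ suc (κ j)
      marks : ∀ a s → x.mark a s ≋ y.mark a s

  idᴱ : ∀ {x} → Embedding x x
  idᴱ = record
    { κ = λ i → i ; mono = λ p → p
    ; nodes = λ j i → (λ p → p) , (λ p → p) ; marks = λ a s i → (λ p → p) , (λ p → p) }

  infixr 9 _∘ᴱ_
  _∘ᴱ_ : ∀ {x y z} → Embedding y z → Embedding x y → Embedding x z
  _∘ᴱ_ {x} {y} {z} f e = record
    { κ = λ i → f.κ (e.κ i) ; mono = λ p → f.mono (e.mono p)
    ; nodes = λ j → compose (e.nodes j) (f.nodes (e.κ j))
    ; marks = λ a s → compose (e.marks a s) (f.marks a s) }
    where
    module f = Embedding f
    module e = Embedding e
    compose : ∀ {u v w} → u e.≋ v → v f.≋ w →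
              SameAncestors (MarkedForest.shape x) (MarkedForest.shape z)
                            (λ i → f.κ (e.κ i)) u w
    compose p q i = (λ r → proj₁ (q (e.κ i)) (proj₁ (p i) r)) ,
                    (λ r → proj₂ (p i) (proj₂ (q (e.κ i)) r))

𝓕 : ℕ → Category 0ℓ 0ℓ 0ℓ
𝓕 g = record
  { Obj       = MarkedForest g
  ; Hom       = Embedding
  ; _≈_       = λ e f → ∀ i → Embedding.κ e i ≡ Embedding.κ f i
  ; id        = idᴱ
  ; _∘_       = _∘ᴱ_
  ; isEquiv   = record { refl = λ _ → refl ; sym = λ p i → sym (p i) ; trans = λ p q i → trans (p i) (q i) }
  ; ∘-resp-≈  = λ {_} {_} {_} {f} p q i → trans (cong (Embedding.κ f) (q i)) (p _)
  ; identityˡ = λ _ _ → refl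
  ; identityʳ = λ _ _ → refl
  ; assoc     = λ _ _ _ _ → refl
  }

-- The code of f is the number whose digits are the values of f; so codes
-- are compared lexicographically.
code : ∀ {m n} → (Fin m → Fin n) → ℕ
code f = toℕ (Fin.funToFin f)

code-cong : ∀ {m n} {f f′ : Fin m → Fin n} → (∀ i → f i ≡ f′ i) → code f ≡ code f′
code-cong p = cong toℕ (go p)
  where
  go : ∀ {m n} {f f′ : Fin m → Fin n} → (∀ i → f i ≡ f′ i) → Fin.funToFin f ≡ Fin.funToFin f′
  go {zero}  p = refl
  go {suc m} p = cong₂ Fin.combine (p zero) (go (λ i → p (suc i)))

code-injective : ∀ {m n} {f f′ : Fin m → Fin n} → code f ≡ code f′ → ∀ i → f i ≡ f′ i
code-injective {f = f} {f′} eq i =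
  trans (sym (Finₚ.finToFun-funToFin f i))
    (trans (cong (λ c → Fin.finToFun c i) (Finₚ.toℕ-injective eq)) (Finₚ.finToFun-funToFin f′ i))

combine-monoʳ-< : ∀ {m n} (i : Fin m) {k l : Fin n} → k Fin.< l → Fin.combine i k Fin.< Fin.combine i l
combine-monoʳ-< {n = n} i {k} {l} p = subst₂ ℕ._<_
  (sym (Finₚ.toℕ-combine i k)) (sym (Finₚ.toℕ-combine i l)) (ℕₚ.+-monoʳ-< (n ℕ.* toℕ i) p)

-- Applying `k` keeps the first index at which `f` and `f′` differ, and the sense in which they
-- differ there. The change of base from `n` to `n′` does not affect a lexicographic comparison.
code-mono : ∀ {m n n′} (k : Fin n → Fin n′) → (∀ {i j} → i Fin.< j → k i Fin.< k j) →
            {f f′ : Fin m → Fin n} → code f ℕ.< code f′ →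
            code (λ i → k (f i)) ℕ.< code (λ i → k (f′ i))
code-mono {zero}  k mono ()
code-mono {suc m} {n} k mono {f} {f′} lt with Finₚ.<-cmp (f zero) (f′ zero)
... | tri< p _ _ = Finₚ.combine-monoˡ-< (Fin.funToFin (λ i → k (f (suc i)))) _ (mono p)
... | tri> _ _ p = contradiction lt
        (ℕₚ.<-asym (Finₚ.combine-monoˡ-< (Fin.funToFin (λ i → f′ (suc i))) _ p))
... | tri≈ _ p _ = subst (λ v → toℕ (Fin.combine (k (f zero)) kf) ℕ.< toℕ (Fin.combine (k v) kf′)) p
        (combine-monoʳ-< (k (f zero)) {kf} {kf′}
          (code-mono k mono {λ i → f (suc i)} {λ i → f′ (suc i)} tails))
  where
  kf = Fin.funToFin (λ i → k (f (suc i)))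
  kf′ = Fin.funToFin (λ i → k (f′ (suc i)))
  tails : code (λ i → f (suc i)) ℕ.< code (λ i → f′ (suc i))
  tails with ℕₚ.<-cmp (code (λ i → f (suc i))) (code (λ i → f′ (suc i)))
  ... | tri< q _ _ = q
  ... | tri≈ _ q _ = contradiction lt (ℕₚ.<-irrefl (cong toℕ
          (cong₂ Fin.combine p (Finₚ.toℕ-injective q))))
  ... | tri> _ _ q = contradiction lt (ℕₚ.<-asym
          (subst (λ v → toℕ (Fin.combine (f′ zero) (Fin.funToFin (λ i → f′ (suc i)))) ℕ.<
                        toℕ (Fin.combine v (Fin.funToFin (λ i → f (suc i))))) (sym p)
                 (combine-monoʳ-< (f′ zero) q)))

code-cast : ∀ {m m′ n n′} (p : m ≡ m′) (q : n ≡ n′) {f : Fin m → Fin n} {f′ : Fin m′ → Fin n′} →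
            (∀ i → f′ (Fin.cast p i) ≡ Fin.cast q (f i)) → code f ≡ code f′
code-cast refl refl {f} {f′} h = code-cong λ i →
  sym (trans (cong f′ (sym (Finₚ.cast-is-id refl i))) (trans (h i) (Finₚ.cast-is-id refl (f i))))

code-cast⁻¹ : ∀ {m m′ n n′} (p : m ≡ m′) (q : n ≡ n′) {f : Fin m → Fin n} {f′ : Fin m′ → Fin n′} →
              code f ≡ code f′ → ∀ i → f′ (Fin.cast p i) ≡ Fin.cast q (f i)
code-cast⁻¹ refl refl {f} {f′} eq i =
  trans (cong f′ (Finₚ.cast-is-id refl i))
    (trans (sym (code-injective eq i)) (sym (Finₚ.cast-is-id refl (f i))))

module _ {m n} (P : ParentArray m) (Q : ParentArray n) (κ : Fin m → Fin n) where
  private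
    module P = ParentArray P
    module Q = ParentArray Q

  module _ (injective : ∀ {i j} → κ i ≡ κ j → i ≡ j)
           (same : ∀ j → SameAncestors P Q κ (suc j) (suc (κ j))) where

    -- The edges above a parent are those above the child other than the last one, and injectivity
    -- of `κ` keeps that edge apart from the others.
    sameAncestors-par : ∀ j → SameAncestors P Q κ (P.par j) (Q.par (κ j))
    sameAncestors-par j i = to , from
      where
      to : i P.⊑ P.par j → κ i Q.⊑ Q.par (κ j)
      to p with Q.⊑-suc⁻¹ (proj₁ (same j i) (P.up p))
      ... | inj₁ eq = contradiction (injective eq) (P.⊑-par⇒≢ p)
      ... | inj₂ q  = q
      from : κ i Q.⊑ Q.par (κ j) → i P.⊑ P.par j
      from p with P.⊑-suc⁻¹ (proj₂ (same j i) (Q.up p))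
      ... | inj₁ eq = contradiction (cong κ eq) (Q.⊑-par⇒≢ p)
      ... | inj₂ q  = q

  sameAncestors-unique : (∀ i → ∃[ j ] κ j ≡ i) → ∀ {v w w′} →
    SameAncestors P Q κ v w → SameAncestors P Q κ v w′ → w ≡ w′
  sameAncestors-unique surjective p q = Q.⊑-antisym
    (λ i r → case surjective i of λ { (j , refl) → proj₁ (q j) (proj₂ (p j) r) })
    (λ i r → case surjective i of λ { (j , refl) → proj₁ (p j) (proj₂ (q j) r) })

sameAncestors-cast : ∀ {m n} (P : ParentArray m) (Q : ParentArray n) (p : m ≡ n) →
  (∀ i → ParentArray.par Q (Fin.cast p i) ≡ Fin.cast (cong suc p) (ParentArray.par P i)) →
  ∀ v → SameAncestors P Q (Fin.cast p) v (Fin.cast (cong suc p) v)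
sameAncestors-cast P Q refl h v i rewrite Finₚ.cast-is-id refl i | Finₚ.cast-is-id refl v = to , from
  where
  module P = ParentArray P
  module Q = ParentArray Q
  par≡ : ∀ j → Q.par j ≡ P.par j
  par≡ j = trans (cong Q.par (sym (Finₚ.cast-is-id refl j))) (trans (h j) (Finₚ.cast-is-id refl _))
  to : ∀ {v} → i P.⊑ v → i Q.⊑ v
  to P.self = Q.self
  to (P.up {j = j} p) = Q.up (subst (i Q.⊑_) (sym (par≡ j)) (to p))
  from : ∀ {v} → i Q.⊑ v → i P.⊑ v
  from Q.self = P.self
  from (Q.up {j = j} p) = P.up (subst (i P.⊑_) (par≡ j) (from p))

-- Rigidity and the admissible order (G1)

module _ {g : ℕ} where
  open Category (𝓕 g) using (_≈_)
  open Gröbner (𝓕 g) using (Under; _~_)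
  open MarkedForest

  κ-injective : ∀ {x y : MarkedForest g} (f : Embedding x y) {i j} →
                Embedding.κ f i ≡ Embedding.κ f j → i ≡ j
  κ-injective f = mono⇒injective (Embedding.mono f)

  endomorphism-trivial : ∀ {x : MarkedForest g} (f : Embedding x x) → f ≈ idᴱ
  endomorphism-trivial f i = Finₚ.toℕ-injective (mono⇒toℕ≡ (Embedding.mono f) ℕₚ.≤-refl i)

  -- The order has to compare morphisms with different targets. An isomorphism of marked forests
  -- preserves all numbers, so size, parents and marks determine the target up to isomorphism. They
  -- come first; for a common target only the code of the embedding decides.
  key : ∀ {x} → Under x → List ℕ
  key (y , f) = n y ∷ code (par y) ∷ code (λ a → mark y a Sign.+) ∷ code (λ a → mark y a Sign.-)
              ∷ code (Embedding.κ f) ∷ []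

  ~⇒key≡ : ∀ {x} (f f′ : Under x) → f ~ f′ → key f ≡ key f′
  ~⇒key≡ {x} (y , f) (z , f′) (k , (k⁻¹ , _ , right-inverse) , kf≈f′) =
    cong₂ _∷_ n≡ (cong₂ _∷_ (code-cast n≡ (cong suc n≡) par≡)
      (cong₂ _∷_ (mark≡ Sign.+) (cong₂ _∷_ (mark≡ Sign.-)
        (cong₂ _∷_ (code-cast refl n≡ λ i → trans (cong f′.κ (Finₚ.cast-is-id refl i))
                                              (trans (sym (kf≈f′ i)) (κ≡cast (f.κ i)))) refl))))
    where
    module f = Embedding f
    module f′ = Embedding f′
    module k = Embedding k
    n≤ : n z ℕ.≤ n y
    n≤ = Finₚ.injective⇒≤ (κ-injective k⁻¹)
    n≡ : n y ≡ n z
    n≡ = ℕₚ.≤-antisym (Finₚ.injective⇒≤ (κ-injective k)) n≤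
    κ≡cast : ∀ i → k.κ i ≡ Fin.cast n≡ i
    κ≡cast i = Finₚ.toℕ-injective (trans (mono⇒toℕ≡ k.mono n≤ i) (sym (Finₚ.toℕ-cast n≡ i)))
    suc⁺≡cast : ∀ v → suc⁺ k.κ v ≡ Fin.cast (cong suc n≡) v
    suc⁺≡cast zero    = refl
    suc⁺≡cast (suc i) = cong suc (κ≡cast i)
    same⁺ : ∀ v → v k.≋ suc⁺ k.κ v
    same⁺ = sameAncestors-suc⁺ (shape y) (shape z) k.κ k.nodes
    unique : ∀ {v w w′} → v k.≋ w → v k.≋ w′ → w ≡ w′
    unique = sameAncestors-unique (shape y) (shape z) k.κ
      (λ i → Embedding.κ k⁻¹ i , right-inverse i)
    par≡ : ∀ i → par z (Fin.cast n≡ i) ≡ Fin.cast (cong suc n≡) (par y i)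
    par≡ i = trans (cong (par z) (sym (κ≡cast i))) (trans
      (unique (sameAncestors-par (shape y) (shape z) k.κ (κ-injective k) k.nodes i)
              (same⁺ (par y i)))
      (suc⁺≡cast (par y i)))
    mark≡ : ∀ s → code (λ a → mark y a s) ≡ code (λ a → mark z a s)
    mark≡ s = code-cast refl (cong suc n≡) λ a → trans (cong (λ b → mark z b s) (Finₚ.cast-is-id refl a))
      (trans (unique (k.marks a s) (same⁺ (mark y a s))) (suc⁺≡cast (mark y a s)))

  key≡⇒~ : ∀ {x} (f f′ : Under x) → Pointwise _≡_ (key f) (key f′) → f ~ f′
  key≡⇒~ {x} (y , f) (z , f′)
         (n≡ Pointwise.∷ par≡ Pointwise.∷ m⁺≡ Pointwise.∷ m⁻≡ Pointwise.∷ κ≡ Pointwise.∷ Pointwise.[]) =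
    isoOf y z n≡ par≡ m⁺≡ m⁻≡ ,
    (isoOf z y (sym n≡) (sym par≡) (sym m⁺≡) (sym m⁻≡) ,
      Finₚ.cast-involutive (sym n≡) n≡ , Finₚ.cast-involutive n≡ (sym n≡)) ,
    λ i → trans (sym (code-cast⁻¹ refl n≡ κ≡ i)) (cong (Embedding.κ f′) (Finₚ.cast-is-id refl i))
    where
    isoOf : ∀ y z → n y ≡ n z → code (par y) ≡ code (par z) →
      code (λ a → mark y a Sign.+) ≡ code (λ a → mark z a Sign.+) →
      code (λ a → mark y a Sign.-) ≡ code (λ a → mark z a Sign.-) → Embedding y z
    isoOf y z p q m m′ = record
      { κ     = Fin.cast p
      ; mono  = λ {i} {j} → subst₂ ℕ._<_ (sym (Finₚ.toℕ-cast p i)) (sym (Finₚ.toℕ-cast p j))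
      ; nodes = λ j → same (suc j)
      ; marks = λ { a Sign.+ → subst (_ ≋_) (mark≡ Sign.+ m a) (same _)
                  ; a Sign.- → subst (_ ≋_) (mark≡ Sign.- m′ a) (same _) }
      }
      where
      _≋_ : Fin (suc (n y)) → Fin (suc (n z)) → Set
      _≋_ = SameAncestors (shape y) (shape z) (Fin.cast p)
      same : ∀ v → v ≋ Fin.cast (cong suc p) v
      same = sameAncestors-cast (shape y) (shape z) p
               (code-cast⁻¹ p (cong suc p) q)
      mark≡ : ∀ s → code (λ a → mark y a s) ≡ code (λ a → mark z a s) →
              ∀ a → Fin.cast (cong suc p) (mark y a s) ≡ mark z a s
      mark≡ s eq a = trans (sym (code-cast⁻¹ refl (cong suc p) eq a))
                           (cong (λ b → mark z b s) (Finₚ.cast-is-id refl a))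

  infix 4 _≼_
  _≼_ : ∀ {x} → Under x → Under x → Set
  f ≼ f′ = Lex.Lex-≤ _≡_ ℕ._<_ (key f) (key f′)

  ≼-isTotalOrder : ∀ {x} → IsTotalOrder (_~_ {x}) _≼_
  ≼-isTotalOrder = record
    { isPartialOrder = record
      { isPreorder = record
        { isEquivalence = record
          { refl  = λ {f} → key≡⇒~ f f (Pointwise.refl refl)
          ; sym   = λ {f f′} p → key≡⇒~ f′ f (Pointwise.≡⇒Pointwise-≡ (sym (~⇒key≡ f f′ p)))
          ; trans = λ {f f′ f″} p q → key≡⇒~ f f″
              (Pointwise.≡⇒Pointwise-≡ (trans (~⇒key≡ f f′ p) (~⇒key≡ f′ f″ q)))
          }
        ; reflexive = λ {f f′} p → L.reflexive (Pointwise.≡⇒Pointwise-≡ (~⇒key≡ f f′ p))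
        ; trans     = λ {f f′ f″} → L.trans {key f} {key f′} {key f″}
        }
      ; antisym = λ {f f′} p q → key≡⇒~ f f′ (L.antisym p q)
      }
    ; total = λ f f′ → L.total (key f) (key f′)
    }
    where module L = IsTotalOrder (Lex.≤-isTotalOrder ℕₚ.<-isStrictTotalOrder)

  ≼-compatible : ∀ {x y z} (f f′ : Embedding x y) (k : Embedding y z) →
                 (y , f) ≼ (y , f′) → (z , k ∘ᴱ f) ≼ (z , k ∘ᴱ f′)
  ≼-compatible f f′ k p = keep (keep (keep (keep (last (drop (drop (drop (drop p))))))))
    where
    drop : ∀ {a as bs} → Lex.Lex-≤ _≡_ ℕ._<_ (a ∷ as) (a ∷ bs) → Lex.Lex-≤ _≡_ ℕ._<_ as bs
    drop (Lex.this p)   = contradiction p (ℕₚ.<-irrefl refl)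
    drop (Lex.next _ p) = p
    keep : ∀ {a as bs} → Lex.Lex-≤ _≡_ ℕ._<_ as bs → Lex.Lex-≤ _≡_ ℕ._<_ (a ∷ as) (a ∷ bs)
    keep = Lex.next refl
    last : Lex.Lex-≤ _≡_ ℕ._<_ (code (Embedding.κ f) ∷ []) (code (Embedding.κ f′) ∷ []) →
           Lex.Lex-≤ _≡_ ℕ._<_ (code (Embedding.κ (k ∘ᴱ f)) ∷ []) (code (Embedding.κ (k ∘ᴱ f′)) ∷ [])
    last (Lex.this p)    =
      Lex.this (code-mono (Embedding.κ k) (Embedding.mono k) {Embedding.κ f} {Embedding.κ f′} p)
    last (Lex.next eq p) = Lex.next (code-cong λ i → cong (Embedding.κ k)
      (code-injective {f = Embedding.κ f} {Embedding.κ f′} eq i)) p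

-- Well-quasi-ordering of the embeddings out of a marked forest

Vecᴿ : DecRel → ℕ → DecRel
Vecᴿ X zero    = ⊤ᴿ
Vecᴿ X (suc n) = X ×ᴿ Vecᴿ X n

wqo-Vec : ∀ {X} → WQO X → ∀ n → WQO (Vecᴿ X n)
wqo-Vec h zero    = wqo-⊤
wqo-Vec h (suc n) = wqo-× h (wqo-Vec h n)

tabulateᴿ : ∀ X {n} → (Fin n → Carrier X) → Carrier (Vecᴿ X n)
tabulateᴿ X {zero}  f = tt
tabulateᴿ X {suc n} f = f zero , tabulateᴿ X (λ i → f (suc i))

tabulateᴿ-lookup : ∀ X {n} {f f′ : Fin n → Carrier X} →
  DecRel._≤_ (Vecᴿ X n) (tabulateᴿ X f) (tabulateᴿ X f′) → ∀ i → DecRel._≤_ X (f i) (f′ i)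
tabulateᴿ-lookup X (p , _) zero    = p
tabulateᴿ-lookup X (_ , q) (suc i) = tabulateᴿ-lookup X q i

Boolᴿ : DecRel
Boolᴿ = ≡-rel Bool Boolₚ._≟_

wqo-Bool : WQO Boolᴿ
wqo-Bool = wqo-comap (λ b → if b then inj₁ tt else inj₂ tt)
  (λ { {true} {true} _ → refl ; {false} {false} _ → refl ; {true} {false} () ; {false} {true} () })
  (wqo-⊎ wqo-⊤ wqo-⊤)

does-true : ∀ {A : Set} (d : Dec A) → A → does d ≡ true
does-true (yes _) _ = refl
does-true (no ¬a) a = contradiction a ¬a

true-does : ∀ {A : Set} (d : Dec A) → does d ≡ true → A
true-does (yes a) _ = a

preimage : ∀ {m n} → (Fin m → Fin n) → Fin n → Fin (suc m)
preimage κ j with Finₚ.any? (λ i → κ i Finₚ.≟ j)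
... | yes (i , _) = suc i
... | no _        = zero

preimage-hit : ∀ {m n} (κ : Fin m → Fin n) → (∀ {i j} → κ i ≡ κ j → i ≡ j) →
               ∀ i → preimage κ (κ i) ≡ suc i
preimage-hit κ inj i with Finₚ.any? (λ j → κ j Finₚ.≟ κ i)
... | yes (j , eq) = cong suc (inj eq)
... | no ¬p        = contradiction (i , refl) ¬p

preimage-sound : ∀ {m n} (κ : Fin m → Fin n) {i j} → preimage κ j ≡ suc i → κ i ≡ j
preimage-sound κ {i} {j} eq with Finₚ.any? (λ i → κ i Finₚ.≟ j)
preimage-sound κ refl | yes (_ , eq) = eq

module _ {g : ℕ} where
  open Gröbner (𝓕 g) using (Under) renaming (_≤_ to _≤ᵁ_)
  open MarkedForest

  Marksᴿ : DecRel
  Marksᴿ = Vecᴿ (Boolᴿ ×ᴿ Boolᴿ) g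

  marksAt : (y : MarkedForest g) → Fin (suc (n y)) → Carrier Marksᴿ
  marksAt y v = tabulateᴿ (Boolᴿ ×ᴿ Boolᴿ)
    λ a → does (mark y a Sign.+ Finₚ.≟ v) , does (mark y a Sign.- Finₚ.≟ v)

  marksAt-≤ : ∀ {y z v w} → DecRel._≤_ Marksᴿ (marksAt y v) (marksAt z w) →
              ∀ a s → mark y a s ≡ v → mark z a s ≡ w
  marksAt-≤ p a Sign.+ eq with tabulateᴿ-lookup (Boolᴿ ×ᴿ Boolᴿ) p a
  ... | q , _ = true-does (_ Finₚ.≟ _) (trans (sym q) (does-true (_ Finₚ.≟ _) eq))
  marksAt-≤ p a Sign.- eq with tabulateᴿ-lookup (Boolᴿ ×ᴿ Boolᴿ) p a
  ... | _ , q = true-does (_ Finₚ.≟ _) (trans (sym q) (does-true (_ Finₚ.≟ _) eq))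

  embed : ∀ {y z : MarkedForest g} (e : NodeEmbedding (forest y) (forest z)) →
          (∀ a s → mark z a s ≡ suc⁺ (λ i → enc (ι e (dec {forest y} i))) (mark y a s)) →
          Embedding y z
  embed {y} {z} e h = record
    { κ     = κ′
    ; mono  = λ p → enc-mono (≺⁺ e (dec-mono p))
    ; nodes = same
    ; marks = λ a s → subst (SameAncestors (shape y) (shape z) κ′ (mark y a s))
        (sym (h a s)) (sameAncestors-suc⁺ (shape y) (shape z) κ′ same (mark y a s))
    }
    where
    κ′ : Fin (n y) → Fin (n z)
    κ′ i = enc (ι e (dec {forest y} i))
    same : ∀ j → SameAncestors (shape y) (shape z) κ′ (suc j) (suc (κ′ j))
    same j i =
      (λ p → ⊑ᴺ⇒⊑ (⊑⁺ e (⊑⇒⊑ᴺ (subst₂ (λ a b → _⊑_ y a (suc b)) (sym (enc-dec i)) (sym (enc-dec j)) p)))) ,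
      (λ p → subst₂ (λ a b → _⊑_ y a (suc b)) (enc-dec i) (enc-dec j) (⊑ᴺ⇒⊑ (⊑⁻ e (⊑⇒⊑ᴺ p))))

  module _ (x : MarkedForest g) where

    -- Labels come from a finite set and are compared by equality. Equal preimages make the
    -- resulting embedding commute with the two embeddings out of `x`; equal mark sets make it carry
    -- marks to marks. The root is no node, so its marks are recorded separately.
    Labelᴿ Underᴿ : DecRel
    Labelᴿ = Finᴿ (suc (n x)) ×ᴿ Marksᴿ
    Underᴿ = Marksᴿ ×ᴿ Treeᴿ ⊤ᴿ ⊥ᴿ Labelᴿ

    wqo-Under : WQO Underᴿ
    wqo-Under = wqo-× wqo-Marks (wqo-tree (wqo-× (wqo-Fin _) wqo-Marks) wqo-⊥ wqo-⊤)
      where wqo-Marks = wqo-Vec (wqo-× wqo-Bool wqo-Bool) g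

    label : ((y , f) : Under x) → Node (forest y) → Carrier Labelᴿ
    label (y , f) j = preimage (Embedding.κ f) (enc j) , marksAt y (suc (enc j))

    underCode : Under x → Carrier Underᴿ
    underCode (y , f) = marksAt y zero , labelled Labelᴿ (forest y) (label (y , f))

    underCode-reflects : ∀ f f′ → DecRel._≤_ Underᴿ (underCode f) (underCode f′) → f ≤ᵁ f′
    underCode-reflects (y , f) (z , f′) (root≤ , tree≤)
      with labelled-⊴ Labelᴿ (forest y) (forest z) (label (y , f)) (label (z , f′)) tree≤
    ... | e , label≤ = embed {y} {z} e mark≡ , commutes
      where
      κ′ : Fin (n y) → Fin (n z)
      κ′ i = enc (ι e (dec {forest y} i))
      mark≡ : ∀ a s → mark z a s ≡ suc⁺ κ′ (mark y a s)
      mark≡ a s with mark y a s in eq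
      ... | zero  = marksAt-≤ {y} {z} root≤ a s eq
      ... | suc i = marksAt-≤ {y} {z} (proj₂ (label≤ (dec {forest y} i))) a s
                      (trans eq (cong suc (sym (enc-dec i))))
      commutes : ∀ i → κ′ (Embedding.κ f i) ≡ Embedding.κ f′ i
      commutes i = sym (preimage-sound (Embedding.κ f′) (begin
        preimage (Embedding.κ f′) (κ′ fi)                  ≡⟨ proj₁ (label≤ (dec {forest y} fi)) ⟨
        preimage (Embedding.κ f) (enc (dec {forest y} fi)) ≡⟨ cong (preimage (Embedding.κ f)) (enc-dec fi) ⟩
        preimage (Embedding.κ f) fi                        ≡⟨ preimage-hit (Embedding.κ f) (κ-injective f) i ⟩
        suc i                                              ∎))
        where
        open ≡-Reasoning
        fi = Embedding.κ f i

𝓕-isGröbner : ∀ g → IsGröbner (𝓕 g)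
𝓕-isGröbner g = record
  { g1 = λ x → record { _≼_ = _≼_ ; isTotalOrder = ≼-isTotalOrder ; compatible = ≼-compatible }
  ; g2 = λ x f bad → case wqo-goodPair (wqo-Under x) (λ i → underCode x (f i)) of
      λ (i , j , i<j , p) → bad (i , j , i<j , underCode-reflects x (f i) (f j) p)
  ; noEndomorphism = endomorphism-trivial
  }

-- Recognising contractions

-- A contraction presented by a forest: `up v` is the first step from v to
-- the chosen vertex `top` of its fiber.
record CollapsingForest {G H : Multigraph} (f : Morphism G H) : Set where
  private
    module G = Multigraph G
    module H = Multigraph H
  open Morphism f
  field
    top          : H.V → G.V
    top-section  : ∀ w → vertex (top w) ≡ w
    up           : G.V → Maybe G.Dart
    rank         : G.V → ℕ
    up-nothing   : ∀ v → up v ≡ nothing → v ≡ top (vertex v)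
    up-just      : ∀ v {a s} → up v ≡ just (a , s) →
                   G.start a s ≡ v × edge a ≡ inj₁ (vertex v) ×
                   rank (G.start a (opposite s)) ℕ.< rank v
    collapsed-up : ∀ a {w} → edge a ≡ inj₁ w → ∃[ s ] up (G.start a s) ≡ just (a , s)
    lift         : ∀ b → ∃[ a ] ∃[ t ] edge a ≡ inj₂ (b , t)
    lift-unique  : ∀ {a a′ b t t′} → edge a ≡ inj₂ (b , t) → edge a′ ≡ inj₂ (b , t′) → a ≡ a′

≢⇒opposite : ∀ {s t : Sign} → s ≢ t → t ≡ opposite s
≢⇒opposite {Sign.+} {Sign.+} n = contradiction refl n
≢⇒opposite {Sign.+} {Sign.-} n = refl
≢⇒opposite {Sign.-} {Sign.+} n = refl
≢⇒opposite {Sign.-} {Sign.-} n = contradiction refl n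

Σ-≡-irrelevant : {A B : Set} {φ : A → B} {b : B} {x y : Σ[ a ∈ A ] φ a ≡ b} → proj₁ x ≡ proj₁ y → x ≡ y
Σ-≡-irrelevant {x = a , p} {.a , q} refl = cong (a ,_) (uip p q)

edgeFiber-contractible : ∀ {G H} (f : Morphism G H) {b} →
  (∃[ a ] ∃[ t ] Morphism.edge f a ≡ inj₂ (b , t)) →
  (∀ {a a′ t t′} → Morphism.edge f a ≡ inj₂ (b , t) → Morphism.edge f a′ ≡ inj₂ (b , t′) → a ≡ a′) →
  Multigraph.Contractible (EdgeFiber f b)
edgeFiber-contractible f {b} lifted unique =
  WalkProperties.discrete-contractible (EdgeFiber f b) (λ ()) lifted (λ x → irrelevant x lifted)
  where
  irrelevant : (x y : Multigraph.V (EdgeFiber f b)) → x ≡ y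
  irrelevant (a , t , p) (a′ , t′ , p′) with unique p p′
  ... | refl with trans (sym p) p′
  ...   | refl = cong (λ q → a , t , q) (uip p p′)

contractible⇒isContraction : ∀ {G H} {f : Morphism G H} →
  (∀ w → ∃[ v ] Morphism.vertex f v ≡ w) →
  (∀ b → ∃[ a ] ∃[ t ] Morphism.edge f a ≡ inj₂ (b , t)) →
  (∀ {a a′ b t t′} → Morphism.edge f a ≡ inj₂ (b , t) → Morphism.edge f a′ ≡ inj₂ (b , t′) → a ≡ a′) →
  (∀ w → Multigraph.Contractible (VertexFiber f w)) → IsContraction f
contractible⇒isContraction {f = f} surjᵛ surjᵉ unique contractibleᵛ = record
  { isSmooshing = record
    { surjectiveᵛ = surjᵛ
    ; surjectiveᵉ = surjᵉ
    ; connectedᵛ  = λ w → WalkProperties.contractible⇒connected (VertexFiber f w) (contractibleᵛ w)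
    ; connectedᵉ  = λ b → WalkProperties.contractible⇒connected (EdgeFiber f b) (contractibleᵉ b)
    }
  ; contractibleᵛ = contractibleᵛ
  ; contractibleᵉ = contractibleᵉ
  }
  where
  contractibleᵉ : ∀ b → Multigraph.Contractible (EdgeFiber f b)
  contractibleᵉ b = edgeFiber-contractible f (surjᵉ b) unique

module _ {G H : Multigraph} {f : Morphism G H} (F : CollapsingForest f) where
  private
    module G = Multigraph G
  open Morphism f
  open CollapsingForest F

  data Climb : G.V → Set where
    stop : ∀ {v} → up v ≡ nothing → Climb v
    rise : ∀ {v a s} → up v ≡ just (a , s) → Climb (G.start a (opposite s)) → Climb v

  climb : ∀ v → Climb v
  climb v = go (suc (rank v)) v ℕₚ.≤-refl
    where
    go : ∀ k v → rank v ℕ.< k → Climb v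
    go (suc k) v (s≤s le) with up v in eq
    ... | nothing      = stop eq
    ... | just (a , s) = rise eq (go k _ (ℕₚ.<-≤-trans (proj₂ (proj₂ (up-just v eq))) le))

  -- Lets a track be rewritten along any known first step without unfolding the recursion that built
  -- it.
  climb-unique : ∀ {v} (c d : Climb v) → c ≡ d
  climb-unique (stop p)   (stop q)   = cong stop (uip p q)
  climb-unique (stop p)   (rise q d) = case trans (sym p) q of λ ()
  climb-unique (rise p c) (stop q)   = case trans (sym p) q of λ ()
  climb-unique (rise p c) (rise q d) with trans (sym p) q
  ... | refl = cong₂ rise (uip p q) (climb-unique c d)

  module _ (w : Multigraph.V H) where
    private
      Aʷ = VertexFiber f w
      module Aʷ = Multigraph Aʷ

    walk : ∀ u → Climb (proj₁ u) → Aʷ.Walk u (top w , top-section w)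
    walk (v , p) (stop eq) = subst (λ z → Aʷ.Walk (v , p) z)
      (Σ-≡-irrelevant (trans (up-nothing v eq) (cong top p))) ε
    walk (v , p) (rise {a = a} {s} eq c) =
      Aʷ.step (a , trans (proj₁ (proj₂ (up-just v eq))) (cong inj₁ p)) s
             (Σ-≡-irrelevant (proj₁ (up-just v eq))) refl
      ◅ walk _ c

    track : ∀ u → Aʷ.Walk u (top w , top-section w)
    track u = walk u (climb (proj₁ u))

    track-step : ∀ {u v} (σ : Aʷ.Step u v) →
                 up (G.start (proj₁ (Aʷ.Step.edge σ)) (Aʷ.Step.sign σ)) ≡ just (proj₁ (Aʷ.Step.edge σ) , Aʷ.Step.sign σ) →
                 track u ≡ σ ◅ track v
    track-step (Aʷ.step (a , e) s refl refl) eq =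
      trans (cong (walk u) (climb-unique (climb (proj₁ u)) (rise eq (climb (G.start a (opposite s))))))
            (same (uip (trans (proj₁ (proj₂ (up-just (G.start a s) eq))) (cong inj₁ (proj₂ u))) e)
                  (Σ-≡-irrelevant (proj₁ (up-just (G.start a s) eq))))
      where
      u = Aʷ.start (a , e) s
      same : ∀ {e′ : edge a ≡ inj₁ w} → e′ ≡ e → (st : Aʷ.start (a , e′) s ≡ u) →
             Aʷ.step (a , e′) s st refl ◅ walk (Aʷ.start (a , e′) (opposite s)) (climb (G.start a (opposite s))) ≡
             Aʷ.step (a , e) s refl refl ◅ walk (Aʷ.start (a , e) (opposite s)) (climb (G.start a (opposite s)))
      same refl st rewrite uip st refl = refl

    -- By `collapsed-up` every edge of the fiber is the first step up from one of its ends. A step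
    -- therefore either begins the track of its source, or is undone by the first step of the track
    -- of its target.
    fiber-contractible : Aʷ.Contractible
    fiber-contractible = record { centre = top w , top-section w ; track = track ; square = square }
      where
      square : ∀ {u v} (σ : Aʷ.Step u v) → (σ ◅ track v) Aʷ.∼ track u
      square {u} {v} σ@(Aʷ.step (a , e) t st en) with collapsed-up a e
      ... | s , eq with t Signₚ.≟ s
      ...   | yes refl = WalkProperties.reflexive Aʷ (sym (track-step σ eq))
      ...   | no  t≢s  = Aʷ.∼-trans
        (WalkProperties.reflexive Aʷ (cong (σ ◅_) (track-step (Aʷ.reverse σ)
          (subst (λ r → up (G.start a r) ≡ just (a , r)) (≢⇒opposite t≢s) eq))))
        (Aʷ.∼-cancel σ (track u))

  collapsingForest⇒isContraction : IsContraction f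
  collapsingForest⇒isContraction = contractible⇒isContraction
    (λ w → top w , top-section w) lift lift-unique fiber-contractible

-- The graph of a marked forest

elim : ∀ {X : Set} {n g} → (Fin n → X) → (Fin g → X) → Fin (n ℕ.+ g) → X
elim {n = n} t m e = [ t , m ]′ (splitAt n e)

elim-tree : ∀ {X : Set} {n g} (t : Fin n → X) (m : Fin g → X) i → elim t m (i ↑ˡ g) ≡ t i
elim-tree {n = n} {g} t m i = cong [ t , m ]′ (Finₚ.splitAt-↑ˡ n i g)

elim-extra : ∀ {X : Set} {n g} (t : Fin n → X) (m : Fin g → X) a → elim t m (n ↑ʳ a) ≡ m a
elim-extra {n = n} {g} t m a = cong [ t , m ]′ (Finₚ.splitAt-↑ʳ n g a)

data EdgeView (n g : ℕ) : Fin (n ℕ.+ g) → Set where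
  tree  : ∀ j → EdgeView n g (j ↑ˡ g)
  extra : ∀ a → EdgeView n g (n ↑ʳ a)

edgeView : ∀ n g e → EdgeView n g e
edgeView n g e with splitAt n e in eq
... | inj₁ j = subst (EdgeView n g) (Finₚ.splitAt⁻¹-↑ˡ eq) (tree j)
... | inj₂ a = subst (EdgeView n g) (Finₚ.splitAt⁻¹-↑ʳ eq) (extra a)

module _ {g : ℕ} (x : MarkedForest g) where
  open MarkedForest x

  -- Tree edges are directed towards the root.
  treeEnd : Fin n → Sign → Fin (suc n)
  treeEnd j Sign.+ = suc j
  treeEnd j Sign.- = par j

  treeGraph : Graph
  treeGraph = record
    { #V = suc n ; #E = n ℕ.+ g
    ; start = λ e s → elim (λ j → treeEnd j s) (λ a → mark a s) e }

  start-tree : ∀ j s → Graph.start treeGraph (j ↑ˡ g) s ≡ treeEnd j s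
  start-tree j s = elim-tree (λ j → treeEnd j s) (λ a → mark a s) j

  start-extra : ∀ a s → Graph.start treeGraph (n ↑ʳ a) s ≡ mark a s
  start-extra a s = elim-extra (λ j → treeEnd j s) (λ a → mark a s) a

  treeGraph-connected : Graph.Connected treeGraph
  treeGraph-connected u v = toRoot u ◅◅ WalkProperties.rev T.multigraph (toRoot v)
    where
    module T = Graph treeGraph
    toRoot : ∀ v → T.Walk v zero
    toRoot = vertex-rec (λ v → T.Walk v zero) ε λ j p →
      T.step (j ↑ˡ g) Sign.+ (start-tree j Sign.+) (start-tree j Sign.-) ◅ p

module _ {g : ℕ} {x y : MarkedForest g} (e : Embedding x y) where
  private
    module x = MarkedForest x
    module y = MarkedForest y
    module X = Graph (treeGraph x)
    module Y = Graph (treeGraph y)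
  open Embedding e renaming (κ to κᵉ; nodes to nodesᵉ; marks to marksᵉ; mono to monoᵉ)

  inImage : ∀ j → Dec (∃[ i ] κᵉ i ≡ j)
  inImage j = Finₚ.any? (λ i → κᵉ i Finₚ.≟ j)

  ≋-unique : ∀ {v v′ w} → v ≋ w → v′ ≋ w → v ≡ v′
  ≋-unique p q = x.⊑-antisym (λ i r → proj₂ (q i) (proj₁ (p i) r)) (λ i r → proj₂ (p i) (proj₁ (q i) r))

  ≋-skip : ∀ {v j} → ¬ (∃[ i ] κᵉ i ≡ j) → v ≋ y.par j → v ≋ suc j
  ≋-skip {v} {j} n p i = (λ r → y.up (proj₁ (p i) r)) , from
    where
    from : κᵉ i y.⊑ suc j → i x.⊑ v
    from r with y.⊑-suc⁻¹ r
    ... | inj₁ eq = contradiction (i , eq) n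
    ... | inj₂ q  = proj₂ (p i) q

  -- A vertex goes to the deepest vertex of x that is retained among its
  -- ancestors.
  retract : ∀ w → ∃[ v ] v ≋ w
  retract = y.vertex-rec (λ w → ∃[ v ] v ≋ w) (zero , λ i → (λ ()) , (λ ())) step
    where
    step : ∀ j → (∃[ v ] v ≋ y.par j) → ∃[ v ] v ≋ suc j
    step j (v , p) with inImage j
    ... | yes (i , refl) = suc i , nodesᵉ i
    ... | no  n          = v , ≋-skip n p

  π : Fin (suc y.n) → Fin (suc x.n)
  π w = proj₁ (retract w)

  π-unique : ∀ {v w} → v ≋ w → π w ≡ v
  π-unique {w = w} p = ≋-unique (proj₂ (retract w)) p

  π-suc⁺ : ∀ v → π (suc⁺ κᵉ v) ≡ v
  π-suc⁺ v = π-unique (sameAncestors-suc⁺ x.shape y.shape κᵉ nodesᵉ v)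

  π-skip : ∀ {j} → ¬ (∃[ i ] κᵉ i ≡ j) → π (y.par j) ≡ π (suc j)
  π-skip {j} n = sym (π-unique (≋-skip n (proj₂ (retract (y.par j)))))

  treeImage : ∀ j → Dec (∃[ i ] κᵉ i ≡ j) → X.V ⊎ X.Dart
  treeImage j (yes (i , _)) = inj₂ (i ↑ˡ g , Sign.+)
  treeImage j (no _)        = inj₁ (π (suc j))

  edgeImage : Y.E → X.V ⊎ X.Dart
  edgeImage = elim (λ j → treeImage j (inImage j)) (λ a → inj₂ (x.n ↑ʳ a , Sign.+))

  edgeImage-tree : ∀ j → edgeImage (j ↑ˡ g) ≡ treeImage j (inImage j)
  edgeImage-tree = elim-tree (λ j → treeImage j (inImage j)) (λ a → inj₂ (x.n ↑ʳ a , Sign.+))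

  edgeImage-extra : ∀ a → edgeImage (y.n ↑ʳ a) ≡ inj₂ (x.n ↑ʳ a , Sign.+)
  edgeImage-extra = elim-extra (λ j → treeImage j (inImage j)) (λ a → inj₂ (x.n ↑ʳ a , Sign.+))

  treeImage-hit : ∀ i d → treeImage (κᵉ i) d ≡ inj₂ (i ↑ˡ g , Sign.+)
  treeImage-hit i (yes (i′ , eq)) = cong (λ k → inj₂ (k ↑ˡ g , Sign.+)) (mono⇒injective monoᵉ eq)
  treeImage-hit i (no n)          = contradiction (i , refl) n

  treeImage-compatible : ∀ j d s →
    π (treeEnd y j s) ≡ corner X.multigraph (treeImage j d) s
  treeImage-compatible j (no n) Sign.+ = refl
  treeImage-compatible j (no n) Sign.- = π-skip n
  treeImage-compatible _ (yes (i , refl)) Sign.+ =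
    trans (π-unique (nodesᵉ i)) (sym (start-tree x i Sign.+))
  treeImage-compatible _ (yes (i , refl)) Sign.- =
    trans (π-unique (sameAncestors-par x.shape y.shape κᵉ
                       (mono⇒injective monoᵉ) nodesᵉ i))
          (sym (start-tree x i Sign.-))

  collapse : Morphism Y.multigraph X.multigraph
  collapse = record { vertex = π ; edge = edgeImage ; compatible = λ b → compatible (edgeView y.n g b) }
    where
    compatible : ∀ {b} → EdgeView y.n g b → ∀ s → π (Y.start b s) ≡ corner X.multigraph (edgeImage b) s
    compatible (tree j) s = trans (cong π (start-tree y j s))
      (trans (treeImage-compatible j (inImage j) s)
             (cong (λ z → corner X.multigraph z s) (sym (edgeImage-tree j))))
    compatible (extra a) s = trans (cong π (start-extra y a s))
      (trans (trans (π-unique (marksᵉ a s)) (sym (start-extra x a s)))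
             (cong (λ z → corner X.multigraph z s) (sym (edgeImage-extra a))))

  collapse-isContraction : IsContraction collapse
  collapse-isContraction = collapsingForest⇒isContraction record
    -- The vertex of a fiber nearest the root is the root itself or the far end of a retained edge.
    -- From any other vertex the edge to its parent is collapsed, and the parent has a smaller
    -- number.
    { top          = suc⁺ κᵉ
    ; top-section  = π-suc⁺
    ; up           = up
    ; rank         = toℕ
    ; up-nothing   = λ { zero _ → cong (suc⁺ κᵉ) (sym (π-suc⁺ zero)) ; (suc j) → dart-nothing j (inImage j) }
    ; up-just      = λ { (suc j) → dart-just j (inImage j) refl }
    ; collapsed-up = λ b → collapsed (edgeView y.n g b)
    ; lift         = λ b → lift (edgeView x.n g b)
    ; lift-unique  = λ {a} {a′} → unique (edgeView y.n g a) (edgeView y.n g a′)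
    }
    where
    dart : ∀ j → Dec (∃[ i ] κᵉ i ≡ j) → Maybe Y.Dart
    dart j (yes _) = nothing
    dart j (no _)  = just (j ↑ˡ g , Sign.+)
    up : Y.V → Maybe Y.Dart
    up zero    = nothing
    up (suc j) = dart j (inImage j)
    dart-nothing : ∀ j d → dart j d ≡ nothing → suc j ≡ suc⁺ κᵉ (π (suc j))
    dart-nothing _ (yes (i , refl)) _ = cong (suc⁺ κᵉ) (sym (π-suc⁺ (suc i)))
    dart-just : ∀ j d → d ≡ inImage j → ∀ {a s} → dart j d ≡ just (a , s) →
                Y.start a s ≡ suc j × edgeImage a ≡ inj₁ (π (suc j)) ×
                toℕ (Y.start a (opposite s)) ℕ.< suc (toℕ j)
    dart-just j (no n) eq refl = start-tree y j Sign.+ ,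
      trans (edgeImage-tree j) (cong (treeImage j) (sym eq)) ,
      s≤s (subst (ℕ._≤ toℕ j) (cong toℕ (sym (start-tree y j Sign.-))) (y.par≤ j))
    collapsed : ∀ {b w} → EdgeView y.n g b → edgeImage b ≡ inj₁ w → ∃[ s ] up (Y.start b s) ≡ just (b , s)
    collapsed (extra a) eq = case trans (sym (edgeImage-extra a)) eq of λ ()
    collapsed (tree j) eq = Sign.+ , trans (cong up (start-tree y j Sign.+)) (missed (inImage j) (trans (sym (edgeImage-tree j)) eq))
      where
      missed : ∀ d {w} → treeImage j d ≡ inj₁ w → dart j d ≡ just (j ↑ˡ g , Sign.+)
      missed (no _) _ = refl
    lift : ∀ {b} → EdgeView x.n g b → ∃[ a ] ∃[ t ] edgeImage a ≡ inj₂ (b , t)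
    lift (tree i)  = κᵉ i ↑ˡ g , Sign.+ , trans (edgeImage-tree (κᵉ i)) (treeImage-hit i (inImage (κᵉ i)))
    lift (extra a) = y.n ↑ʳ a , Sign.+ , edgeImage-extra a
    hit : ∀ {j b t} d → treeImage j d ≡ inj₂ (b , t) → ∃[ i ] j ≡ κᵉ i × b ≡ i ↑ˡ g
    hit (yes (i , eq)) refl = i , sym eq , refl
    unique : ∀ {a a′ b t t′} → EdgeView y.n g a → EdgeView y.n g a′ →
             edgeImage a ≡ inj₂ (b , t) → edgeImage a′ ≡ inj₂ (b , t′) → a ≡ a′
    unique (tree j) (tree j′) p p′
      with hit (inImage j) (trans (sym (edgeImage-tree j)) p) | hit (inImage j′) (trans (sym (edgeImage-tree j′)) p′)
    ... | i , refl , refl | i′ , refl , eq = cong (λ k → κᵉ k ↑ˡ g) (Finₚ.↑ˡ-injective g i i′ eq)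
    unique (tree j) (extra a) p p′
      with hit (inImage j) (trans (sym (edgeImage-tree j)) p) | trans (sym (edgeImage-extra a)) p′
    ... | i , _ , eq | refl = contradiction (sym eq) (↑ˡ≢↑ʳ i a)
      where
      ↑ˡ≢↑ʳ : ∀ {n g} (i : Fin n) (a : Fin g) → i ↑ˡ g ≢ n ↑ʳ a
      ↑ˡ≢↑ʳ {n} {g} i a eq = case trans (sym (Finₚ.splitAt-↑ˡ n i g)) (trans (cong (splitAt n) eq) (Finₚ.splitAt-↑ʳ n g a)) of λ ()
    unique (extra a) (tree j) p p′ = sym (unique (tree j) (extra a) p′ p)
    unique (extra a) (extra a′) p p′
      with trans (sym (edgeImage-extra a)) p | trans (sym (edgeImage-extra a′)) p′
    ... | refl | q = cong (y.n ↑ʳ_) (sym (Finₚ.↑ʳ-injective x.n a′ a (cong proj₁ (inj₂-injective q))))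

-- Homology of the graph of a marked forest

δ : ∀ {n} → Fin n → Fin n → ℤ
δ u v = if does (u Finₚ.≟ v) then 1ℤ else 0ℤ

δ-refl : ∀ {n} (u : Fin n) → δ u u ≡ 1ℤ
δ-refl u with u Finₚ.≟ u
... | yes _ = refl
... | no  n = contradiction refl n

δ-≢ : ∀ {n} {u v : Fin n} → u ≢ v → δ u v ≡ 0ℤ
δ-≢ {u = u} {v} u≢v with u Finₚ.≟ v
... | yes p = contradiction p u≢v
... | no  _ = refl

δ-injective : ∀ {m n} {f : Fin m → Fin n} → (∀ {i j} → f i ≡ f j → i ≡ j) → ∀ u v → δ (f u) (f v) ≡ δ u v
δ-injective {f = f} inj u v with u Finₚ.≟ v
... | yes refl = δ-refl (f u)
... | no  u≢v  = δ-≢ λ p → u≢v (inj p)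

δ-comm : ∀ {n} (u v : Fin n) → δ u v ≡ δ v u
δ-comm u v with u Finₚ.≟ v
... | yes refl = sym (δ-refl u)
... | no  u≢v  = sym (δ-≢ λ p → u≢v (sym p))

sum-zero : ∀ {n} {t : Fin n → ℤ} → (∀ i → t i ≡ 0ℤ) → sum t ≡ 0ℤ
sum-zero {zero}  h = refl
sum-zero {suc n} h = cong₂ ℤ._+_ (h zero) (sum-zero λ i → h (suc i))

sum-δ : ∀ {n} (h : Fin n → ℤ) u → sum (λ v → h v ℤ.* δ u v) ≡ h u
sum-δ {suc n} h zero = trans
  (cong₂ ℤ._+_ (ℤₚ.*-identityʳ (h zero)) (sum-zero λ i → ℤₚ.*-zeroʳ (h (suc i))))
  (ℤₚ.+-identityʳ (h zero))
sum-δ {suc n} h (suc u) = trans (cong₂ ℤ._+_ (ℤₚ.*-zeroʳ (h zero))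
  (trans (sum-cong-≗ λ v → cong (h (suc v) ℤ.*_) (δ-injective Finₚ.suc-injective u v))
         (sum-δ (λ v → h (suc v)) u)))
  (ℤₚ.+-identityˡ (h (suc u)))

sum-++ : ∀ {n g} (t : Fin (n ℕ.+ g) → ℤ) → sum t ≡ sum (λ i → t (i ↑ˡ g)) ℤ.+ sum (λ a → t (n ↑ʳ a))
sum-++ {zero}  t = sym (ℤₚ.+-identityˡ _)
sum-++ {suc n} t = trans (cong (ℤ._+_ (t zero)) (sum-++ {n} λ i → t (suc i))) (sym (ℤₚ.+-assoc (t zero) _ _))

sum-*ˡ : ∀ {n} c (t : Fin n → ℤ) → c ℤ.* sum t ≡ sum (λ i → c ℤ.* t i)
sum-*ˡ c t = *-distribˡ-sum c t

sum-neg : ∀ {n} (t : Fin n → ℤ) → sum (λ i → ℤ.- t i) ≡ ℤ.- sum t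
sum-neg {zero}  t = refl
sum-neg {suc n} t = trans (cong (ℤ._+_ (ℤ.- t zero)) (sum-neg λ i → t (suc i))) (sym (ℤₚ.neg-distrib-+ (t zero) _))

sum-minus : ∀ {n} (f h : Fin n → ℤ) → sum (λ i → f i ℤ.- h i) ≡ sum f ℤ.- sum h
sum-minus {zero}  f h = refl
sum-minus {suc n} f h = trans (cong (ℤ._+_ (f zero ℤ.- h zero)) (sum-minus (λ i → f (suc i)) (λ i → h (suc i))))
  (exchange (f zero) (h zero) _ _)
  where
  exchange : ∀ a b c d → (a ℤ.- b) ℤ.+ (c ℤ.- d) ≡ (a ℤ.+ c) ℤ.- (b ℤ.+ d)
  exchange = solve-∀

-- The coboundary operator is adjoint to the boundary operator.
coboundary : (G : Graph) (z : Graph.Chain G) (h : Fin (Graph.#V G) → ℤ) →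
  sum (λ v → h v ℤ.* Graph.∂ G z v) ≡
  sum (λ a → z a ℤ.* (h (Graph.start G a Sign.-) ℤ.- h (Graph.start G a Sign.+)))
coboundary G z h = begin
  sum (λ v → h v ℤ.* ∂ z v)
    ≡⟨ sum-cong-≗ (λ v → sum-*ˡ (h v) (λ a → z a ℤ.* (δ (a⁻ a) v ℤ.- δ (a⁺ a) v))) ⟩
  sum (λ v → sum λ a → h v ℤ.* (z a ℤ.* (δ (a⁻ a) v ℤ.- δ (a⁺ a) v)))
    ≡⟨ ∑-comm (λ v a → h v ℤ.* (z a ℤ.* (δ (a⁻ a) v ℤ.- δ (a⁺ a) v))) ⟩
  sum (λ a → sum λ v → h v ℤ.* (z a ℤ.* (δ (a⁻ a) v ℤ.- δ (a⁺ a) v)))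
    ≡⟨ sum-cong-≗ (λ a → trans (sum-cong-≗ λ v → rearrange (h v) (z a) (δ (a⁻ a) v) (δ (a⁺ a) v))
                               (sym (sum-*ˡ (z a) (λ v → h v ℤ.* δ (a⁻ a) v ℤ.- h v ℤ.* δ (a⁺ a) v)))) ⟩
  sum (λ a → z a ℤ.* sum (λ v → h v ℤ.* δ (a⁻ a) v ℤ.- h v ℤ.* δ (a⁺ a) v))
    ≡⟨ sum-cong-≗ (λ a → cong (z a ℤ.*_) (trans (sum-minus (λ v → h v ℤ.* δ (a⁻ a) v) _)
                               (cong₂ ℤ._-_ (sum-δ h (a⁻ a)) (sum-δ h (a⁺ a))))) ⟩
  sum (λ a → z a ℤ.* (h (a⁻ a) ℤ.- h (a⁺ a))) ∎
  where
  open Graph G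
  open ≡-Reasoning
  a⁺ a⁻ : Fin #E → Fin #V
  a⁺ a = start a Sign.+
  a⁻ a = start a Sign.-
  rearrange : ∀ h z p q → h ℤ.* (z ℤ.* (p ℤ.- q)) ≡ z ℤ.* (h ℤ.* p ℤ.- h ℤ.* q)
  rearrange = solve-∀

module _ {g : ℕ} (x : MarkedForest g) where
  open MarkedForest x
  open Graph (treeGraph x) using (#E; ∂; IsCycle; combination; Chain)

  -- In `w`, the indicator of the vertices that removal of the edge `j` cuts off from the root; in
  -- `j`, the indicator of the path from the root to `w`.
  below : Fin n → Fin (suc n) → ℤ
  below j w = if does (j ⊑? w) then 1ℤ else 0ℤ

  below-suc : ∀ j k → below j (suc k) ≡ δ k j ℤ.+ below j (par k)
  below-suc j k with j ⊑? suc k | j ⊑? par k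
  ... | yes p | yes q = cong (ℤ._+ 1ℤ) (sym (δ-≢ {u = k} {j} λ { refl → ⊑-par⇒≢ q refl }))
  ... | yes self   | no ¬q = cong (ℤ._+ 0ℤ) (sym (δ-refl k))
  ... | yes (up p) | no ¬q = contradiction p ¬q
  ... | no ¬p | yes q = contradiction (up q) ¬p
  ... | no ¬p | no ¬q = cong (ℤ._+ 0ℤ) (sym (δ-≢ {u = k} {j} λ { refl → ¬p self }))

  -- Only the edges on the path between `w` and the root contribute, and along it the differences of
  -- `h` cancel in succession.
  telescope : ∀ (h : Fin (suc n) → ℤ) w →
    sum (λ j → below j w ℤ.* (h (par j) ℤ.- h (suc j))) ≡ h zero ℤ.- h w
  telescope h = vertex-rec _
    (trans (sum-zero {n} λ j → trans (cong (λ b → b ℤ.* (h (par j) ℤ.- h (suc j))) (below-zero j)) refl)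
           (sym (ℤₚ.+-inverseʳ (h zero))))
    λ k ih → begin
      sum (λ j → below j (suc k) ℤ.* φ j)
        ≡⟨ sum-cong-≗ (λ j → trans (cong (ℤ._* φ j) (below-suc j k)) (expand (δ k j) _ _)) ⟩
      sum (λ j → φ j ℤ.* δ k j ℤ.+ below j (par k) ℤ.* φ j)
        ≡⟨ ∑-distrib-+ (λ j → φ j ℤ.* δ k j) _ ⟩
      sum (λ j → φ j ℤ.* δ k j) ℤ.+ sum (λ j → below j (par k) ℤ.* φ j)
        ≡⟨ cong₂ ℤ._+_ (sum-δ φ k) ih ⟩
      (h (par k) ℤ.- h (suc k)) ℤ.+ (h zero ℤ.- h (par k))
        ≡⟨ cancel (h (par k)) (h (suc k)) (h zero) ⟩
      h zero ℤ.- h (suc k) ∎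
    where
    open ≡-Reasoning
    φ : Fin n → ℤ
    φ j = h (par j) ℤ.- h (suc j)
    below-zero : ∀ j → below j zero ≡ 0ℤ
    below-zero j with j ⊑? zero
    ... | no _ = refl
    expand : ∀ d b c → (d ℤ.+ b) ℤ.* c ≡ c ℤ.* d ℤ.+ b ℤ.* c
    expand = solve-∀
    cancel : ∀ p s z → (p ℤ.- s) ℤ.+ (z ℤ.- p) ≡ z ℤ.- s
    cancel = solve-∀

  -- The tree path that closes up the extra edge `a`: from its end up to the root, then down to its
  -- start. The part common to both ways cancels.
  detour : Fin g → Fin n → ℤ
  detour a j = below j (mark a Sign.-) ℤ.- below j (mark a Sign.+)

  fundamentalCycle : Fin g → Chain
  fundamentalCycle a = elim (detour a) (δ a)

  pairing : ∀ (z : Chain) (h : Fin (suc n) → ℤ) →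
    sum (λ a → z a ℤ.* (h (Graph.start (treeGraph x) a Sign.-) ℤ.- h (Graph.start (treeGraph x) a Sign.+))) ≡
    sum (λ j → z (j ↑ˡ g) ℤ.* (h (par j) ℤ.- h (suc j))) ℤ.+
    sum (λ a → z (n ↑ʳ a) ℤ.* (h (mark a Sign.-) ℤ.- h (mark a Sign.+)))
  pairing z h = trans (sum-++ {n} {g} _) (cong₂ ℤ._+_
    (sum-cong-≗ λ j → cong₂ (λ u v → z (j ↑ˡ g) ℤ.* (h u ℤ.- h v)) (start-tree x j Sign.-) (start-tree x j Sign.+))
    (sum-cong-≗ λ a → cong₂ (λ u v → z (n ↑ʳ a) ℤ.* (h u ℤ.- h v)) (start-extra x a Sign.-) (start-extra x a Sign.+)))

  fundamentalCycle-isCycle : ∀ a → IsCycle (fundamentalCycle a)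
  fundamentalCycle-isCycle a v = begin
    ∂ (fundamentalCycle a) v
      ≡⟨ pairing (fundamentalCycle a) h ⟩
    sum (λ j → fundamentalCycle a (j ↑ˡ g) ℤ.* φ j) ℤ.+ sum (λ b → fundamentalCycle a (n ↑ʳ b) ℤ.* ψ b)
      ≡⟨ cong₂ ℤ._+_
           (trans (sum-cong-≗ λ j → trans (cong (ℤ._* φ j) (elim-tree (detour a) (δ a) j)) (ℤₚ.*-distribʳ-+ (φ j) (below j (mark a Sign.-)) (ℤ.- below j (mark a Sign.+))))
             (trans (sum-cong-≗ λ j → cong (ℤ._+_ (below j (mark a Sign.-) ℤ.* φ j))
                                            (sym (ℤₚ.neg-distribˡ-* (below j (mark a Sign.+)) (φ j))))
             (trans (sum-minus (λ j → below j (mark a Sign.-) ℤ.* φ j) _)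
                    (cong₂ ℤ._-_ (telescope h (mark a Sign.-)) (telescope h (mark a Sign.+))))))
           (trans (sum-cong-≗ λ b → trans (cong (ℤ._* ψ b) (elim-extra (detour a) (δ a) b)) (ℤₚ.*-comm _ (ψ b)))
                  (sum-δ ψ a)) ⟩
    ((h zero ℤ.- h (mark a Sign.-)) ℤ.- (h zero ℤ.- h (mark a Sign.+))) ℤ.+ ψ a
      ≡⟨ cancel (h zero) (h (mark a Sign.-)) (h (mark a Sign.+)) ⟩
    0ℤ ∎
    where
    open ≡-Reasoning
    -- The coefficient of `v` in the boundary is the pairing with the coboundary of the indicator of
    -- `v`.
    h : Fin (suc n) → ℤ
    h u = δ u v
    φ : Fin n → ℤ
    φ j = h (par j) ℤ.- h (suc j)
    ψ : Fin g → ℤ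
    ψ b = h (mark b Sign.-) ℤ.- h (mark b Sign.+)
    cancel : ∀ z s t → ((z ℤ.- s) ℤ.- (z ℤ.- t)) ℤ.+ (s ℤ.- t) ≡ 0ℤ
    cancel = solve-∀

  -- Restricted to the extra edges, the fundamental cycles are the unit vectors. This gives their
  -- independence and dictates the coefficients with which they span.
  combination-extra : ∀ c a → combination c fundamentalCycle (n ↑ʳ a) ≡ c a
  combination-extra c a = trans
    (sum-cong-≗ λ i → cong (c i ℤ.*_) (trans (elim-extra (detour i) (δ i) a) (δ-comm i a)))
    (sum-δ c a)

  -- Pairing a cycle with the coboundary of `below j` isolates its j-th coefficient.
  cycle-tree : ∀ z → IsCycle z → ∀ j → z (j ↑ˡ g) ≡ combination (λ a → z (n ↑ʳ a)) fundamentalCycle (j ↑ˡ g)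
  cycle-tree z cycle j = begin
    z (j ↑ˡ g)
      ≡⟨ solveFor (z (j ↑ˡ g)) (sum (λ a → z (n ↑ʳ a) ℤ.* detour a j)) (trans (sym evaluate) vanish) ⟩
    sum (λ a → z (n ↑ʳ a) ℤ.* detour a j)
      ≡⟨ sum-cong-≗ (λ a → cong (z (n ↑ʳ a) ℤ.*_) (sym (elim-tree (detour a) (δ a) j))) ⟩
    combination (λ a → z (n ↑ʳ a)) fundamentalCycle (j ↑ˡ g) ∎
    where
    open ≡-Reasoning
    vanish : sum (λ a → z a ℤ.* (below j (Graph.start (treeGraph x) a Sign.-) ℤ.- below j (Graph.start (treeGraph x) a Sign.+))) ≡ 0ℤ
    vanish = trans (sym (coboundary (treeGraph x) z (below j)))
      (sum-zero λ v → trans (cong (below j v ℤ.*_) (cycle v)) (ℤₚ.*-zeroʳ (below j v)))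
    simplify : ∀ z p d → z ℤ.* (p ℤ.- (d ℤ.+ p)) ≡ ℤ.- (z ℤ.* d)
    simplify = solve-∀
    evaluate : sum (λ a → z a ℤ.* (below j (Graph.start (treeGraph x) a Sign.-) ℤ.- below j (Graph.start (treeGraph x) a Sign.+)))
             ≡ ℤ.- z (j ↑ˡ g) ℤ.+ sum (λ a → z (n ↑ʳ a) ℤ.* detour a j)
    evaluate = trans (pairing z (below j)) (cong (ℤ._+ sum (λ a → z (n ↑ʳ a) ℤ.* detour a j))
      (trans (sum-cong-≗ λ k → trans (cong (λ b → z (k ↑ˡ g) ℤ.* (below j (par k) ℤ.- b)) (below-suc j k))
                                     (trans (simplify (z (k ↑ˡ g)) (below j (par k)) (δ k j))
                                            (cong (λ d → ℤ.- (z (k ↑ˡ g) ℤ.* d)) (δ-comm k j))))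
             (trans (sum-neg λ k → z (k ↑ˡ g) ℤ.* δ j k)
                    (cong ℤ.-_ (sum-δ (λ k → z (k ↑ˡ g)) j)))))
    solveFor : ∀ a b → ℤ.- a ℤ.+ b ≡ 0ℤ → a ≡ b
    solveFor a b eq = trans (trans (sym (ℤₚ.+-identityʳ a)) (cong (ℤ._+_ a) (sym eq))) (collect a b)
      where
      collect : ∀ a b → a ℤ.+ (ℤ.- a ℤ.+ b) ≡ b
      collect = solve-∀

  treeGraph-H₁Rank : Graph.HasH₁Rank (treeGraph x) g
  treeGraph-H₁Rank = record
    { basis       = fundamentalCycle
    ; isCycle     = fundamentalCycle-isCycle
    ; independent = λ c h a → trans (sym (combination-extra c a)) (h (n ↑ʳ a))
    ; spanning    = λ z cycle → (λ a → z (n ↑ʳ a)) , λ e → spans z cycle (edgeView n g e)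
    }
    where
    spans : ∀ z → IsCycle z → ∀ {e} → EdgeView n g e → z e ≡ combination (λ a → z (n ↑ʳ a)) fundamentalCycle e
    spans z cycle (tree j)  = cycle-tree z cycle j
    spans z cycle (extra a) = sym (combination-extra (λ a → z (n ↑ʳ a)) a)

  treeGraphOfGenus : GraphOfGenus g
  treeGraphOfGenus = record
    { graph = treeGraph x ; nonEmpty = zero ; connected = treeGraph-connected x ; hasH₁Rank = treeGraph-H₁Rank }

-- The functor to the contraction category

Φ : ∀ g → Functor (𝓕 g) ((𝒢 g) ᵒᵖ)
Φ g = record
  { F₀           = treeGraphOfGenus
  ; F₁           = λ e → collapse e , collapse-isContraction e
  ; F-resp-≈     = λ {x} {y} {e} {f} → collapse-cong {x} {y} e f
  ; identity     = λ {x} → (λ v → π-unique (idᴱ {x = x}) (λ i → (λ p → p) , (λ p → p))) , λ b → identityᵉ x (edgeView (MarkedForest.n x) g b)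
  ; homomorphism = λ {x} {y} {z} f e → (λ w → π-∘ f e w) , λ b → homomorphismᵉ f e (edgeView (MarkedForest.n z) g b)
  }
  where
  π-≈ : ∀ {x y : MarkedForest g} (e f : Embedding x y) → (∀ i → Embedding.κ e i ≡ Embedding.κ f i) → ∀ w → π e w ≡ π f w
  π-≈ {x} {y} e f e≈f w = π-unique e λ i →
    (λ p → subst (λ k → MarkedForest._⊑_ y k w) (sym (e≈f i)) (proj₁ (proj₂ (retract f w) i) p)) ,
    (λ p → proj₂ (proj₂ (retract f w) i) (subst (λ k → MarkedForest._⊑_ y k w) (e≈f i) p))
  π-∘ : ∀ {x y z : MarkedForest g} (f : Embedding y z) (e : Embedding x y) w → π (f ∘ᴱ e) w ≡ π e (π f w)
  π-∘ f e w = π-unique (f ∘ᴱ e) λ i →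
    (λ p → proj₁ (proj₂ (retract f w) _) (proj₁ (proj₂ (retract e (π f w)) i) p)) ,
    (λ p → proj₂ (proj₂ (retract e (π f w)) i) (proj₂ (proj₂ (retract f w) _) p))
  treeImage-miss : ∀ {x y : MarkedForest g} (e : Embedding x y) j d →
    ¬ (∃[ i ] Embedding.κ e i ≡ j) → treeImage e j d ≡ inj₁ (π e (suc j))
  treeImage-miss e j (yes p) n = contradiction p n
  treeImage-miss e j (no _)  n = refl
  collapse-cong : ∀ {x y : MarkedForest g} (e f : Embedding x y) → (∀ i → Embedding.κ e i ≡ Embedding.κ f i) →
         collapse e ≗ᴹ collapse f
  collapse-cong {x} {y} e f e≈f = π-≈ e f e≈f , λ b → edge≡ (edgeView (MarkedForest.n y) g b)
    where
    tree≡ : ∀ j d → treeImage e j d ≡ treeImage f j (inImage f j)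
    tree≡ _ (yes (i , refl)) = trans (sym (treeImage-hit f i (inImage f (Embedding.κ f i))))
      (cong (λ k → treeImage f k (inImage f k)) (sym (e≈f i)))
    tree≡ j (no n) = trans (cong inj₁ (π-≈ e f e≈f (suc j)))
      (sym (treeImage-miss f j (inImage f j) λ (i , eq) → n (i , trans (e≈f i) eq)))
    edge≡ : ∀ {b} → EdgeView (MarkedForest.n y) g b → edgeImage e b ≡ edgeImage f b
    edge≡ (tree j)  = trans (edgeImage-tree e j) (trans (tree≡ j (inImage e j)) (sym (edgeImage-tree f j)))
    edge≡ (extra a) = trans (edgeImage-extra e a) (sym (edgeImage-extra f a))
  identityᵉ : ∀ x {b} → EdgeView (MarkedForest.n x) g b → edgeImage (idᴱ {x = x}) b ≡ inj₂ (b , Sign.+)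
  identityᵉ x (tree j)  = trans (edgeImage-tree (idᴱ {x = x}) j) (treeImage-hit (idᴱ {x = x}) j (inImage (idᴱ {x = x}) j))
  identityᵉ x (extra a) = edgeImage-extra (idᴱ {x = x}) a
  homomorphismᵉ : ∀ {x y z : MarkedForest g} (f : Embedding y z) (e : Embedding x y) {b} → EdgeView (MarkedForest.n z) g b →
    edgeImage (f ∘ᴱ e) b ≡ Morphism.extend (collapse e) (edgeImage f b)
  homomorphismᵉ {x} {y} {z} f e (extra a) = trans (edgeImage-extra (f ∘ᴱ e) a) (sym (trans
    (cong (Morphism.extend (collapse e)) (edgeImage-extra f a))
    (cong (twist (multigraph x) Sign.+) (edgeImage-extra e a))))
    where multigraph = λ x → Graph.multigraph (treeGraph x)
  homomorphismᵉ {x} {y} {z} f e (tree j) = trans (edgeImage-tree (f ∘ᴱ e) j) (trans (go j (inImage f j))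
    (cong (Morphism.extend (collapse e)) (sym (edgeImage-tree f j))))
    where
    go : ∀ j d → treeImage (f ∘ᴱ e) j (inImage (f ∘ᴱ e) j) ≡ Morphism.extend (collapse e) (treeImage f j d)
    go j (no n) = trans (treeImage-miss (f ∘ᴱ e) j (inImage (f ∘ᴱ e) j) λ (i , eq) → n (Embedding.κ e i , eq))
      (cong inj₁ (π-∘ f e (suc j)))
    go _ (yes (k , refl)) = trans (within (inImage e k))
      (cong (twist (Graph.multigraph (treeGraph x)) Sign.+) (sym (edgeImage-tree e k)))
      where
      j′ = Embedding.κ f k
      within : ∀ d → treeImage (f ∘ᴱ e) j′ (inImage (f ∘ᴱ e) j′) ≡
                     twist (Graph.multigraph (treeGraph x)) Sign.+ (treeImage e k d)
      within (yes (i , refl)) = treeImage-hit (f ∘ᴱ e) i (inImage (f ∘ᴱ e) j′)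
      within (no n) = trans
        (treeImage-miss (f ∘ᴱ e) j′ (inImage (f ∘ᴱ e) j′) λ (i , eq) → n (i , κ-injective f eq))
        (cong inj₁ (trans (π-∘ f e (suc j′)) (cong (π e) (π-unique f (Embedding.nodes f k)))))

-- Uniqueness of the rank

-- Gaussian elimination without division: for a pivot `a`, the nonzero first entry of `v p`, the
-- vectors a times `u i` minus `u i zero` times `v p` vanish in the first coordinate. A relation
-- `c′` among them lifts to one with coefficients a times `c′ i` on the `u i` and minus `total` on
-- `v p`; it stays nontrivial because the integers have no zero divisors.
dependent : ∀ {r n} → r ℕ.< n → (v : Fin n → Fin r → ℤ) →
  Σ[ c ∈ (Fin n → ℤ) ] (∃[ i ] c i ≢ 0ℤ) × (∀ b → sum (λ i → c i ℤ.* v i b) ≡ 0ℤ)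
dependent {zero}  (s≤s _) v = (λ _ → 1ℤ) , (zero , λ ()) , λ ()
dependent {suc r} {suc n} (s≤s r<n) v with Finₚ.any? (λ i → ¬? (v i zero ℤₚ.≟ 0ℤ))
... | no none = let c , nonzero , h = dependent (ℕₚ.m≤n⇒m≤1+n r<n) (λ i b → v i (suc b)) in
  c , nonzero , λ
  { zero    → sum-zero λ i → trans (cong (c i ℤ.*_) (decidable-stable (v i zero ℤₚ.≟ 0ℤ) λ n → none (i , n)))
                                    (ℤₚ.*-zeroʳ (c i))
  ; (suc b) → h b }
... | yes (p , vp≢0) = c , nonzero , vanish
  where
  a : ℤ
  a = v p zero
  u : Fin n → Fin (suc r) → ℤ
  u i = v (Fin.punchIn p i)
  w : Fin n → Fin r → ℤ
  w i b = a ℤ.* u i (suc b) ℤ.- u i zero ℤ.* v p (suc b)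
  ih : Σ[ c ∈ (Fin n → ℤ) ] (∃[ i ] c i ≢ 0ℤ) × (∀ b → sum (λ i → c i ℤ.* w i b) ≡ 0ℤ)
  ih = dependent r<n w
  c′ : Fin n → ℤ
  c′ = proj₁ ih
  total : ℤ
  total = sum (λ i → c′ i ℤ.* u i zero)
  c : Fin (suc n) → ℤ
  c = insertAt (λ i → a ℤ.* c′ i) p (ℤ.- total)
  nonzero : ∃[ i ] c i ≢ 0ℤ
  nonzero with proj₁ (proj₂ ih)
  ... | i , c′i≢0 = Fin.punchIn p i , λ eq →
    case ℤₚ.i*j≡0⇒i≡0∨j≡0 a (trans (sym (Vectorₚ.insertAt-punchIn (λ i → a ℤ.* c′ i) p _ i)) eq) of λ
      { (inj₁ q) → vp≢0 q ; (inj₂ q) → c′i≢0 q }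
  expand : ∀ b → sum (λ i → c i ℤ.* v i b) ≡ ℤ.- total ℤ.* v p b ℤ.+ sum (λ i → (a ℤ.* c′ i) ℤ.* u i b)
  expand b = trans (sum-remove {i = p} (λ i → c i ℤ.* v i b)) (cong₂ ℤ._+_
    (cong (ℤ._* v p b) (Vectorₚ.insertAt-lookup (λ i → a ℤ.* c′ i) p _))
    (sum-cong-≗ λ i → cong (ℤ._* u i b) (Vectorₚ.insertAt-punchIn (λ i → a ℤ.* c′ i) p _ i)))
  vanish : ∀ b → sum (λ i → c i ℤ.* v i b) ≡ 0ℤ
  vanish zero = trans (expand zero) (trans
    (cong (ℤ._+_ (ℤ.- total ℤ.* a)) (trans (sum-cong-≗ λ i → ℤₚ.*-assoc a (c′ i) (u i zero))
                                           (sym (sum-*ˡ a (λ i → c′ i ℤ.* u i zero)))))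
    (cancel total a))
    where
    cancel : ∀ t a → ℤ.- t ℤ.* a ℤ.+ a ℤ.* t ≡ 0ℤ
    cancel = solve-∀
  vanish (suc b) = trans (expand (suc b)) (trans (sym (trans
    (sum-cong-≗ λ i → rearrange (c′ i) a (u i (suc b)) (u i zero) x)
    (trans (sum-minus (λ i → (a ℤ.* c′ i) ℤ.* u i (suc b)) (λ i → x ℤ.* (c′ i ℤ.* u i zero)))
      (trans (cong (λ y → s ℤ.- y) (sym (sum-*ˡ x (λ i → c′ i ℤ.* u i zero)))) (swap s x total)))))
    (proj₂ (proj₂ ih) b))
    where
    x = v p (suc b)
    s = sum (λ i → (a ℤ.* c′ i) ℤ.* u i (suc b))
    rearrange : ∀ c a y z x → c ℤ.* (a ℤ.* y ℤ.- z ℤ.* x) ≡ (a ℤ.* c) ℤ.* y ℤ.- x ℤ.* (c ℤ.* z)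
    rearrange = solve-∀
    swap : ∀ s x t → s ℤ.- x ℤ.* t ≡ ℤ.- t ℤ.* x ℤ.+ s
    swap = solve-∀

module _ {G : Graph} where
  open Graph G

  -- If `r < s`, the coordinate vectors of the second basis with respect to the first are linearly
  -- dependent, and the same relation would hold in the second basis.
  H₁Rank-≤ : ∀ {r s} → HasH₁Rank r → HasH₁Rank s → s ℕ.≤ r
  H₁Rank-≤ {r} {s} R S with ℕₚ.≤-<-connex s r
  ... | inj₁ s≤r = s≤r
  ... | inj₂ r<s with dependent r<s (λ i → proj₁ (HasH₁Rank.spanning R (HasH₁Rank.basis S i) (HasH₁Rank.isCycle S i)))
  ...   | c , (i , cᵢ≢0) , vanish = contradiction (HasH₁Rank.independent S c trivial i) cᵢ≢0
    where
    module R = HasH₁Rank R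
    module S = HasH₁Rank S
    x : Fin s → Fin r → ℤ
    x i = proj₁ (R.spanning (S.basis i) (S.isCycle i))
    open ≡-Reasoning
    trivial : ∀ a → combination c S.basis a ≡ 0ℤ
    trivial a = begin
      sum (λ i → c i ℤ.* S.basis i a)
        ≡⟨ sum-cong-≗ (λ i → trans (cong (c i ℤ.*_) (proj₂ (R.spanning (S.basis i) (S.isCycle i)) a))
                                   (sum-*ˡ (c i) (λ j → x i j ℤ.* R.basis j a))) ⟩
      sum (λ i → sum λ j → c i ℤ.* (x i j ℤ.* R.basis j a))
        ≡⟨ ∑-comm (λ i j → c i ℤ.* (x i j ℤ.* R.basis j a)) ⟩
      sum (λ j → sum λ i → c i ℤ.* (x i j ℤ.* R.basis j a))
        ≡⟨ sum-cong-≗ (λ j → trans (sum-cong-≗ λ i → rearrange (c i) (x i j) (R.basis j a))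
                                   (sym (sum-*ˡ (R.basis j a) (λ i → c i ℤ.* x i j)))) ⟩
      sum (λ j → R.basis j a ℤ.* sum (λ i → c i ℤ.* x i j))
        ≡⟨ sum-zero (λ j → trans (cong (R.basis j a ℤ.*_) (vanish j)) (ℤₚ.*-zeroʳ (R.basis j a))) ⟩
      0ℤ ∎
      where
      rearrange : ∀ c x b → c ℤ.* (x ℤ.* b) ≡ b ℤ.* (c ℤ.* x)
      rearrange = solve-∀

  H₁Rank-unique : ∀ {r s} → HasH₁Rank r → HasH₁Rank s → r ≡ s
  H₁Rank-unique R S = ℕₚ.≤-antisym (H₁Rank-≤ S R) (H₁Rank-≤ R S)

-- Isomorphisms of graphs

record GraphIso (G H : Graph) : Set where
  private
    module G = Graph G
    module H = Graph H
  field
    φ    : G.V → H.V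
    φ⁻¹  : H.V → G.V
    φ∘φ⁻¹ : ∀ w → φ (φ⁻¹ w) ≡ w
    φ⁻¹∘φ : ∀ v → φ⁻¹ (φ v) ≡ v
    η    : G.E → H.E
    η⁻¹  : H.E → G.E
    η∘η⁻¹ : ∀ b → η (η⁻¹ b) ≡ b
    η⁻¹∘η : ∀ a → η⁻¹ (η a) ≡ a
    direction : G.E → Sign
    φ-start   : ∀ a s → φ (G.start a s) ≡ H.start (η a) (direction a · s)

  φ-injective : ∀ {u v} → φ u ≡ φ v → u ≡ v
  φ-injective {u} {v} eq = trans (sym (φ⁻¹∘φ u)) (trans (cong φ⁻¹ eq) (φ⁻¹∘φ v))

  toMorphism : Morphism G.multigraph H.multigraph
  toMorphism = record { vertex = φ ; edge = λ a → inj₂ (η a , direction a) ; compatible = φ-start }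

  toMorphism-isContraction : IsContraction toMorphism
  toMorphism-isContraction = collapsingForest⇒isContraction record
    { top          = φ⁻¹
    ; top-section  = φ∘φ⁻¹
    ; up           = λ _ → nothing
    ; rank         = λ _ → 0
    ; up-nothing   = λ v _ → sym (φ⁻¹∘φ v)
    ; up-just      = λ _ ()
    ; collapsed-up = λ _ ()
    ; lift         = λ b → η⁻¹ b , _ , cong (λ c → inj₂ (c , direction (η⁻¹ b))) (η∘η⁻¹ b)
    ; lift-unique  = λ {a} {a′} p q → trans (sym (η⁻¹∘η a)) (trans (cong η⁻¹
        (trans (cong proj₁ (inj₂-injective p)) (sym (cong proj₁ (inj₂-injective q))))) (η⁻¹∘η a′))
    }

GraphIso-sym : ∀ {G H} → GraphIso G H → GraphIso H G
GraphIso-sym {G} {H} i = record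
  { φ = φ⁻¹ ; φ⁻¹ = φ ; φ∘φ⁻¹ = φ⁻¹∘φ ; φ⁻¹∘φ = φ∘φ⁻¹
  ; η = η⁻¹ ; η⁻¹ = η ; η∘η⁻¹ = η⁻¹∘η ; η⁻¹∘η = η∘η⁻¹
  ; direction = λ b → direction (η⁻¹ b)
  ; φ-start   = λ b s → trans (cong φ⁻¹ (sym (trans (φ-start (η⁻¹ b) (direction (η⁻¹ b) · s))
      (cong₂ (Graph.start H) (η∘η⁻¹ b) (·-cancel (direction (η⁻¹ b)) s))))) (φ⁻¹∘φ _)
  }
  where open GraphIso i

module _ {G H : Graph} (i : GraphIso G H) where
  private
    module G = Graph G
    module H = Graph H
  open GraphIso i

  toMorphism-inverseˡ : GraphIso.toMorphism (GraphIso-sym i) ∘ᴹ toMorphism ≗ᴹ idᴹ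
  toMorphism-inverseˡ = φ⁻¹∘φ , λ a → cong₂ (λ b s → inj₂ (b , s)) (η⁻¹∘η a)
    (trans (cong (λ b → direction a · direction b) (η⁻¹∘η a)) (Signₚ.s*s≡+ (direction a)))

  toMorphism-inverseʳ : toMorphism ∘ᴹ GraphIso.toMorphism (GraphIso-sym i) ≗ᴹ idᴹ
  toMorphism-inverseʳ = φ∘φ⁻¹ , λ b → cong₂ (λ c s → inj₂ (c , s)) (η∘η⁻¹ b) (Signₚ.s*s≡+ (direction (η⁻¹ b)))

  signed : Sign → ℤ → ℤ
  signed Sign.+ z = z
  signed Sign.- z = ℤ.- z

  pullback : H.Chain → G.Chain
  pullback z a = signed (direction a) (z (η a))

  pullback-isCycle : ∀ z → H.IsCycle z → G.IsCycle (pullback z)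
  pullback-isCycle z cycle v = begin
    G.∂ (pullback z) v
      ≡⟨ sum-cong-≗ (λ a → term a (direction a) (φ-start a)) ⟩
    sum (λ a → z (η a) ℤ.* (δ (H.start (η a) Sign.-) (φ v) ℤ.- δ (H.start (η a) Sign.+) (φ v)))
      ≡⟨ sum-permute (λ b → z b ℤ.* (δ (H.start b Sign.-) (φ v) ℤ.- δ (H.start b Sign.+) (φ v)))
           (Permutation.permutation η η⁻¹ η∘η⁻¹ η⁻¹∘η) ⟨
    H.∂ z (φ v)
      ≡⟨ cycle (φ v) ⟩
    0ℤ ∎
    where
    open ≡-Reasoning
    flip : ∀ z p q → ℤ.- z ℤ.* (p ℤ.- q) ≡ z ℤ.* (q ℤ.- p)
    flip = solve-∀
    at : ∀ a s {w} → φ (G.start a s) ≡ w → δ (G.start a s) v ≡ δ w (φ v)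
    at a s refl = sym (δ-injective φ-injective (G.start a s) v)
    term : ∀ a t → (∀ s → φ (G.start a s) ≡ H.start (η a) (t · s)) →
      signed t (z (η a)) ℤ.* (δ (G.start a Sign.-) v ℤ.- δ (G.start a Sign.+) v) ≡
      z (η a) ℤ.* (δ (H.start (η a) Sign.-) (φ v) ℤ.- δ (H.start (η a) Sign.+) (φ v))
    term a Sign.+ h = cong₂ (λ p q → z (η a) ℤ.* (p ℤ.- q)) (at a Sign.- (h Sign.-)) (at a Sign.+ (h Sign.+))
    term a Sign.- h = trans (flip (z (η a)) (δ (G.start a Sign.-) v) (δ (G.start a Sign.+) v))
      (cong₂ (λ p q → z (η a) ℤ.* (p ℤ.- q)) (at a Sign.+ (h Sign.+)) (at a Sign.- (h Sign.-)))

  signed-combination : ∀ t {n} (c b : Fin n → ℤ) →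
    sum (λ i → c i ℤ.* signed t (b i)) ≡ signed t (sum (λ i → c i ℤ.* b i))
  signed-combination Sign.+ c b = refl
  signed-combination Sign.- {n} c b = trans (sum-cong-≗ λ i → sym (ℤₚ.neg-distribʳ-* (c i) (b i))) (sum-neg (λ i → c i ℤ.* b i))

  signed-involutive : ∀ t z → signed t (signed t z) ≡ z
  signed-involutive Sign.+ z = refl
  signed-involutive Sign.- z = ℤₚ.neg-involutive z

  signed≡0 : ∀ t {z} → signed t z ≡ 0ℤ → z ≡ 0ℤ
  signed≡0 t {z} eq = trans (sym (signed-involutive t z)) (trans (cong (signed t) eq) (zero₀ t))
    where
    zero₀ : ∀ t → signed t 0ℤ ≡ 0ℤ
    zero₀ Sign.+ = refl
    zero₀ Sign.- = refl

pullback-inverse : ∀ {G H} (i : GraphIso G H) z a → pullback i (pullback (GraphIso-sym i) z) a ≡ z a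
pullback-inverse i z a rewrite GraphIso.η⁻¹∘η i a = lemma (GraphIso.direction i a)
  where
  lemma : ∀ t → signed i t (signed (GraphIso-sym i) t (z a)) ≡ z a
  lemma Sign.+ = refl
  lemma Sign.- = ℤₚ.neg-involutive (z a)

transport-H₁Rank : ∀ {G H r} → GraphIso G H → Graph.HasH₁Rank H r → Graph.HasH₁Rank G r
transport-H₁Rank {G} {H} i R = record
  { basis       = λ k → pullback i (R.basis k)
  ; isCycle     = λ k → pullback-isCycle i (R.basis k) (R.isCycle k)
  ; independent = λ c h → R.independent c λ b → signed≡0 i (direction (η⁻¹ b))
      (trans (cong (λ b′ → signed i (direction (η⁻¹ b)) (Graph.combination H c R.basis b′)) (sym (η∘η⁻¹ b)))
        (trans (sym (signed-combination i (direction (η⁻¹ b)) c (λ k → R.basis k (η (η⁻¹ b))))) (h (η⁻¹ b))))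
  ; spanning    = λ z cycle →
      let c , h = R.spanning (pullback (GraphIso-sym i) z) (pullback-isCycle (GraphIso-sym i) z cycle) in
      c , λ a → trans (sym (pullback-inverse i z a)) (trans (cong (signed i (direction a)) (h (η a)))
                  (sym (signed-combination i (direction a) c (λ k → R.basis k (η a)))))
  }
  where
  module R = Graph.HasH₁Rank R
  open GraphIso i

-- Spanning trees

-- A new leaf shifts the preorder numbers of the nodes behind it, so the nodes of `F⁺` are described
-- as the nodes of `F` and one more, with `split` telling them apart. Data on the nodes are extended
-- by case distinction on `split`.
record LeafExtension (F F⁺ : Forest) (u : Maybe (Node F)) : Set where
  field
    old        : Node F → Node F⁺
    new        : Node F⁺
    split      : Node F⁺ → Maybe (Node F)
    split-old  : ∀ x → split (old x) ≡ just x
    split-new  : split new ≡ nothing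
    cover      : ∀ x → x ≡ new ⊎ (∃[ y ] x ≡ old y)
    parent-old : ∀ x → parent (old x) ≡ Maybe.map old (parent x)
    parent-new : parent new ≡ Maybe.map old u
    size-suc   : size F⁺ ≡ suc (size F)

leafAtRoot : ∀ F → LeafExtension F (node [] F) nothing
leafAtRoot F = record
  { old        = right
  ; new        = here
  ; split      = λ { here → nothing ; (right x) → just x }
  ; split-old  = λ _ → refl
  ; split-new  = refl
  ; cover      = λ { here → inj₁ refl ; (right x) → inj₂ (x , refl) }
  ; parent-old = λ x → inRight≡ (parent x)
  ; parent-new = refl
  ; size-suc   = refl
  }
  where
  inRight≡ : ∀ v → inRight v ≡ Maybe.map right v
  inRight≡ nothing  = refl
  inRight≡ (just x) = refl

leafDown : ∀ {A A⁺ B u} → LeafExtension A A⁺ u → LeafExtension (node A B) (node A⁺ B) (inDown u)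
leafDown {A} {A⁺} {B} {u} e = record
  { old        = old′
  ; new        = down new
  ; split      = λ { here → just here ; (down x) → Maybe.map down (split x) ; (right x) → just (right x) }
  ; split-old  = λ { here → refl ; (down x) → cong (Maybe.map down) (split-old x) ; (right x) → refl }
  ; split-new  = cong (Maybe.map down) split-new
  ; cover      = λ { here → inj₂ (here , refl) ; (right x) → inj₂ (right x , refl)
                   ; (down x) → case cover x of λ
                       { (inj₁ refl) → inj₁ refl ; (inj₂ (y , refl)) → inj₂ (down y , refl) } }
  ; parent-old = λ { here → refl
                   ; (down x) → trans (cong inDown (parent-old x)) (inDown≡ (parent x))
                   ; (right x) → inRight≡ (parent x) }
  ; parent-new = trans (cong inDown parent-new) (inDown≡ u)
  ; size-suc   = cong (λ k → suc (k ℕ.+ size B)) size-suc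
  }
  where
  open LeafExtension e
  old′ : Node (node A B) → Node (node A⁺ B)
  old′ here      = here
  old′ (down x)  = down (old x)
  old′ (right x) = right x
  inDown≡ : ∀ v → inDown (Maybe.map old v) ≡ Maybe.map old′ (inDown v)
  inDown≡ nothing  = refl
  inDown≡ (just x) = refl
  inRight≡ : ∀ v → inRight v ≡ Maybe.map old′ (inRight v)
  inRight≡ nothing  = refl
  inRight≡ (just x) = refl

leafRight : ∀ {A B B⁺ u} → LeafExtension B B⁺ u → LeafExtension (node A B) (node A B⁺) (inRight u)
leafRight {A} {B} {B⁺} {u} e = record
  { old        = old′
  ; new        = right new
  ; split      = λ { here → just here ; (down x) → just (down x) ; (right x) → Maybe.map right (split x) }
  ; split-old  = λ { here → refl ; (down x) → refl ; (right x) → cong (Maybe.map right) (split-old x) }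
  ; split-new  = cong (Maybe.map right) split-new
  ; cover      = λ { here → inj₂ (here , refl) ; (down x) → inj₂ (down x , refl)
                   ; (right x) → case cover x of λ
                       { (inj₁ refl) → inj₁ refl ; (inj₂ (y , refl)) → inj₂ (right y , refl) } }
  ; parent-old = λ { here → refl
                   ; (right x) → trans (cong inRight (parent-old x)) (inRight≡ (parent x))
                   ; (down x) → inDown≡ (parent x) }
  ; parent-new = trans (cong inRight parent-new) (inRight≡ u)
  ; size-suc   = cong suc (trans (cong (size A ℕ.+_) size-suc) (ℕₚ.+-suc (size A) (size B)))
  }
  where
  open LeafExtension e
  old′ : Node (node A B) → Node (node A B⁺)
  old′ here      = here
  old′ (down x)  = down x
  old′ (right x) = right (old x)
  inRight≡ : ∀ v → inRight (Maybe.map old v) ≡ Maybe.map old′ (inRight v)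
  inRight≡ nothing  = refl
  inRight≡ (just x) = refl
  inDown≡ : ∀ v → inDown v ≡ Maybe.map old′ (inDown v)
  inDown≡ nothing  = refl
  inDown≡ (just x) = refl

extendLeaf : ∀ F u → ∃[ F⁺ ] LeafExtension F F⁺ u
extendLeaf F nothing = _ , leafAtRoot F
extendLeaf (node A B) (just here) = _ , leafDown (leafAtRoot A)
extendLeaf (node A B) (just (down x)) = _ , leafDown (proj₂ (extendLeaf A (just x)))
extendLeaf (node A B) (just (right x)) = _ , leafRight (proj₂ (extendLeaf B (just x)))

module _ (G : Graph) where
  open Graph G

  record Subtree : Set where
    field
      forest    : Forest
      ψ         : Maybe (Node forest) → V
      ψ-inj     : ∀ {u v} → ψ u ≡ ψ v → u ≡ v
      edge      : Node forest → E
      edge-inj  : ∀ {x y} → edge x ≡ edge y → x ≡ y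
      direction : Node forest → Sign
      child     : ∀ x → start (edge x) (direction x) ≡ ψ (just x)
      parent≡   : ∀ x → start (edge x) (opposite (direction x)) ≡ ψ (parent x)

    size<#V : size forest ℕ.< #V
    size<#V = Finₚ.injective⇒≤ {f = λ { zero → ψ nothing ; (suc i) → ψ (just (dec i)) }} inj
      where
      inj : ∀ {i j} → _ ≡ _ → i ≡ j
      inj {zero}  {zero}  _  = refl
      inj {zero}  {suc j} eq = case ψ-inj eq of λ ()
      inj {suc i} {zero}  eq = case ψ-inj eq of λ ()
      inj {suc i} {suc j} eq = cong suc (trans (sym (enc-dec i)) (trans (cong enc (just⁻¹ (ψ-inj eq))) (enc-dec j)))
        where
        just⁻¹ : ∀ {x y : Node forest} → just x ≡ just y → x ≡ y
        just⁻¹ refl = refl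

    covered? : ∀ v → Dec (∃[ u ] ψ u ≡ v)
    covered? v with ψ nothing Finₚ.≟ v | Finₚ.any? (λ i → ψ (just (dec {forest} i)) Finₚ.≟ v)
    ... | yes p | _           = yes (nothing , p)
    ... | no _  | yes (i , p) = yes (just (dec i) , p)
    ... | no ¬p | no ¬q       = no λ
      { (nothing , p) → ¬p p
      ; (just x , p)  → ¬q (enc x , trans (cong (λ y → ψ (just y)) (dec-enc x)) p) }

  module _ (T : Subtree) (u : Maybe (Node (Subtree.forest T))) (a : E) (s : Sign)
           (child⁺ : ¬ (∃[ w ] Subtree.ψ T w ≡ start a s))
           (parent⁺ : start a (opposite s) ≡ Subtree.ψ T u) where
    open Subtree T

    attach : ∃[ T⁺ ] size (Subtree.forest T⁺) ≡ suc (size forest)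
    attach with extendLeaf forest u
    ... | F⁺ , ext = record
      { forest = F⁺ ; ψ = ψ⁺ ; ψ-inj = λ {v} {w} → ψ⁺-inj v w
      ; edge = edge⁺ ; edge-inj = λ {x} {y} → edge⁺-inj x y
      ; direction = direction⁺ ; child = childOf ; parent≡ = parentOf } , size-suc
      where
      open LeafExtension ext
      at : {X : Set} → X → (Node forest → X) → Node F⁺ → X
      at z f x = Maybe.maybe′ f z (split x)
      at-new : ∀ {X : Set} {z : X} {f} → at z f new ≡ z
      at-new {z = z} {f} = cong (Maybe.maybe′ f z) split-new
      at-old : ∀ {X : Set} {z : X} {f} x → at z f (old x) ≡ f x
      at-old {z = z} {f} x = cong (Maybe.maybe′ f z) (split-old x)
      ψ⁺ : Maybe (Node F⁺) → V
      ψ⁺ nothing  = ψ nothing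
      ψ⁺ (just x) = at (start a s) (λ y → ψ (just y)) x
      ψ⁺-old : ∀ v → ψ⁺ (Maybe.map old v) ≡ ψ v
      ψ⁺-old nothing  = refl
      ψ⁺-old (just x) = at-old x
      edge⁺ : Node F⁺ → E
      edge⁺ = at a edge
      direction⁺ : Node F⁺ → Sign
      direction⁺ = at s direction
      ψ⁺-inj : ∀ v w → ψ⁺ v ≡ ψ⁺ w → v ≡ w
      ψ⁺-inj nothing nothing _ = refl
      ψ⁺-inj nothing (just y) eq with cover y
      ... | inj₁ refl       = contradiction (_ , trans eq at-new) child⁺
      ... | inj₂ (x , refl) = case ψ-inj (trans eq (at-old x)) of λ ()
      ψ⁺-inj (just y) nothing eq = sym (ψ⁺-inj nothing (just y) (sym eq))
      ψ⁺-inj (just y) (just z) eq with cover y | cover z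
      ... | inj₁ refl | inj₁ refl = refl
      ... | inj₁ refl | inj₂ (x , refl) = contradiction (_ , sym (trans (sym at-new) (trans eq (at-old x)))) child⁺
      ... | inj₂ (x , refl) | inj₁ refl = contradiction (_ , trans (sym (at-old x)) (trans eq at-new)) child⁺
      ... | inj₂ (x , refl) | inj₂ (x′ , refl) =
        cong (Maybe.map old) (ψ-inj (trans (sym (at-old x)) (trans eq (at-old x′))))
      edge-new : ∀ x → a ≢ edge x
      edge-new x refl with direction x Signₚ.≟ s
      ... | yes refl = child⁺ (_ , sym (child x))
      ... | no  d≢s  = child⁺ (_ , sym (trans (cong (start (edge x)) (≢⇒opposite d≢s)) (parent≡ x)))
      edge⁺-inj : ∀ x y → edge⁺ x ≡ edge⁺ y → x ≡ y
      edge⁺-inj x y eq with cover x | cover y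
      ... | inj₁ refl | inj₁ refl = refl
      ... | inj₁ refl | inj₂ (y , refl) = contradiction (trans (sym at-new) (trans eq (at-old y))) (edge-new y)
      ... | inj₂ (x , refl) | inj₁ refl = contradiction (sym (trans (sym (at-old x)) (trans eq at-new))) (edge-new x)
      ... | inj₂ (x , refl) | inj₂ (y , refl) = cong old (edge-inj (trans (sym (at-old x)) (trans eq (at-old y))))
      childOf : ∀ x → start (edge⁺ x) (direction⁺ x) ≡ ψ⁺ (just x)
      childOf x with cover x
      ... | inj₁ refl = trans (cong₂ start at-new at-new) (sym at-new)
      ... | inj₂ (y , refl) = trans (cong₂ start (at-old y) (at-old y)) (trans (child y) (sym (at-old y)))
      parentOf : ∀ x → start (edge⁺ x) (opposite (direction⁺ x)) ≡ ψ⁺ (parent x)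
      parentOf x with cover x
      ... | inj₁ refl = trans (cong₂ (λ b t → start b (opposite t)) at-new at-new)
              (trans parent⁺ (trans (sym (ψ⁺-old u)) (cong ψ⁺ (sym parent-new))))
      ... | inj₂ (y , refl) = trans (cong₂ (λ b t → start b (opposite t)) (at-old y) (at-old y))
              (trans (parent≡ y) (trans (sym (ψ⁺-old (parent y))) (cong ψ⁺ (sym (parent-old y)))))

  IsSpanning : Subtree → Set
  IsSpanning T = ∀ v → ∃[ u ] Subtree.ψ T u ≡ v

  spanningTree : V → Connected → Σ[ T ∈ Subtree ] IsSpanning T
  spanningTree v₀ connected = grow #V trivial (ℕₚ.m≤n+m #V 0)
    where
    trivial : Subtree
    trivial = record
      { forest = [] ; ψ = λ _ → v₀ ; ψ-inj = λ { {nothing} {nothing} _ → refl }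
      ; edge = λ () ; edge-inj = λ { {()} } ; direction = λ () ; child = λ () ; parent≡ = λ () }
    grow : ∀ k T → #V ℕ.≤ size (Subtree.forest T) ℕ.+ k → Σ[ T ∈ Subtree ] IsSpanning T
    grow zero T le = contradiction (Subtree.size<#V T) (ℕₚ.≤⇒≯ (subst (#V ℕ.≤_) (ℕₚ.+-identityʳ _) le))
    grow (suc k) T le with Finₚ.any? (λ a → leaving? a Sign.+ ⊎-dec leaving? a Sign.-)
      where
      leaving? : ∀ a s → Dec ((∃[ u ] Subtree.ψ T u ≡ start a (opposite s)) × ¬ (∃[ w ] Subtree.ψ T w ≡ start a s))
      leaving? a s = Subtree.covered? T (start a (opposite s)) ×-dec ¬? (Subtree.covered? T (start a s))
    ... | yes (a , p) = let s , (u , eq) , new = side p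
                            T⁺ , size≡ = attach T u a s new (sym eq) in
        grow k T⁺ (subst (#V ℕ.≤_) (trans (ℕₚ.+-suc _ k) (cong (ℕ._+ k) (sym size≡))) le)
      where
      side : _ → ∃[ s ] (∃[ u ] Subtree.ψ T u ≡ start a (opposite s)) × ¬ (∃[ w ] Subtree.ψ T w ≡ start a s)
      side (inj₁ p) = Sign.+ , p
      side (inj₂ p) = Sign.- , p
    -- When no edge leaves the set of covered vertices, a walk starting at the root cannot leave it
    -- either, and connectedness supplies a walk to every vertex.
    ... | no none = T , λ v → reach (connected (Subtree.ψ T nothing) v) (nothing , refl)
      where
      reach : ∀ {v w} → Walk v w → (∃[ u ] Subtree.ψ T u ≡ v) → ∃[ u ] Subtree.ψ T u ≡ w
      reach ε c = c
      reach {w = w} (step a s refl refl ◅ p) c with Subtree.covered? T (start a (opposite s))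
      ... | yes c′ = reach p c′
      ... | no ¬c  = contradiction (a , leaves s c ¬c) none
        where
        leaves : ∀ s → (∃[ u ] Subtree.ψ T u ≡ start a s) → ¬ (∃[ u ] Subtree.ψ T u ≡ start a (opposite s)) →
          ((∃[ u ] Subtree.ψ T u ≡ start a Sign.-) × ¬ (∃[ w ] Subtree.ψ T w ≡ start a Sign.+)) ⊎
          ((∃[ u ] Subtree.ψ T u ≡ start a Sign.+) × ¬ (∃[ w ] Subtree.ψ T w ≡ start a Sign.-))
        leaves Sign.+ c n = inj₂ (c , n)
        leaves Sign.- c n = inj₁ (c , n)

enumerate : ∀ {m} {P : Fin m → Set} → (∀ i → Dec (P i)) →
  ∃[ n ] Σ[ f ∈ (Fin n → Fin m) ] (∀ {i j} → f i ≡ f j → i ≡ j) × (∀ i → P (f i)) × (∀ x → P x → ∃[ i ] f i ≡ x)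
enumerate {zero} P? = 0 , (λ ()) , (λ { {()} }) , (λ ()) , (λ ())
enumerate {suc m} P? with P? zero | enumerate (λ i → P? (suc i))
... | no ¬p | n , f , inj , sound , complete =
  n , (λ i → suc (f i)) , (λ eq → inj (Finₚ.suc-injective eq)) , sound , λ
    { zero p → contradiction p ¬p
    ; (suc x) p → let i , eq = complete x p in i , cong suc eq }
... | yes p | n , f , inj , sound , complete =
  suc n , f⁺ , f⁺-inj , (λ { zero → p ; (suc i) → sound i }) , λ
    { zero p → zero , refl
    ; (suc x) p → let i , eq = complete x p in suc i , cong suc eq }
  where
  f⁺ : Fin (suc n) → Fin (suc m)
  f⁺ zero    = zero
  f⁺ (suc i) = suc (f i)
  f⁺-inj : ∀ {i j} → f⁺ i ≡ f⁺ j → i ≡ j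
  f⁺-inj {zero}  {zero}  _  = refl
  f⁺-inj {suc i} {suc j} eq = cong suc (inj (Finₚ.suc-injective eq))

module _ (G : Graph) (T : Subtree G) (spanning : IsSpanning G T) where
  open Graph G
  open Subtree T

  isTree? : ∀ b → Dec (∃[ i ] edge (dec i) ≡ b)
  isTree? b = Finₚ.any? (λ i → edge (dec {forest} i) Finₚ.≟ b)

  private
    extras = enumerate {P = λ b → ¬ (∃[ i ] edge (dec {forest} i) ≡ b)} (λ b → ¬? (isTree? b))

  #extra : ℕ
  #extra = proj₁ extras

  extraEdge : Fin #extra → E
  extraEdge = proj₁ (proj₂ extras)

  ψᶠ : Fin (suc (size forest)) → V
  ψᶠ zero    = ψ nothing
  ψᶠ (suc i) = ψ (just (dec i))

  ψᶠ-enc : ∀ u → ψᶠ (encᵛ u) ≡ ψ u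
  ψᶠ-enc nothing  = refl
  ψᶠ-enc (just x) = cong (λ y → ψ (just y)) (dec-enc x)

  locate : V → Fin (suc (size forest))
  locate v = encᵛ (proj₁ (spanning v))

  ψᶠ-locate : ∀ v → ψᶠ (locate v) ≡ v
  ψᶠ-locate v = trans (ψᶠ-enc (proj₁ (spanning v))) (proj₂ (spanning v))

  locate-ψᶠ : ∀ v → locate (ψᶠ v) ≡ v
  locate-ψᶠ zero    = cong encᵛ (ψ-inj (proj₂ (spanning (ψ nothing))))
  locate-ψᶠ (suc i) = trans (cong encᵛ (ψ-inj (proj₂ (spanning (ψ (just (dec i))))))) (cong suc (enc-dec i))

  markedSpanningTree : MarkedForest #extra
  markedSpanningTree = record
    { forest = forest
    ; marks  = tabulate λ a → locate (start (extraEdge a) Sign.+) , locate (start (extraEdge a) Sign.-) }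

  private
    y = markedSpanningTree
    n = size forest

  ψᶠ-mark : ∀ a s → ψᶠ (MarkedForest.mark y a s) ≡ start (extraEdge a) s
  ψᶠ-mark a Sign.+ = trans (cong (λ p → ψᶠ (proj₁ p)) (Vecₚ.lookup∘tabulate _ a)) (ψᶠ-locate _)
  ψᶠ-mark a Sign.- = trans (cong (λ p → ψᶠ (proj₂ p)) (Vecₚ.lookup∘tabulate _ a)) (ψᶠ-locate _)

  markedSpanningTree-iso : GraphIso (treeGraph y) G
  markedSpanningTree-iso = record
    { φ = ψᶠ ; φ⁻¹ = locate ; φ∘φ⁻¹ = ψᶠ-locate ; φ⁻¹∘φ = locate-ψᶠ
    ; η = η ; η⁻¹ = λ b → η⁻¹ b (isTree? b) ; η∘η⁻¹ = λ b → η∘η⁻¹ b (isTree? b)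
    ; η⁻¹∘η = λ e → η⁻¹∘η (edgeView n #extra e) (isTree? (η e))
    ; direction = elim treeDirection (λ _ → Sign.+)
    ; φ-start = λ e → φ-start (edgeView n #extra e)
    }
    where
    treeEdge : Fin n → E
    treeEdge i = edge (dec i)
    treeDirection : Fin n → Sign
    treeDirection i = direction (dec i)
    η : Fin (n ℕ.+ #extra) → E
    η = elim treeEdge extraEdge
    extra-new : ∀ a → ¬ (∃[ i ] treeEdge i ≡ extraEdge a)
    extra-new = proj₁ (proj₂ (proj₂ (proj₂ extras)))
    η⁻¹ : ∀ b → Dec (∃[ i ] treeEdge i ≡ b) → Fin (n ℕ.+ #extra)
    η⁻¹ b (yes (i , _)) = i ↑ˡ #extra
    η⁻¹ b (no ¬p)       = n ↑ʳ proj₁ (proj₂ (proj₂ (proj₂ (proj₂ extras))) b ¬p)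
    η∘η⁻¹ : ∀ b d → η (η⁻¹ b d) ≡ b
    η∘η⁻¹ b (yes (i , eq)) = trans (elim-tree treeEdge extraEdge i) eq
    η∘η⁻¹ b (no ¬p)        = trans (elim-extra treeEdge extraEdge _) (proj₂ (proj₂ (proj₂ (proj₂ (proj₂ extras))) b ¬p))
    η⁻¹∘η : ∀ {e} → EdgeView n #extra e → ∀ d → η⁻¹ (η e) d ≡ e
    η⁻¹∘η (tree j) (yes (i , eq)) = cong (_↑ˡ #extra) (trans (sym (enc-dec i))
      (trans (cong enc (edge-inj (trans eq (elim-tree treeEdge extraEdge j)))) (enc-dec j)))
    η⁻¹∘η (tree j) (no n) = contradiction (j , sym (elim-tree treeEdge extraEdge j)) n
    η⁻¹∘η (extra a) (yes (i , eq)) = contradiction (i , trans eq (elim-extra treeEdge extraEdge a)) (extra-new a)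
    η⁻¹∘η (extra a) (no ¬p) = cong (n ↑ʳ_) (proj₁ (proj₂ (proj₂ extras))
      (trans (proj₂ (proj₂ (proj₂ (proj₂ (proj₂ extras))) _ ¬p)) (elim-extra treeEdge extraEdge a)))
    φ-start : ∀ {e} → EdgeView n #extra e → ∀ s →
      ψᶠ (Graph.start (treeGraph y) e s) ≡ start (η e) (elim treeDirection (λ _ → Sign.+) e · s)
    φ-start (extra a) s = trans (cong ψᶠ (start-extra y a s)) (trans (ψᶠ-mark a s)
      (sym (cong₂ (λ b t → start b (t · s)) (elim-extra treeEdge extraEdge a) (elim-extra treeDirection (λ _ → Sign.+) a))))
    φ-start (tree j) s = trans (cong ψᶠ (start-tree y j s)) (trans (ends s)
      (sym (cong₂ (λ b t → start b (t · s)) (elim-tree treeEdge extraEdge j) (elim-tree treeDirection (λ _ → Sign.+) j))))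
      where
      negate : ∀ t → opposite t ≡ t · Sign.-
      negate Sign.+ = refl
      negate Sign.- = refl
      ends : ∀ s → ψᶠ (treeEnd y j s) ≡ start (treeEdge j) (treeDirection j · s)
      ends Sign.+ = trans (sym (child (dec j))) (cong (start (treeEdge j)) (sym (Signₚ.*-identityʳ (treeDirection j))))
      ends Sign.- = trans (ψᶠ-enc (parent (dec j))) (trans (sym (parent≡ (dec j)))
        (cong (start (treeEdge j)) (negate (treeDirection j))))

Φ-essentiallySurjective : ∀ g → EssentiallySurjective (Φ g)
Φ-essentiallySurjective g x =
  build (markedSpanningTree graph T spans) (markedSpanningTree-iso graph T spans)
  where
  open GraphOfGenus x
  T : Subtree graph
  T = proj₁ (spanningTree graph nonEmpty connected)
  spans : IsSpanning graph T
  spans = proj₂ (spanningTree graph nonEmpty connected)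
  -- The number of edges outside the tree is kept as a variable here, so that uniqueness of the rank
  -- of the first homology can identify it with `g`.
  build : ∀ {N} (y : MarkedForest N) → GraphIso (treeGraph y) graph →
          ∃[ y ] Category._≅_ ((𝒢 g) ᵒᵖ) (treeGraphOfGenus y) x
  build y i with H₁Rank-unique (transport-H₁Rank (GraphIso-sym i) (treeGraph-H₁Rank y)) hasH₁Rank
  ... | refl = y , (backward , GraphIso.toMorphism-isContraction (GraphIso-sym i)) ,
                   (forward , GraphIso.toMorphism-isContraction i) , toMorphism-inverseˡ i , toMorphism-inverseʳ i
    where
    forward = GraphIso.toMorphism i
    backward = GraphIso.toMorphism (GraphIso-sym i)

-- Cancellation of contractions

-- Vertices of a fiber often agree only by a proved equality. Turning the equality into an empty
-- walk keeps transports out of the homotopies.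
pathFrom≡ : ∀ (G : Multigraph) {u v} → u ≡ v → Multigraph.Walk G u v
pathFrom≡ G refl = ε

edge-unique : ∀ {G H} {f : Morphism G H} → IsContraction f → ∀ {a a′ b t t′} →
  Morphism.edge f a ≡ inj₂ (b , t) → Morphism.edge f a′ ≡ inj₂ (b , t′) → a ≡ a′
edge-unique {f = f} fᶜ {b = b} p q = cong proj₁
  (WalkProperties.discrete-unique (EdgeFiber f b) (λ ()) (IsContraction.connectedᵉ fᶜ b (_ , _ , p) (_ , _ , q)))

extend-inj₂ : ∀ {G H} (f : Morphism G H) x {b t} → Morphism.extend f x ≡ inj₂ (b , t) →
  ∃[ c ] ∃[ r ] x ≡ inj₂ (c , r) × Morphism.edge f c ≡ inj₂ (b , r · t)
extend-inj₂ {H = H} f (inj₂ (c , r)) eq = c , r , refl , twist-inj₂ H r (Morphism.edge f c) eq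

-- A fiber of `f` is the image under `q` of the fiber of `k` over the same vertex. The contraction
-- of the latter is pushed forward, edges collapsed by `q` becoming empty walks. Since the fibers of
-- `q` are connected, the result does not depend, up to homotopy, on the preimages chosen.
module Cancellation {G H K : Multigraph} {k : Morphism G K} {q : Morphism G H} (f : Morphism H K)
                    (kᶜ : IsContraction k) (qᶜ : IsContraction q) (k≗fq : k ≗ᴹ f ∘ᴹ q) where
  private
    module G = Multigraph G
    module H = Multigraph H
    module k = Morphism k
    module q = Morphism q
    module f = Morphism f
    module kᶜ = IsContraction kᶜ
    module qᶜ = IsContraction qᶜ

  surjectiveᵛ : ∀ w → ∃[ v ] f.vertex v ≡ w
  surjectiveᵛ w = let v , p = kᶜ.surjectiveᵛ w in q.vertex v , trans (sym (proj₁ k≗fq v)) p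

  surjectiveᵉ : ∀ b → ∃[ a ] ∃[ t ] f.edge a ≡ inj₂ (b , t)
  surjectiveᵉ b =
    let a , t , p = kᶜ.surjectiveᵉ b
        c , r , _ , eq = extend-inj₂ f (q.edge a) (trans (sym (proj₂ k≗fq a)) p) in c , r · t , eq

  k-edge : ∀ {a c r b t} → q.edge a ≡ inj₂ (c , r) → f.edge c ≡ inj₂ (b , t) → k.edge a ≡ inj₂ (b , r · t)
  k-edge {a} p p′ = trans (proj₂ k≗fq a) (trans (cong f.extend p) (cong (twist K _) p′))

  uniqueᵉ : ∀ {a a′ b t t′} → f.edge a ≡ inj₂ (b , t) → f.edge a′ ≡ inj₂ (b , t′) → a ≡ a′
  uniqueᵉ {a} {a′} p p′ with qᶜ.surjectiveᵉ a | qᶜ.surjectiveᵉ a′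
  ... | c , r , eq | c′ , r′ , eq′ with edge-unique kᶜ (k-edge eq p) (k-edge eq′ p′)
  ...   | refl = cong proj₁ (inj₂-injective (trans (sym eq) eq′))

  module _ (w : Multigraph.V K) where
    private
      Aʷ = VertexFiber k w
      Bʷ = VertexFiber f w
      module Aʷ = Multigraph Aʷ
      module Bʷ = Multigraph Bʷ
      module Cᴬ = Multigraph.Contractible (kᶜ.contractibleᵛ w)
      module Q x = Multigraph (VertexFiber q x)
      open WalkProperties Bʷ

    ε≡ : ∀ {u v : Bʷ.V} → u ≡ v → Bʷ.Walk u v
    ε≡ = pathFrom≡ Bʷ

    ε≡-trans : ∀ {u v x z} (p : u ≡ v) (p′ : v ≡ x) (p″ : u ≡ x) (r : Bʷ.Walk x z) →
               ε≡ p ◅◅ (ε≡ p′ ◅◅ r) ≡ ε≡ p″ ◅◅ r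
    ε≡-trans refl refl refl r = refl

    step-unique : ∀ {u v} (s s′ : Bʷ.Step u v) → proj₁ (Bʷ.Step.edge s) ≡ proj₁ (Bʷ.Step.edge s′) →
                  Bʷ.Step.sign s ≡ Bʷ.Step.sign s′ → s ≡ s′
    step-unique (Bʷ.step (a , p) t st en) (Bʷ.step (.a , p′) .t st′ en′) refl refl
      with uip p p′
    ... | refl with uip st st′ | uip en en′
    ...   | refl | refl = refl

    step-move : ∀ {u v u′ v′ z} (s : Bʷ.Step u v) (s′ : Bʷ.Step u′ v′) (p : u ≡ u′) (p′ : v ≡ v′) (r : Bʷ.Walk v′ z) →
                proj₁ (Bʷ.Step.edge s) ≡ proj₁ (Bʷ.Step.edge s′) → Bʷ.Step.sign s ≡ Bʷ.Step.sign s′ →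
                s ◅ (ε≡ p′ ◅◅ r) ≡ ε≡ p ◅◅ (s′ ◅ r)
    step-move s s′ refl refl r e t = cong (_◅ r) (step-unique s s′ e t)

    image : Aʷ.V → Bʷ.V
    image (v , p) = q.vertex v , trans (sym (proj₁ k≗fq v)) p

    image-start : ∀ a t {c r} → q.edge (proj₁ a) ≡ inj₂ (c , r) → (p : f.edge c ≡ inj₁ w) →
                  Bʷ.start (c , p) (r · t) ≡ image (Aʷ.start a t)
    image-start (a , _) t eq p = Σ-≡-irrelevant (sym (trans (q.compatible a t) (cong (λ z → corner H z t) eq)))

    image-collapsed : ∀ a t t′ {x} → q.edge (proj₁ a) ≡ inj₁ x → image (Aʷ.start a t) ≡ image (Aʷ.start a t′)
    image-collapsed (a , _) t t′ eq = Σ-≡-irrelevant (trans (at t) (sym (at t′)))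
      where
      at : ∀ t → q.vertex (G.start a t) ≡ _
      at t = trans (q.compatible a t) (cong (λ z → corner H z t) eq)

    f-edge : ∀ {a c r} → k.edge a ≡ inj₁ w → q.edge a ≡ inj₂ (c , r) → f.edge c ≡ inj₁ w
    f-edge {a} {c} {r} p eq = twist-inj₁ K r (f.edge c)
      (trans (cong f.extend (sym eq)) (trans (sym (proj₂ k≗fq a)) p))

    pushAlong : ∀ a t y → q.edge (proj₁ a) ≡ y →
                Bʷ.Walk (image (Aʷ.start a t)) (image (Aʷ.start a (opposite t)))
    pushAlong a t (inj₁ x) eq = ε≡ (image-collapsed a t (opposite t) eq)
    pushAlong a t (inj₂ (c , r)) eq =
      Bʷ.step (c , f-edge (proj₂ a) eq) (r · t) (image-start a t eq _)
             (trans (cong (Bʷ.start (c , f-edge (proj₂ a) eq)) (sym (·-opposite r t)))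
                    (image-start a (opposite t) eq _)) ◅ ε

    push : ∀ {u v} → Aʷ.Step u v → Bʷ.Walk (image u) (image v)
    push (Aʷ.step a t refl refl) = pushAlong a t (q.edge (proj₁ a)) refl

    push-inverse : ∀ {u v z} (s : Aʷ.Step u v) (r : Bʷ.Walk (image u) z) →
                   (push s ◅◅ (push (Aʷ.reverse s) ◅◅ r)) Bʷ.∼ r
    push-inverse (Aʷ.step a Sign.+ refl refl) r = go (q.edge (proj₁ a)) refl
      where
      go : ∀ y eq → (pushAlong a Sign.+ y eq ◅◅ (pushAlong a Sign.- y eq ◅◅ r)) Bʷ.∼ r
      go (inj₁ x) eq = reflexive (ε≡-trans (image-collapsed a Sign.+ Sign.- eq) (image-collapsed a Sign.- Sign.+ eq) refl r)
      go (inj₂ (c , t)) eq = Bʷ.∼-trans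
        (Bʷ.∼-cons _ (reflexive (cong (_◅ r) (step-unique _ (Bʷ.reverse _) refl (·-opposite t Sign.+)))))
        (Bʷ.∼-cancel _ r)
    push-inverse (Aʷ.step a Sign.- refl refl) r = go (q.edge (proj₁ a)) refl
      where
      go : ∀ y eq → (pushAlong a Sign.- y eq ◅◅ (pushAlong a Sign.+ y eq ◅◅ r)) Bʷ.∼ r
      go (inj₁ x) eq = reflexive (ε≡-trans (image-collapsed a Sign.- Sign.+ eq) (image-collapsed a Sign.+ Sign.- eq) refl r)
      go (inj₂ (c , t)) eq = Bʷ.∼-trans
        (Bʷ.∼-cons _ (reflexive (cong (_◅ r) (step-unique _ (Bʷ.reverse _) refl (·-opposite t Sign.-)))))
        (Bʷ.∼-cancel _ r)

    module P = Induced Aʷ Bʷ image push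

    descend : ∀ u → Bʷ.Walk (image u) (image Cᴬ.centre)
    descend u = P.walk (Cᴬ.track u)

    descend-step : ∀ {u v} (s : Aʷ.Step u v) → (push s ◅◅ descend v) Bʷ.∼ descend u
    descend-step s = P.walk-resp-∼ push-inverse (Cᴬ.square s)

    push-collapsed : ∀ {u v x} (s : Aʷ.Step u v) → q.edge (proj₁ (Aʷ.Step.edge s)) ≡ inj₁ x →
                     ∃[ p ] push s ≡ ε≡ p
    push-collapsed (Aʷ.step a t refl refl) eq = go (q.edge (proj₁ a)) refl eq
      where
      go : ∀ {x} y eq → y ≡ inj₁ x → ∃[ p ] pushAlong a t y eq ≡ ε≡ p
      go (inj₁ x) eq _ = _ , refl

    include : ∀ {x} → f.vertex x ≡ w → Q.V x → Aʷ.V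
    include p (v , r) = v , trans (proj₁ k≗fq v) (trans (cong f.vertex r) p)

    includeStep : ∀ {x} (p : f.vertex x ≡ w) {α β} → Q.Step x α β → Aʷ.Step (include p α) (include p β)
    includeStep p s = Aʷ.step
      (proj₁ (Q.Step.edge s) , trans (proj₂ k≗fq _) (trans (cong f.extend (proj₂ (Q.Step.edge s))) (cong inj₁ p)))
      (Q.Step.sign s)
      (Σ-≡-irrelevant (cong proj₁ (Q.Step.starts s)))
      (Σ-≡-irrelevant (cong proj₁ (Q.Step.ends s)))

    -- Two vertices in one fiber of `q` are joined by edges that `q` collapses. The squares over
    -- these edges compare the two tracks, and the edges themselves are pushed to empty walks.
    descend-fiber : ∀ {x} (p : f.vertex x ≡ w) {α β} → Q.Walk x α β →
      (eq : image (include p α) ≡ image (include p β)) →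
      (ε≡ eq ◅◅ descend (include p β)) Bʷ.∼ descend (include p α)
    descend-fiber p {α} ε eq = reflexive (cong (λ e → ε≡ e ◅◅ descend (include p α)) (uip eq refl))
    descend-fiber {x} p {α} {β} (_◅_ {j = γ} s r) eq with push-collapsed (includeStep p s) (proj₂ (Q.Step.edge s))
    ... | e , push≡ = Bʷ.∼-trans
      (reflexive (sym (ε≡-trans e (trans (sym e) eq) eq (descend (include p β)))))
      (Bʷ.∼-trans (∼-++ˡ (ε≡ e) (descend-fiber p r (trans (sym e) eq)))
        (Bʷ.∼-trans (reflexive (cong (_◅◅ descend (include p γ)) (sym push≡))) (descend-step (includeStep p s))))

    descend-fiber′ : ∀ {x} (p : f.vertex x ≡ w) {α β u v} → Q.Walk x α β → include p α ≡ u → include p β ≡ v →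
                     (eq : image u ≡ image v) → (ε≡ eq ◅◅ descend v) Bʷ.∼ descend u
    descend-fiber′ p r refl refl eq = descend-fiber p r eq

    descend-unique : ∀ {z} u v (p : z ≡ image u) (p′ : z ≡ image v) →
                     (ε≡ p ◅◅ descend u) Bʷ.∼ (ε≡ p′ ◅◅ descend v)
    descend-unique u v p p′ = Bʷ.∼-trans
      (∼-++ˡ (ε≡ p) (Bʷ.∼-sym (transfer u v (trans (sym p) p′))))
      (reflexive (ε≡-trans p (trans (sym p) p′) p′ (descend v)))
      where
      transfer : ∀ u v (eq : image u ≡ image v) → (ε≡ eq ◅◅ descend v) Bʷ.∼ descend u
      transfer (u , a) (v , b) eq = descend-fiber′ at
        (qᶜ.connectedᵛ (q.vertex v) (u , cong proj₁ eq) (v , refl)) (Σ-≡-irrelevant refl) (Σ-≡-irrelevant refl) eq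
        where
        at : f.vertex (q.vertex v) ≡ w
        at = trans (sym (proj₁ k≗fq v)) b

    base : Bʷ.V → Aʷ.V
    base (x , p) = let v , eq = qᶜ.surjectiveᵛ x in include p (v , eq)

    image-base : ∀ u → u ≡ image (base u)
    image-base (x , p) = Σ-≡-irrelevant (sym (proj₂ (qᶜ.surjectiveᵛ x)))

    trackᴮ : ∀ u → Bʷ.Walk u (image Cᴬ.centre)
    trackᴮ u = ε≡ (image-base u) ◅◅ descend (base u)

    squareᴮ : ∀ {u v} (s : Bʷ.Step u v) → (s ◅ trackᴮ v) Bʷ.∼ trackᴮ u
    squareᴮ {u} {v} s@(Bʷ.step (c , p) t refl refl) with qᶜ.surjectiveᵉ c
    -- The step is lifted to the edge `a` of `G` lying over `c`. The ends of this lift need not be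
    -- the preimages chosen by `base`; `descend-unique` makes the comparison at both ends.
    ... | a , r , eq = Bʷ.∼-trans (Bʷ.∼-cons s (descend-unique (base v) v′ (image-base v) v≡))
      (Bʷ.∼-trans (reflexive (step-move s σ u≡ v≡ (descend v′) refl (sym (·-cancel r t))))
        (Bʷ.∼-trans (∼-++ˡ (ε≡ u≡) (Bʷ.∼-trans (reflexive (cong (_◅◅ descend v′) (sym push≡))) (descend-step τ)))
                   (descend-unique u′ (base u) u≡ (image-base u))))
      where
      aᴬ : Aʷ.E
      aᴬ = a , trans (proj₂ k≗fq a) (trans (cong f.extend eq) (cong (twist K r) p))
      u′ = Aʷ.start aᴬ (r · t)
      v′ = Aʷ.start aᴬ (opposite (r · t))
      τ : Aʷ.Step u′ v′
      τ = Aʷ.step aᴬ (r · t) refl refl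
      u≡ : u ≡ image u′
      u≡ = trans (cong (Bʷ.start (c , p)) (sym (·-cancel r t))) (image-start aᴬ (r · t) eq p)
      v≡ : v ≡ image v′
      v≡ = trans (cong (Bʷ.start (c , p)) (trans (cong opposite (sym (·-cancel r t))) (sym (·-opposite r (r · t)))))
                 (image-start aᴬ (opposite (r · t)) eq p)
      σ : Bʷ.Step (image u′) (image v′)
      σ = Bʷ.step (c , p) (r · (r · t)) (image-start aᴬ (r · t) eq p)
                 (trans (cong (Bʷ.start (c , p)) (sym (·-opposite r (r · t)))) (image-start aᴬ (opposite (r · t)) eq p))
      push≡ : push τ ≡ σ ◅ ε
      push≡ = go (q.edge a) refl eq
        where
        go : ∀ y eq′ → y ≡ inj₂ (c , r) → pushAlong aᴬ (r · t) y eq′ ≡ σ ◅ ε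
        go _ eq′ refl = cong (_◅ ε) (step-unique _ σ refl refl)

    contractibleᵛ : Bʷ.Contractible
    contractibleᵛ = record { centre = image Cᴬ.centre ; track = trackᴮ ; square = squareᴮ }

  isContraction : IsContraction f
  isContraction = contractible⇒isContraction surjectiveᵛ surjectiveᵉ uniqueᵉ contractibleᵛ

-- Cancellation with the identity as first factor: `f` agrees with `f′ ∘ᴹ idᴹ`.
isContraction-cong : ∀ {G H} {f f′ : Morphism G H} → f ≗ᴹ f′ → IsContraction f → IsContraction f′
isContraction-cong {f′ = f′} (p , q) fᶜ =
  Cancellation.isContraction f′ fᶜ id-isContraction (p , λ a → trans (q a) (sym (twist-+ (Morphism.edge f′ a))))

-- Deciding whether a morphism of finite graphs is a contraction

module _ {G H : Graph} {f : Morphism (Graph.multigraph G) (Graph.multigraph H)} where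
  private
    module G = Graph G
  open Morphism f

  -- Winding around the loop changes the signed number of its traversals,
  -- which is a homotopy invariant.
  loop-not-collapsed : IsContraction f → ∀ a → G.start a Sign.+ ≡ G.start a Sign.- → ∀ {w} → ¬ (edge a ≡ inj₁ w)
  loop-not-collapsed fᶜ a loop {w} p = absurd (trans (sym (traversals-∼ (C.square σ))) refl)
    where
    Aʷ = VertexFiber f w
    module Aʷ = Multigraph Aʷ
    module C = Aʷ.Contractible (IsContraction.contractibleᵛ fᶜ w)
    weight : ∀ {u v} → Aʷ.Step u v → ℤ
    weight s = signedUnit (Aʷ.Step.sign s) ℤ.* δ (proj₁ (Aʷ.Step.edge s)) a
      where
      signedUnit : Sign → ℤ
      signedUnit Sign.+ = 1ℤ
      signedUnit Sign.- = ℤ.- 1ℤ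
    traversals : ∀ {u v} → Aʷ.Walk u v → ℤ
    traversals ε       = 0ℤ
    traversals (s ◅ p) = weight s ℤ.+ traversals p
    cancel⁺ : ∀ d t → 1ℤ ℤ.* d ℤ.+ (ℤ.- 1ℤ ℤ.* d ℤ.+ t) ≡ t
    cancel⁺ = solve-∀
    cancel⁻ : ∀ d t → ℤ.- 1ℤ ℤ.* d ℤ.+ (1ℤ ℤ.* d ℤ.+ t) ≡ t
    cancel⁻ = solve-∀
    traversals-∼ : ∀ {u v} {p p′ : Aʷ.Walk u v} → p Aʷ.∼ p′ → traversals p ≡ traversals p′
    traversals-∼ Aʷ.∼-refl          = refl
    traversals-∼ (Aʷ.∼-sym r)       = sym (traversals-∼ r)
    traversals-∼ (Aʷ.∼-trans r r′)  = trans (traversals-∼ r) (traversals-∼ r′)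
    traversals-∼ (Aʷ.∼-cons s r)    = cong (ℤ._+_ (weight s)) (traversals-∼ r)
    traversals-∼ (Aʷ.∼-cancel (Aʷ.step b Sign.+ _ _) p) = cancel⁺ (δ (proj₁ b) a) (traversals p)
    traversals-∼ (Aʷ.∼-cancel (Aʷ.step b Sign.- _ _) p) = cancel⁻ (δ (proj₁ b) a) (traversals p)
    σ : Aʷ.Step (Aʷ.start (a , p) Sign.+) (Aʷ.start (a , p) Sign.+)
    σ = Aʷ.step (a , p) Sign.+ refl (Σ-≡-irrelevant (sym loop))
    absurd : ∀ {t} → ¬ (t ≡ 1ℤ ℤ.* δ a a ℤ.+ t)
    absurd {t} eq = case trans (sym (δ-refl a)) (trans (isolate (δ a a) t) (trans (cong (ℤ._- t) (sym eq)) (ℤₚ.+-inverseʳ t))) of λ ()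
      where
      isolate : ∀ d t → d ≡ (1ℤ ℤ.* d ℤ.+ t) ℤ.- t
      isolate = solve-∀

-- Collapsing a single edge that is not a loop

module Quotient {n m} (start : Fin (suc m) → Sign → Fin (suc n)) (a : Fin (suc m))
                (a≢ : start a Sign.- ≢ start a Sign.+) where

  G : Graph
  G = record { #V = suc n ; #E = suc m ; start = start }

  v₀ : Fin (suc n)
  v₀ = start a Sign.-

  ρ : ∀ w → Dec (v₀ ≡ w) → Fin n
  ρ w (yes _)   = Fin.punchOut a≢
  ρ w (no v₀≢w) = Fin.punchOut v₀≢w

  vertexMap : Fin (suc n) → Fin n
  vertexMap w = ρ w (v₀ Finₚ.≟ w)

  G/a : Graph
  G/a = record { #V = n ; #E = m ; start = λ b s → vertexMap (start (Fin.punchIn a b) s) }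

  edgeMap : ∀ b → Dec (a ≡ b) → Fin n ⊎ (Fin m × Sign)
  edgeMap b (yes _)  = inj₁ (vertexMap v₀)
  edgeMap b (no a≢b) = inj₂ (Fin.punchOut a≢b , Sign.+)

  vertexMap-v₀ : vertexMap v₀ ≡ vertexMap (start a Sign.+)
  vertexMap-v₀ with v₀ Finₚ.≟ v₀ | v₀ Finₚ.≟ start a Sign.+
  ... | no n    | _      = contradiction refl n
  ... | yes _   | yes eq = contradiction eq a≢
  ... | yes _   | no _   = Finₚ.punchOut-cong v₀ refl

  punchIn-vertexMap : ∀ w → (w ≡ v₀ × Fin.punchIn v₀ (vertexMap w) ≡ start a Sign.+) ⊎
                            Fin.punchIn v₀ (vertexMap w) ≡ w
  punchIn-vertexMap w with v₀ Finₚ.≟ w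
  ... | yes eq = inj₁ (sym eq , Finₚ.punchIn-punchOut a≢)
  ... | no ¬eq = inj₂ (Finₚ.punchIn-punchOut ¬eq)

  vertexMap-punchIn : ∀ w → vertexMap (Fin.punchIn v₀ w) ≡ w
  vertexMap-punchIn w with v₀ Finₚ.≟ Fin.punchIn v₀ w
  ... | yes eq = contradiction (sym eq) (Finₚ.punchInᵢ≢i v₀ w)
  ... | no ¬eq = trans (Finₚ.punchOut-cong v₀ refl) (Finₚ.punchOut-punchIn v₀)

  quotient : Morphism (Graph.multigraph G) (Graph.multigraph G/a)
  quotient = record { vertex = vertexMap ; edge = λ b → edgeMap b (a Finₚ.≟ b) ; compatible = λ b → compatible b (a Finₚ.≟ b) }
    where
    compatible : ∀ b d s → vertexMap (start b s) ≡ corner (Graph.multigraph G/a) (edgeMap b d) s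
    compatible b (yes refl) Sign.+ = sym vertexMap-v₀
    compatible b (yes refl) Sign.- = refl
    compatible b (no a≢b) s = cong (λ c → vertexMap (start c s)) (sym (Finₚ.punchIn-punchOut a≢b))

  quotient-isContraction : IsContraction quotient
  quotient-isContraction = collapsingForest⇒isContraction record
    { top          = Fin.punchIn v₀
    ; top-section  = vertexMap-punchIn
    ; up           = λ w → up w (v₀ Finₚ.≟ w)
    ; rank         = λ w → rank w (v₀ Finₚ.≟ w)
    ; up-nothing   = λ w → up-nothing w (v₀ Finₚ.≟ w)
    ; up-just      = λ w → up-just w (v₀ Finₚ.≟ w)
    ; collapsed-up = λ b → collapsed b (a Finₚ.≟ b)
    ; lift         = λ b → Fin.punchIn a b , Sign.+ , lift b (a Finₚ.≟ Fin.punchIn a b)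
    ; lift-unique  = λ {b} {b′} → unique b b′ (a Finₚ.≟ b) (a Finₚ.≟ b′)
    }
    where
    up : ∀ w → Dec (v₀ ≡ w) → Maybe (Fin (suc m) × Sign)
    up w (yes _) = just (a , Sign.-)
    up w (no _)  = nothing
    rank : ∀ w → Dec (v₀ ≡ w) → ℕ
    rank w (yes _) = 1
    rank w (no _)  = 0
    up-nothing : ∀ w d → up w d ≡ nothing → w ≡ Fin.punchIn v₀ (vertexMap w)
    up-nothing w (no ¬eq) _ with punchIn-vertexMap w
    ... | inj₁ (eq , _) = contradiction (sym eq) ¬eq
    ... | inj₂ eq       = sym eq
    edge-a : edgeMap a (a Finₚ.≟ a) ≡ inj₁ (vertexMap v₀)
    edge-a with a Finₚ.≟ a
    ... | yes _ = refl
    ... | no n  = contradiction refl n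
    rank-+ : ∀ d → rank (start a Sign.+) d ℕ.< 1
    rank-+ (yes eq) = contradiction eq a≢
    rank-+ (no _)   = s≤s z≤n
    up-just : ∀ w d {b s} → up w d ≡ just (b , s) →
      start b s ≡ w × edgeMap b (a Finₚ.≟ b) ≡ inj₁ (vertexMap w) ×
      rank (start b (opposite s)) (v₀ Finₚ.≟ start b (opposite s)) ℕ.< rank w d
    up-just w (yes refl) refl = refl , edge-a , rank-+ (v₀ Finₚ.≟ start a Sign.+)
    collapsed : ∀ b d {w} → edgeMap b d ≡ inj₁ w → ∃[ s ] up (start b s) (v₀ Finₚ.≟ start b s) ≡ just (b , s)
    collapsed b (yes refl) _ = Sign.- , up-v₀ (v₀ Finₚ.≟ v₀)
      where
      up-v₀ : ∀ d → up v₀ d ≡ just (a , Sign.-)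
      up-v₀ (yes _) = refl
      up-v₀ (no n)  = contradiction refl n
    lift : ∀ b d → edgeMap (Fin.punchIn a b) d ≡ inj₂ (b , Sign.+)
    lift b (yes eq) = contradiction (sym eq) (Finₚ.punchInᵢ≢i a b)
    lift b (no ¬eq) = cong (λ c → inj₂ (c , Sign.+)) (trans (Finₚ.punchOut-cong a refl) (Finₚ.punchOut-punchIn a))
    unique : ∀ b b′ d d′ {c t t′} → edgeMap b d ≡ inj₂ (c , t) → edgeMap b′ d′ ≡ inj₂ (c , t′) → b ≡ b′
    unique b b′ (no n) (no n′) refl eq = Finₚ.punchOut-injective n n′ (sym (cong proj₁ (inj₂-injective eq)))

  module _ {H : Multigraph} (f : Morphism (Graph.multigraph G) H) {w} (f-a : Morphism.edge f a ≡ inj₁ w) where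
    open Morphism f

    f-ends : ∀ s → vertex (start a s) ≡ w
    f-ends s = trans (compatible a s) (cong (λ z → corner H z s) f-a)

    vertex-punchIn : ∀ x → vertex (Fin.punchIn v₀ (vertexMap x)) ≡ vertex x
    vertex-punchIn x with punchIn-vertexMap x
    ... | inj₁ (refl , eq) = trans (cong vertex eq) (trans (f-ends Sign.+) (sym (f-ends Sign.-)))
    ... | inj₂ eq          = cong vertex eq

    factor : Morphism (Graph.multigraph G/a) H
    factor = record
      { vertex     = λ x → vertex (Fin.punchIn v₀ x)
      ; edge       = λ b → edge (Fin.punchIn a b)
      ; compatible = λ b s → trans (vertex-punchIn _) (compatible (Fin.punchIn a b) s)
      }

    factor-≗ : f ≗ᴹ factor ∘ᴹ quotient
    factor-≗ = (λ x → sym (vertex-punchIn x)) , λ b → edges b (a Finₚ.≟ b)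
      where
      edges : ∀ b d → edge b ≡ Morphism.extend factor (edgeMap b d)
      edges b (yes refl) = trans f-a (cong inj₁ (sym (trans (vertex-punchIn v₀) (f-ends Sign.-))))
      edges b (no a≢b) = trans (cong edge (sym (Finₚ.punchIn-punchOut a≢b))) (sym (twist-+ {H} _))

inj₁? : ∀ {A B : Set} (x : A ⊎ B) → Dec (∃[ a ] x ≡ inj₁ a)
inj₁? (inj₁ a) = yes (a , refl)
inj₁? (inj₂ _) = no λ ()

module _ {G H : Graph} (f : Morphism (Graph.multigraph G) (Graph.multigraph H)) where
  private
    module G = Graph G
    module H = Graph H
  open Morphism f

  module _ (none : ¬ (∃[ a ] ∃[ w ] edge a ≡ inj₁ w)) where

    target : ∀ a → ∃[ b ] ∃[ t ] edge a ≡ inj₂ (b , t)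
    target a with edge a in eq
    ... | inj₁ w = contradiction (a , w , eq) none
    ... | inj₂ (b , t) = b , t , refl

    target-unique : ∀ {a b t} → edge a ≡ inj₂ (b , t) → proj₁ (target a) ≡ b
    target-unique {a} p = cong proj₁ (inj₂-injective (trans (sym (proj₂ (proj₂ (target a)))) p))

    -- When no edge is collapsed all fibers are discrete, so a contraction is a morphism bijective
    -- on vertices and on edges, and this is decided by search.
    isContraction?-none : Dec (IsContraction f)
    isContraction?-none = map′ to from
      ((Finₚ.all? λ w → Finₚ.any? λ v → vertex v Finₚ.≟ w) ×-dec
       (Finₚ.all? λ u → Finₚ.all? λ v → (vertex u Finₚ.≟ vertex v) →-dec (u Finₚ.≟ v)) ×-dec
       (Finₚ.all? λ b → Finₚ.any? λ a → proj₁ (target a) Finₚ.≟ b) ×-dec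
       (Finₚ.all? λ a → Finₚ.all? λ a′ → (proj₁ (target a) Finₚ.≟ proj₁ (target a′)) →-dec (a Finₚ.≟ a′)))
      where
      Bijective : Set
      Bijective = (∀ w → ∃[ v ] vertex v ≡ w) × (∀ u v → vertex u ≡ vertex v → u ≡ v) ×
                  (∀ b → ∃[ a ] proj₁ (target a) ≡ b) × (∀ a a′ → proj₁ (target a) ≡ proj₁ (target a′) → a ≡ a′)
      to : Bijective → IsContraction f
      to (surjᵛ , injᵛ , surjᵉ , injᵉ) = collapsingForest⇒isContraction record
        { top          = λ w → proj₁ (surjᵛ w)
        ; top-section  = λ w → proj₂ (surjᵛ w)
        ; up           = λ _ → nothing
        ; rank         = λ _ → 0
        ; up-nothing   = λ v _ → injᵛ _ _ (sym (proj₂ (surjᵛ (vertex v))))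
        ; up-just      = λ _ ()
        ; collapsed-up = λ a p → contradiction (a , _ , p) none
        ; lift         = λ b → let a , eq = surjᵉ b; _ , t , p = target a in
                             a , t , trans p (cong (λ c → inj₂ (c , t)) eq)
        ; lift-unique  = λ p q → injᵉ _ _ (trans (target-unique p) (sym (target-unique q)))
        }
      from : IsContraction f → Bijective
      from fᶜ = surjectiveᵛ , injᵛ , (λ b → let a , t , p = surjectiveᵉ b in a , target-unique p) ,
        λ a a′ eq → edge-unique fᶜ (proj₂ (proj₂ (target a)))
          (trans (proj₂ (proj₂ (target a′))) (cong (λ c → inj₂ (c , proj₁ (proj₂ (target a′)))) (sym eq)))
        where
        open IsContraction fᶜ
        injᵛ : ∀ u v → vertex u ≡ vertex v → u ≡ v
        injᵛ u v eq = cong proj₁ (WalkProperties.discrete-unique (VertexFiber f (vertex v))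
          (λ (a , p) → none (a , _ , p)) (connectedᵛ (vertex v) (u , eq) (v , refl)))

-- Recursion on the number of edges. A collapsed loop rules out a contraction. Any other collapsed
-- edge `a` lets `f` factor through the quotient by `a`, and `f` is a contraction exactly when the
-- factor is: closure under composition gives one direction, cancellation the other.
isContraction? : ∀ {G H : Graph} (f : Morphism (Graph.multigraph G) (Graph.multigraph H)) → Dec (IsContraction f)
isContraction? {record { #E = m ; start = start }} {H} f = go m start f
  where
  go : ∀ m {n} (start : Fin m → Sign → Fin n)
       (f : Morphism (Graph.multigraph (record { #V = n ; #E = m ; start = start })) (Graph.multigraph H)) →
       Dec (IsContraction f)
  go m start f with Finₚ.any? (λ a → inj₁? (Morphism.edge f a))
  ... | no none = isContraction?-none {record { start = start }} {H} f none
  go (suc m) {n} start f | yes (a , w , p) with start a Sign.- Finₚ.≟ start a Sign.+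
  ... | yes loop = no λ fᶜ → loop-not-collapsed {record { start = start }} {H} fᶜ a (sym loop) p
  go (suc m) {zero}  start f | yes (a , w , p) | no a≢ = case start a Sign.+ of λ ()
  go (suc m) {suc n} start f | yes (a , w , p) | no a≢ = map′
    (λ c → isContraction-cong ((λ v → sym (proj₁ ≗ v)) , λ b → sym (proj₂ ≗ b))
             (Composite.isContraction (factor f p) quotient c quotient-isContraction))
    (λ fᶜ → Cancellation.isContraction (factor f p) fᶜ quotient-isContraction ≗)
    (go m (Graph.start G/a) (factor f p))
    where
    open Quotient start a a≢
    ≗ = factor-≗ f p

-- Restriction of a forest to a set of nodes

infixr 5 _++ᶠ_
_++ᶠ_ : Forest → Forest → Forest
[]       ++ᶠ G = G
node X Y ++ᶠ G = node X (Y ++ᶠ G)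

separate : ∀ X {Y} → Node (X ++ᶠ Y) → Node X ⊎ Node Y
separate []           x         = inj₂ x
separate (node X₁ X₂) here      = inj₁ here
separate (node X₁ X₂) (down x)  = inj₁ (down x)
separate (node X₁ X₂) (right x) = ⊎.map₁ right (separate X₂ x)

inˡ : ∀ {X Y} → Node X → Node (X ++ᶠ Y)
inˡ here      = here
inˡ (down x)  = down x
inˡ (right x) = right (inˡ x)

inʳ : ∀ X {Y} → Node Y → Node (X ++ᶠ Y)
inʳ []           y = y
inʳ (node X₁ X₂) y = right (inʳ X₂ y)

separate-inˡ : ∀ {X Y} (x : Node X) → separate X {Y} (inˡ x) ≡ inj₁ x
separate-inˡ here      = refl
separate-inˡ (down x)  = refl
separate-inˡ (right x) = cong (⊎.map₁ right) (separate-inˡ x)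

separate-inʳ : ∀ X {Y} (y : Node Y) → separate X (inʳ X y) ≡ inj₂ y
separate-inʳ []           y = refl
separate-inʳ (node X₁ X₂) y = cong (⊎.map₁ right) (separate-inʳ X₂ y)

data Separated≺ {X Y : Forest} : Node X ⊎ Node Y → Node X ⊎ Node Y → Set where
  left   : ∀ {x x′} → x ≺ x′ → Separated≺ (inj₁ x) (inj₁ x′)
  across : ∀ {x y} → Separated≺ (inj₁ x) (inj₂ y)
  right  : ∀ {y y′} → y ≺ y′ → Separated≺ (inj₂ y) (inj₂ y′)

data Separated⊑ {X Y : Forest} : Node X ⊎ Node Y → Node X ⊎ Node Y → Set where
  left  : ∀ {x x′} → x ⊑ᴺ x′ → Separated⊑ (inj₁ x) (inj₁ x′)
  right : ∀ {y y′} → y ⊑ᴺ y′ → Separated⊑ (inj₂ y) (inj₂ y′)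

separate-≺ : ∀ X {Y} {x y : Node (X ++ᶠ Y)} → x ≺ y → Separated≺ (separate X x) (separate X y)
separate-≺ [] p = right p
separate-≺ (node X₁ X₂) here≺down = left here≺down
separate-≺ (node X₁ X₂) (here≺right {x = x}) with separate X₂ x
... | inj₁ _ = left here≺right
... | inj₂ _ = across
separate-≺ (node X₁ X₂) (down≺right {y = y}) with separate X₂ y
... | inj₁ _ = left down≺right
... | inj₂ _ = across
separate-≺ (node X₁ X₂) (down p) = left (down p)
separate-≺ (node X₁ X₂) (right {x = x} {y} p) with separate X₂ x | separate X₂ y | separate-≺ X₂ p
... | inj₁ _ | inj₁ _ | left q  = left (right q)
... | inj₁ _ | inj₂ _ | across  = across
... | inj₂ _ | inj₂ _ | right q = right q

separate-⊑ : ∀ X {Y} {x y : Node (X ++ᶠ Y)} → x ⊑ᴺ y → Separated⊑ (separate X x) (separate X y)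
separate-⊑ [] p = right p
separate-⊑ (node X₁ X₂) here⊑here = left here⊑here
separate-⊑ (node X₁ X₂) here⊑down = left here⊑down
separate-⊑ (node X₁ X₂) (down p) = left (down p)
separate-⊑ (node X₁ X₂) (right {x = x} {y} p) with separate X₂ x | separate X₂ y | separate-⊑ X₂ p
... | inj₁ _ | inj₁ _ | left q  = left (right q)
... | inj₂ _ | inj₂ _ | right q = right q

separate-⊑⁻¹ : ∀ X {Y} {x y : Node (X ++ᶠ Y)} → Separated⊑ (separate X x) (separate X y) → x ⊑ᴺ y
separate-⊑⁻¹ [] (right p) = p
separate-⊑⁻¹ (node X₁ X₂) {x = here}   {here}   _ = here⊑here
separate-⊑⁻¹ (node X₁ X₂) {x = here}   {down y} _ = here⊑down
separate-⊑⁻¹ (node X₁ X₂) {x = down x} {down y} (left (down p)) = down p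
separate-⊑⁻¹ (node X₁ X₂) {x = down x} {here}   (left ())
separate-⊑⁻¹ (node X₁ X₂) {x = here}   {right y} p with separate X₂ y
separate-⊑⁻¹ (node X₁ X₂) {x = here}   {right y} (left ()) | inj₁ _
separate-⊑⁻¹ (node X₁ X₂) {x = down x} {right y} p with separate X₂ y
separate-⊑⁻¹ (node X₁ X₂) {x = down x} {right y} (left ()) | inj₁ _
separate-⊑⁻¹ (node X₁ X₂) {x = right x} {here}   p with separate X₂ x
separate-⊑⁻¹ (node X₁ X₂) {x = right x} {here}   (left ()) | inj₁ _
separate-⊑⁻¹ (node X₁ X₂) {x = right x} {down y} p with separate X₂ x
separate-⊑⁻¹ (node X₁ X₂) {x = right x} {down y} (left ()) | inj₁ _
separate-⊑⁻¹ (node X₁ X₂) {x = right x} {right y} p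
  with separate X₂ x | separate X₂ y | separate-⊑⁻¹ X₂ {x = x} {y}
separate-⊑⁻¹ (node X₁ X₂) {x = right x} {right y} (left (right p)) | inj₁ _ | inj₁ _ | ih = right (ih (left p))
separate-⊑⁻¹ (node X₁ X₂) {x = right x} {right y} (right p)        | inj₂ _ | inj₂ _ | ih = right (ih (right p))

besideᴱ : ∀ {X Y X′ Y′} → NodeEmbedding X X′ → NodeEmbedding Y Y′ → NodeEmbedding (X ++ᶠ Y) (node X′ Y′)
besideᴱ {X} {Y} {X′} {Y′} α β = record
  { ι  = λ x → place (separate X x)
  ; ≺⁺ = λ p → place≺ (separate-≺ X p)
  ; ⊑⁺ = λ p → place⊑ (separate-⊑ X p)
  ; ⊑⁻ = λ {x} {y} p → separate-⊑⁻¹ X (place⊑⁻¹ (separate X x) (separate X y) p)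
  }
  where
  place : Node X ⊎ Node Y → Node (node X′ Y′)
  place (inj₁ x) = down (ι α x)
  place (inj₂ y) = right (ι β y)
  place≺ : ∀ {s t} → Separated≺ s t → place s ≺ place t
  place≺ (left p)  = down (≺⁺ α p)
  place≺ across    = down≺right
  place≺ (right p) = right (≺⁺ β p)
  place⊑ : ∀ {s t} → Separated⊑ s t → place s ⊑ᴺ place t
  place⊑ (left p)  = down (⊑⁺ α p)
  place⊑ (right p) = right (⊑⁺ β p)
  place⊑⁻¹ : ∀ s t → place s ⊑ᴺ place t → Separated⊑ s t
  place⊑⁻¹ (inj₁ x) (inj₁ y) (down p)  = left (⊑⁻ α p)
  place⊑⁻¹ (inj₂ x) (inj₂ y) (right p) = right (⊑⁻ β p)

record Restriction (F : Forest) (S : Node F → Bool) : Set where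
  field
    forest    : Forest
    embedding : NodeEmbedding forest F
    sound     : ∀ y → S (ι embedding y) ≡ true
    complete  : ∀ x → S x ≡ true → ∃[ y ] ι embedding y ≡ x

-- When the edge `here` is dropped, its children are put in its place, ahead of its later siblings.
-- This leaves preorder and ancestry among the remaining nodes as they were.
restrict : ∀ F S → Restriction F S
restrict [] S = record { forest = [] ; embedding = emptyᴱ ; sound = λ () ; complete = λ () }
restrict (node A B) S with restrict A (λ x → S (down x)) | restrict B (λ x → S (right x)) | S here in S-here
... | α | β | true = record
  { forest    = node (Restriction.forest α) (Restriction.forest β)
  ; embedding = nodeᴱ (Restriction.embedding α) (Restriction.embedding β)
  ; sound     = λ { here → S-here ; (down x) → Restriction.sound α x ; (right x) → Restriction.sound β x }
  ; complete  = λ { here _ → here , refl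
                  ; (down x) p → let y , eq = Restriction.complete α x p in down y , cong down eq
                  ; (right x) p → let y , eq = Restriction.complete β x p in right y , cong right eq }
  }
... | α | β | false = record
  { forest    = α.forest ++ᶠ β.forest
  ; embedding = e
  ; sound     = sound′
  ; complete  = λ { here p → case trans (sym S-here) p of λ ()
                  ; (down x) p → let y , eq = α.complete x p in
                      inˡ y , trans (ι-inˡ y) (cong down eq)
                  ; (right x) p → let y , eq = β.complete x p in
                      inʳ α.forest y , trans (ι-inʳ y) (cong right eq) }
  }
  where
  module α = Restriction α
  module β = Restriction β
  e : NodeEmbedding (α.forest ++ᶠ β.forest) (node A B)
  e = besideᴱ α.embedding β.embedding
  sound′ : ∀ y → S (ι e y) ≡ true
  sound′ y with separate α.forest y
  ... | inj₁ x = α.sound x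
  ... | inj₂ x = β.sound x
  ι-inˡ : ∀ y → ι e (inˡ y) ≡ down (ι α.embedding y)
  ι-inˡ y rewrite separate-inˡ {α.forest} {β.forest} y = refl
  ι-inʳ : ∀ y → ι e (inʳ α.forest y) ≡ right (ι β.embedding y)
  ι-inʳ y rewrite separate-inʳ α.forest {β.forest} y = refl

-- Enumerations

Enumeration : Set → Set
Enumeration A = Σ[ xs ∈ List A ] (∀ x → x ∈ˡ xs)

∈-bind : ∀ {a b} {A : Set a} {B : Set b} {f : A → List B} {xs x y} → x ∈ˡ xs → y ∈ˡ f x → y ∈ˡ List.concatMap f xs
∈-bind {f = f} {y = y} p q = ∈ₚ.∈-concatMap⁺ f (Any.map (λ { refl → q }) p)

enumerate-Σ : ∀ {A : Set} {B : A → Set} → Enumeration A → (∀ a → Enumeration (B a)) → Enumeration (Σ A B)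
enumerate-Σ (xs , p) ys =
  List.concatMap (λ a → List.map (a ,_) (proj₁ (ys a))) xs ,
  λ (a , b) → ∈-bind (p a) (∈ₚ.∈-map⁺ (a ,_) (proj₂ (ys a) b))

enumerate-Fin : ∀ n → Enumeration (Fin n)
enumerate-Fin n = List.allFin n , ∈ₚ.∈-allFin

enumerate-Sign : Enumeration Sign
enumerate-Sign = Sign.+ ∷ Sign.- ∷ [] , λ { Sign.+ → Any.here refl ; Sign.- → Any.there (Any.here refl) }

enumerate-⊎ : ∀ {A B : Set} → Enumeration A → Enumeration B → Enumeration (A ⊎ B)
enumerate-⊎ (xs , p) (ys , q) = List.map inj₁ xs List.++ List.map inj₂ ys , λ
  { (inj₁ x) → ∈ₚ.∈-++⁺ˡ (∈ₚ.∈-map⁺ inj₁ (p x))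
  ; (inj₂ y) → ∈ₚ.∈-++⁺ʳ _ (∈ₚ.∈-map⁺ inj₂ (q y)) }

enumerate-Vec : ∀ {A : Set} → Enumeration A → ∀ n → Enumeration (Vec A n)
enumerate-Vec e zero    = [] ∷ [] , λ { [] → Any.here refl }
enumerate-Vec e (suc n) = let xs , p = enumerate-Σ e (λ _ → enumerate-Vec e n) in
  List.map (λ (x , v) → x ∷ v) xs , λ { (x ∷ v) → ∈ₚ.∈-map⁺ _ (p (x , v)) }

forests : ∀ N → Σ[ Fs ∈ List Forest ] (∀ F → size F ℕ.≤ N → F ∈ˡ Fs)
forests zero    = [] ∷ [] , λ { [] _ → Any.here refl }
forests (suc N) with forests N
... | Fs , p = [] ∷ List.concatMap (λ A → List.map (node A) Fs) Fs , complete
  where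
  complete : ∀ F → size F ℕ.≤ suc N → F ∈ˡ [] ∷ List.concatMap (λ A → List.map (node A) Fs) Fs
  complete [] _ = Any.here refl
  complete (node A B) (s≤s le) = Any.there (∈-bind (p A (ℕₚ.≤-trans (ℕₚ.m≤m+n (size A) (size B)) le))
    (∈ₚ.∈-map⁺ (node A) (p B (ℕₚ.≤-trans (ℕₚ.m≤n+m (size B) (size A)) le))))

markedForests : ∀ g N → Σ[ ys ∈ List (MarkedForest g) ] (∀ y → MarkedForest.n y ℕ.≤ N → y ∈ˡ ys)
markedForests g N = List.concatMap (λ F → List.map (withMarks F) (proj₁ (marks F))) (proj₁ (forests N)) ,
  λ y le → ∈-bind (proj₂ (forests N) (MarkedForest.forest y) le)
                  (∈ₚ.∈-map⁺ (withMarks (MarkedForest.forest y)) (proj₂ (marks _) (MarkedForest.marks y)))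
  where
  withMarks : ∀ F → Vec (Fin (suc (size F)) × Fin (suc (size F))) g → MarkedForest g
  withMarks F v = record { forest = F ; marks = v }
  marks : ∀ F → Enumeration (Vec (Fin (suc (size F)) × Fin (suc (size F))) g)
  marks F = enumerate-Vec (enumerate-Σ (enumerate-Fin _) (λ _ → enumerate-Fin _)) g

-- Listing the contractions between two finite graphs

module _ (G H : Graph) where
  private
    module G = Graph G
    module H = Graph H

  Table : Set
  Table = Vec H.V G.#V × Vec (H.V ⊎ H.Dart) G.#E

  tables : Enumeration Table
  tables = enumerate-Σ (enumerate-Vec (enumerate-Fin _) _) λ _ →
    enumerate-Vec (enumerate-⊎ (enumerate-Fin _) (enumerate-Σ (enumerate-Fin _) (λ _ → enumerate-Sign))) _

  compatible? : ((vs , es) : Table) →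
    Dec (∀ a s → lookup vs (G.start a s) ≡ corner H.multigraph (lookup es a) s)
  compatible? (vs , es) = Finₚ.all? λ a → map′ (λ (p , q) → λ { Sign.+ → p ; Sign.- → q }) (λ h → h Sign.+ , h Sign.-)
    ((lookup vs (G.start a Sign.+) Finₚ.≟ corner H.multigraph (lookup es a) Sign.+) ×-dec
     (lookup vs (G.start a Sign.-) Finₚ.≟ corner H.multigraph (lookup es a) Sign.-))

  contractionsOf : Table → List (Contraction G.multigraph H.multigraph)
  contractionsOf t with compatible? t
  ... | no _ = []
  ... | yes c with isContraction? {G} {H} (record { vertex = lookup (proj₁ t) ; edge = lookup (proj₂ t) ; compatible = c })
  ...   | no _   = []
  ...   | yes fᶜ = (_ , fᶜ) ∷ []

  contractionsOf-complete : ∀ t (f : Contraction G.multigraph H.multigraph) →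
    (∀ v → lookup (proj₁ t) v ≡ Morphism.vertex (proj₁ f) v) →
    (∀ a → lookup (proj₂ t) a ≡ Morphism.edge (proj₁ f) a) →
    ∃[ f′ ] f′ ∈ˡ contractionsOf t × proj₁ f ≗ᴹ proj₁ f′
  contractionsOf-complete t (f , fᶜ) p q with compatible? t
  ... | no ¬c = contradiction
    (λ a s → trans (p _) (trans (Morphism.compatible f a s) (cong (λ z → corner H.multigraph z s) (sym (q a))))) ¬c
  ... | yes c with isContraction? {G} {H} (record { vertex = lookup (proj₁ t) ; edge = lookup (proj₂ t) ; compatible = c })
  ...   | no ¬fᶜ = contradiction (isContraction-cong ((λ v → sym (p v)) , (λ a → sym (q a))) fᶜ) ¬fᶜ
  ...   | yes _  = _ , Any.here refl , (λ v → sym (p v)) , (λ a → sym (q a))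

  contractions : List (Contraction G.multigraph H.multigraph)
  contractions = List.concatMap contractionsOf (proj₁ tables)

  -- A tabulated function agrees with the original only pointwise, so completeness is up to `≗ᴹ`,
  -- which is the equality of morphisms in `𝒢`.
  contractions-complete : ∀ f → ∃[ f′ ] f′ ∈ˡ contractions × proj₁ f ≗ᴹ proj₁ f′
  contractions-complete f =
    let t = tabulate (Morphism.vertex (proj₁ f)) , tabulate (Morphism.edge (proj₁ f))
        f′ , p , eq = contractionsOf-complete t f (Vecₚ.lookup∘tabulate _) (Vecₚ.lookup∘tabulate _)
    in f′ , ∈-bind (proj₂ tables t) p , eq

-- Property (F)

module _ {g : ℕ} (x : GraphOfGenus g) (z : MarkedForest g)
         (k : Morphism (Graph.multigraph (treeGraph z)) (GraphOfGenus.multigraph x)) (kᶜ : IsContraction k) where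
  private
    module z = MarkedForest z
    module k = Morphism k
    X = GraphOfGenus.graph x
    module X = Graph X

  survives : Fin z.n → Bool
  survives j = not (does (inj₁? (k.edge (j ↑ˡ g))))

  private
    R : Restriction z.forest (λ x → survives (enc x))
    R = restrict z.forest (λ x → survives (enc x))
    module R = Restriction R

    -- The marks of the restricted forest are the images of those of `z` under the retraction, and
    -- the retraction needs an embedding. To avoid a circle, the embedding is first formed between
    -- forests without marks.
    unmarked : Forest → MarkedForest 0
    unmarked F = record { forest = F ; marks = [] }

    e⁰ : Embedding (unmarked R.forest) (unmarked z.forest)
    e⁰ = embed {y = unmarked R.forest} {unmarked z.forest} R.embedding (λ ())
    module e⁰ = Embedding e⁰

  survivors : MarkedForest g
  survivors = record
    { forest = R.forest ; marks = tabulate λ a → π e⁰ (z.mark a Sign.+) , π e⁰ (z.mark a Sign.-) }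

  private
    y = survivors
    module y = MarkedForest y

  inclusion : Embedding y z
  inclusion = record
    { κ = e⁰.κ ; mono = e⁰.mono ; nodes = e⁰.nodes
    ; marks = λ { a Sign.+ → subst (λ v → v e⁰.≋ z.mark a Sign.+) (sym (cong proj₁ (Vecₚ.lookup∘tabulate _ a)))
                                   (proj₂ (retract e⁰ (z.mark a Sign.+)))
                ; a Sign.- → subst (λ v → v e⁰.≋ z.mark a Sign.-) (sym (cong proj₂ (Vecₚ.lookup∘tabulate _ a)))
                                   (proj₂ (retract e⁰ (z.mark a Sign.-))) } }

  open Embedding inclusion using () renaming (κ to κᵉ; nodes to nodesᵉ; marks to marksᵉ)

  not-survives : ∀ {A : Set} (d : Dec A) → not (does d) ≡ true → ¬ A
  not-survives (no n) _ = n

  survives-not : ∀ {A : Set} (d : Dec A) → ¬ A → not (does d) ≡ true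
  survives-not (yes a) n = contradiction a n
  survives-not (no _)  _ = refl

  image-survives : ∀ i → ¬ (∃[ w ] k.edge (κᵉ i ↑ˡ g) ≡ inj₁ w)
  image-survives i = not-survives (inj₁? (k.edge (κᵉ i ↑ˡ g))) (R.sound (dec i))

  missed-collapsed : ∀ j → ¬ (∃[ i ] κᵉ i ≡ j) → ∃[ w ] k.edge (j ↑ˡ g) ≡ inj₁ w
  missed-collapsed j n with inj₁? (k.edge (j ↑ˡ g)) in eq
  ... | yes c = c
  ... | no ¬c = let y , eq′ = R.complete (dec j)
                      (subst (λ j → survives j ≡ true) (sym (enc-dec j)) (survives-not (inj₁? _) ¬c)) in
    contradiction (enc y , trans (cong (λ x → enc (ι R.embedding x)) (dec-enc y)) (trans (cong enc eq′) (enc-dec j))) n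

  k-collapsed : ∀ {j w} → k.edge (j ↑ˡ g) ≡ inj₁ w → ∀ s → k.vertex (treeEnd z j s) ≡ w
  k-collapsed {j} p s = trans (cong k.vertex (sym (start-tree z j s)))
    (trans (k.compatible (j ↑ˡ g) s) (cong (λ c → corner X.multigraph c s) p))

  -- By induction from the root: an edge outside the image of `κᵉ` is collapsed by `k`, so passing
  -- to the parent changes neither the retraction nor the image under `k`. Hence `k` is determined
  -- by its values at the retained vertices.
  k-π : ∀ w → k.vertex (suc⁺ κᵉ (π inclusion w)) ≡ k.vertex w
  k-π = z.vertex-rec _ (cong (λ v → k.vertex (suc⁺ κᵉ v)) (π-suc⁺ inclusion zero)) λ j ih → step j ih (inImage inclusion j)
    where
    step : ∀ j → k.vertex (suc⁺ κᵉ (π inclusion (z.par j))) ≡ k.vertex (z.par j) → Dec (∃[ i ] κᵉ i ≡ j) →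
           k.vertex (suc⁺ κᵉ (π inclusion (suc j))) ≡ k.vertex (suc j)
    step _ ih (yes (i , refl)) = cong (λ v → k.vertex (suc⁺ κᵉ v)) (π-suc⁺ inclusion (suc i))
    step j ih (no n) = let w , p = missed-collapsed j n in
      trans (cong (λ v → k.vertex (suc⁺ κᵉ v)) (sym (π-skip inclusion n)))
        (trans ih (trans (k-collapsed p Sign.-) (sym (k-collapsed p Sign.+))))

  private
    treeEdge : Fin y.n → X.V ⊎ X.Dart
    treeEdge i = k.edge (κᵉ i ↑ˡ g)
    extraEdge′ : Fin g → X.V ⊎ X.Dart
    extraEdge′ a = k.edge (z.n ↑ʳ a)

  remainder : Morphism (Graph.multigraph (treeGraph y)) X.multigraph
  remainder = record
    { vertex     = λ v → k.vertex (suc⁺ κᵉ v)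
    ; edge       = elim treeEdge extraEdge′
    ; compatible = λ b → compatible (edgeView y.n g b)
    }
    where
    compatible : ∀ {b} → EdgeView y.n g b → ∀ s →
      k.vertex (suc⁺ κᵉ (Graph.start (treeGraph y) b s)) ≡ corner X.multigraph (elim treeEdge extraEdge′ b) s
    compatible (tree i) s = trans (cong (λ v → k.vertex (suc⁺ κᵉ v)) (start-tree y i s))
      (trans (ends s) (trans (cong k.vertex (sym (start-tree z (κᵉ i) s))) (trans (k.compatible (κᵉ i ↑ˡ g) s)
        (cong (λ c → corner X.multigraph c s) (sym (elim-tree treeEdge extraEdge′ i))))))
      where
      ends : ∀ s → k.vertex (suc⁺ κᵉ (treeEnd y i s)) ≡ k.vertex (treeEnd z (κᵉ i) s)
      ends Sign.+ = refl
      ends Sign.- = trans (cong (λ v → k.vertex (suc⁺ κᵉ v)) (sym (π-unique inclusion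
        (sameAncestors-par y.shape z.shape κᵉ (κ-injective inclusion) nodesᵉ i))))
        (k-π (z.par (κᵉ i)))
    compatible (extra a) s = trans (cong (λ v → k.vertex (suc⁺ κᵉ v)) (start-extra y a s))
      (trans (trans (cong (λ v → k.vertex (suc⁺ κᵉ v)) (sym (π-unique inclusion (marksᵉ a s)))) (k-π (z.mark a s)))
        (trans (cong k.vertex (sym (start-extra z a s))) (trans (k.compatible (z.n ↑ʳ a) s)
          (cong (λ c → corner X.multigraph c s) (sym (elim-extra treeEdge extraEdge′ a))))))

  factors : k ≗ᴹ remainder ∘ᴹ collapse inclusion
  factors = (λ w → sym (k-π w)) , λ b → edges (edgeView z.n g b)
    where
    edges : ∀ {b} → EdgeView z.n g b → k.edge b ≡ Morphism.extend remainder (edgeImage inclusion b)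
    edges (extra a) = sym (trans (cong (Morphism.extend remainder) (edgeImage-extra inclusion a))
      (trans (twist-+ {X.multigraph} _) (elim-extra treeEdge extraEdge′ a)))
    edges (tree j) = trans (treeEdges j (inImage inclusion j)) (cong (Morphism.extend remainder) (sym (edgeImage-tree inclusion j)))
      where
      treeEdges : ∀ j d → k.edge (j ↑ˡ g) ≡ Morphism.extend remainder (treeImage inclusion j d)
      treeEdges _ (yes (i , refl)) = sym (trans (twist-+ {X.multigraph} _) (elim-tree treeEdge extraEdge′ i))
      treeEdges j (no n) = let w , p = missed-collapsed j n in
        trans p (cong inj₁ (sym (trans (k-π (suc j)) (k-collapsed p Sign.+))))

  remainder-isContraction : IsContraction remainder
  remainder-isContraction = Cancellation.isContraction remainder kᶜ (collapse-isContraction inclusion) factors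

  -- Surviving tree edges map to edges of `x`, and a contraction has only one edge over each.
  survivors-bounded : y.n ℕ.≤ X.#E
  survivors-bounded = Finₚ.injective⇒≤ {f = λ i → proj₁ (survivorTarget i)} λ {i} {j} eq →
    κ-injective inclusion (Finₚ.↑ˡ-injective g _ _ (edge-unique kᶜ (proj₂ (proj₂ (survivorTarget i)))
      (trans (proj₂ (proj₂ (survivorTarget j))) (cong (λ b → inj₂ (b , proj₁ (proj₂ (survivorTarget j)))) (sym eq)))))
    where
    survivorTarget : ∀ i → ∃[ b ] ∃[ t ] k.edge (κᵉ i ↑ˡ g) ≡ inj₂ (b , t)
    survivorTarget i with k.edge (κᵉ i ↑ˡ g) | image-survives i
    ... | inj₁ w       | n = contradiction (w , refl) n
    ... | inj₂ (b , t) | _ = b , t , refl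

Φ-propertyF : ∀ g → PropertyF (Φ g)
Φ-propertyF g x = List.length candidates , (λ i → proj₁ (List.lookup candidates i)) ,
  (λ i → proj₂ (List.lookup candidates i)) , factorise
  where
  X = GraphOfGenus.graph x
  ys = markedForests g (Graph.#E X)
  candidates : List (Σ[ y ∈ MarkedForest g ] Contraction (Graph.multigraph (treeGraph y)) (Graph.multigraph X))
  candidates = List.concatMap (λ y → List.map (y ,_) (contractions (treeGraph y) X)) (proj₁ ys)
  factorise : ∀ z (k : Contraction (Graph.multigraph (treeGraph z)) (Graph.multigraph X)) →
    ∃[ i ] Σ[ e ∈ Embedding (proj₁ (List.lookup candidates i)) z ]
      proj₁ k ≗ᴹ proj₁ (proj₂ (List.lookup candidates i)) ∘ᴹ collapse e
  factorise z (k , kᶜ) = Any.index listed , transfer (Anyₚ.lookup-index listed)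
    where
    y : MarkedForest g
    y = survivors x z k kᶜ
    known : ∃[ f ] f ∈ˡ contractions (treeGraph y) X × remainder x z k kᶜ ≗ᴹ proj₁ f
    known = contractions-complete (treeGraph y) X (remainder x z k kᶜ , remainder-isContraction x z k kᶜ)
    f : Contraction (Graph.multigraph (treeGraph y)) (Graph.multigraph X)
    f = proj₁ known
    ≗f : remainder x z k kᶜ ≗ᴹ proj₁ f
    ≗f = proj₂ (proj₂ known)
    factors′ : k ≗ᴹ proj₁ f ∘ᴹ collapse (inclusion x z k kᶜ)
    factors′ = (λ v → trans (proj₁ (factors x z k kᶜ) v) (proj₁ ≗f _)) ,
      λ a → trans (proj₂ (factors x z k kᶜ) a)
              (extend-cong {f = remainder x z k kᶜ} {f′ = proj₁ f} ≗f (edgeImage (inclusion x z k kᶜ) a))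
    listed : (y , f) ∈ˡ candidates
    listed = ∈-bind (proj₂ ys y (survivors-bounded x z k kᶜ)) (∈ₚ.∈-map⁺ _ (proj₁ (proj₂ known)))
    transfer : ∀ {c} → (y , f) ≡ c → Σ[ e ∈ Embedding (proj₁ c) z ] k ≗ᴹ proj₁ (proj₂ c) ∘ᴹ collapse e
    transfer refl = inclusion x z k kᶜ , factors′

-- Spans

-- `Span` unfolds, so that its predicate cannot be inferred; the wrapper
-- makes it inferable.
record InSpan {c ℓ m ℓm p} {k : CommutativeRing c ℓ} (M : Module k m ℓm) (S : Pred (Module.Carrierᴹ M) p)
              (x : Module.Carrierᴹ M) : Set (c ⊔ m ⊔ ℓm ⊔ p) where
  constructor inSpan
  field
    span : Span M S x

open InSpan

module _ {c ℓ m ℓm} {k : CommutativeRing c ℓ} (M : Module k m ℓm) where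
  private
    module k = CommutativeRing k
  open Module M
  open Sum +ᴹ-monoid using () renaming (sum to sumᴹ)

  module _ {p} {S : Pred Carrierᴹ p} where

    Span-resp : ∀ {x y} → x ≈ᴹ y → InSpan M S x → InSpan M S y
    Span-resp x≈y (inSpan (n , a , s , s∈S , eq)) = inSpan (n , a , s , s∈S , ≈ᴹ-trans (≈ᴹ-sym x≈y) eq)

    Span-0 : InSpan M S 0ᴹ
    Span-0 = inSpan (0 , (λ ()) , (λ ()) , (λ ()) , ≈ᴹ-refl)

    Span-cons : ∀ a {s y} → S s → InSpan M S y → InSpan M S (a *ₗ s +ᴹ y)
    Span-cons a {s} s∈S (inSpan (n , as , ss , ss∈S , eq)) = inSpan
      (suc n , (λ { zero → a ; (suc i) → as i }) , (λ { zero → s ; (suc i) → ss i }) ,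
      (λ { zero → s∈S ; (suc i) → ss∈S i }) , +ᴹ-congˡ eq)

    Span-∈ : ∀ {s} → S s → InSpan M S s
    Span-∈ s∈S = Span-resp (≈ᴹ-trans (+ᴹ-congʳ (*ₗ-identityˡ _)) (+ᴹ-identityʳ _)) (Span-cons k.1# s∈S Span-0)

    Span-elim : ∀ {q} (P : Pred Carrierᴹ q) → (∀ {x y} → x ≈ᴹ y → P x → P y) → P 0ᴹ →
                (∀ {x y} → P x → P y → P (x +ᴹ y)) → (∀ a {x} → P x → P (a *ₗ x)) →
                (∀ {s} → S s → P s) → ∀ {x} → InSpan M S x → P x
    Span-elim P resp zero₀ plus scale incl (inSpan (n , a , s , s∈S , eq)) = resp (≈ᴹ-sym eq) (go n a s s∈S)
      where
      go : ∀ n a s → (∀ i → S (s i)) → P (sumᴹ {n} λ i → a i *ₗ s i)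
      go zero    a s s∈S = zero₀
      go (suc n) a s s∈S = plus (scale (a zero) (incl (s∈S zero))) (go n (λ i → a (suc i)) (λ i → s (suc i)) (λ i → s∈S (suc i)))

    Span-+ : ∀ {x y} → InSpan M S x → InSpan M S y → InSpan M S (x +ᴹ y)
    Span-+ (inSpan (n , a , s , s∈S , eq)) q = Span-resp (+ᴹ-congʳ (≈ᴹ-sym eq)) (go n a s s∈S)
      where
      go : ∀ n a s → (∀ i → S (s i)) → InSpan M S (sumᴹ {n} (λ i → a i *ₗ s i) +ᴹ _)
      go zero    a s s∈S = Span-resp (≈ᴹ-sym (+ᴹ-identityˡ _)) q
      go (suc n) a s s∈S = Span-resp (≈ᴹ-sym (+ᴹ-assoc _ _ _))
        (Span-cons (a zero) (s∈S zero) (go n (λ i → a (suc i)) (λ i → s (suc i)) (λ i → s∈S (suc i))))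

    Span-* : ∀ r {x} → InSpan M S x → InSpan M S (r *ₗ x)
    Span-* r (inSpan (n , a , s , s∈S , eq)) = Span-resp (*ₗ-congˡ (≈ᴹ-sym eq)) (go n a s s∈S)
      where
      go : ∀ n a s → (∀ i → S (s i)) → InSpan M S (r *ₗ sumᴹ {n} (λ i → a i *ₗ s i))
      go zero    a s s∈S = Span-resp (≈ᴹ-sym (*ₗ-zeroʳ r)) Span-0
      go (suc n) a s s∈S = Span-resp
        (≈ᴹ-trans (+ᴹ-congʳ (*ₗ-assoc r (a zero) (s zero))) (≈ᴹ-sym (*ₗ-distribˡ r _ _)))
        (Span-cons (r k.* a zero) (s∈S zero) (go n (λ i → a (suc i)) (λ i → s (suc i)) (λ i → s∈S (suc i))))

-- Noetherian rings

module NoetherianRing {c ℓ} (k : CommutativeRing c ℓ) (noetherian : IsNoetherian k) where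
  open CommutativeRing k hiding (zero; refl; sym; trans)
  private
    module k = CommutativeRing k

  -- The trivial ring plays the role of falsity.
  Trivial : Set ℓ
  Trivial = 1# ≈ 0#

  trivial⇒≈0 : Trivial → ∀ x → x ≈ 0#
  trivial⇒≈0 t x = k.trans (k.sym (*-identityˡ x)) (k.trans (*-congʳ t) (zeroˡ x))

  trivial⇒∈ : Trivial → ∀ (J : Ideal k) x → Ideal.I J x
  trivial⇒∈ t J x = Ideal.resp-≈ J (k.sym (trivial⇒≈0 t x)) (Ideal.0∈ J)

  -- As every ideal has finitely many generators, so has the ideal of those
  -- x which vanish unless A holds; its generators decide A.
  excludedMiddle : (A : Set (c ⊔ ℓ)) → A ⊎ (A → Trivial)
  excludedMiddle A with noetherian J
    where
    J : Ideal k
    J = record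
      { I        = λ x → A ⊎ x ≈ 0#
      ; resp-≈   = λ { x≈y (inj₁ a) → inj₁ a ; x≈y (inj₂ p) → inj₂ (k.trans (k.sym x≈y) p) }
      ; 0∈       = inj₂ k.refl
      ; +-closed = λ { (inj₁ a) _ → inj₁ a ; (inj₂ _) (inj₁ a) → inj₁ a
                     ; (inj₂ p) (inj₂ q) → inj₂ (k.trans (+-cong p q) (+-identityˡ 0#)) }
      ; *-closed = λ { r (inj₁ a) → inj₁ a ; r (inj₂ p) → inj₂ (k.trans (*-congˡ p) (zeroʳ r)) }
      }
  ... | r , v , v∈J , spans = search r v v∈J λ all0 a →
      Span-elim {k = k} (TensorUnit.⟨module⟩ {R = k}) (λ x → x ≈ 0#)
        (λ x≈y p → k.trans (k.sym x≈y) p) k.refl (λ p q → k.trans (+-cong p q) (+-identityˡ 0#))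
        (λ r p → k.trans (*-congˡ p) (zeroʳ r)) (λ { (i , refl) → all0 i }) (inSpan {S = λ y → ∃[ i ] y ≡ v i} (spans 1# (inj₁ a)))
    where
    search : ∀ r (v : Fin r → k.Carrier) → (∀ i → A ⊎ v i ≈ 0#) → ((∀ i → v i ≈ 0#) → A → Trivial) → A ⊎ (A → Trivial)
    search zero    v v∈J cont = inj₂ (cont λ ())
    search (suc r) v v∈J cont with v∈J zero
    ... | inj₁ a = inj₁ a
    ... | inj₂ p = search r (λ i → v (suc i)) (λ i → v∈J (suc i)) λ all0 → cont λ { zero → p ; (suc i) → all0 i }

  infix 4 _⊆_
  _⊆_ : Ideal k → Ideal k → Set (c ⊔ ℓ)
  J ⊆ J′ = ∀ x → Ideal.I J x → Ideal.I J′ x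

  module _ (J : ℕ → Ideal k) (ascending : ∀ n → J n ⊆ J (suc n)) where

    ascending-≤ : ∀ {m n} → m ℕ.≤ n → J m ⊆ J n
    ascending-≤ {m} m≤n with ℕₚ.m≤n⇒∃[o]m+o≡n m≤n
    ... | o , refl = go o
      where
      go : ∀ o → J m ⊆ J (m ℕ.+ o)
      go zero    x p = subst (λ n → Ideal.I (J n) x) (sym (ℕₚ.+-identityʳ m)) p
      go (suc o) x p = subst (λ n → Ideal.I (J n) x) (sym (ℕₚ.+-suc m o)) (ascending (m ℕ.+ o) x (go o x p))

    -- The union of the chain has finitely many generators, and these already lie in a common `J n`.
    stabilises : ∃[ n ] J (suc n) ⊆ J n
    stabilises with noetherian U
      where
      U : Ideal k
      U = record
        { I        = λ x → ∃[ n ] Ideal.I (J n) x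
        ; resp-≈   = λ x≈y (n , p) → n , Ideal.resp-≈ (J n) x≈y p
        ; 0∈       = 0 , Ideal.0∈ (J 0)
        ; +-closed = λ (m , p) (n , q) → m ℕ.⊔ n , Ideal.+-closed (J (m ℕ.⊔ n))
                       (ascending-≤ (ℕₚ.m≤m⊔n m n) _ p) (ascending-≤ (ℕₚ.m≤n⊔m m n) _ q)
        ; *-closed = λ r (n , p) → n , Ideal.*-closed (J n) r p
        }
    ... | r , v , v∈U , spans = let n , v∈Jn = common r v v∈U in
        n , λ x p → Span-elim {k = k} (TensorUnit.⟨module⟩ {R = k}) (Ideal.I (J n)) (Ideal.resp-≈ (J n)) (Ideal.0∈ (J n)) (Ideal.+-closed (J n))
                      (Ideal.*-closed (J n)) (λ { (i , refl) → v∈Jn i }) (inSpan {S = λ y → ∃[ i ] y ≡ v i} (spans x (suc n , p)))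
      where
      common : ∀ r (v : Fin r → k.Carrier) → (∀ i → ∃[ n ] Ideal.I (J n) (v i)) → ∃[ n ] (∀ i → Ideal.I (J n) (v i))
      common zero    v h = 0 , λ ()
      common (suc r) v h with h zero | common r (λ i → v (suc i)) (λ i → h (suc i))
      ... | m , p | n , q = m ℕ.⊔ n , λ
        { zero → ascending-≤ (ℕₚ.m≤m⊔n m n) _ p ; (suc i) → ascending-≤ (ℕₚ.m≤n⊔m m n) _ (q i) }

  module _ (X : DecRel) (J : Carrier X → Ideal k) (mono : ∀ {x y} → DecRel._≤_ X x y → J x ⊆ J y) where

    Maximal : Carrier X → Set (c ⊔ ℓ)
    Maximal x = ∀ y → DecRel._≤_ X x y → J y ⊆ J x

    -- Otherwise there would be an infinite strictly ascending chain of ideals.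
    maximal : Carrier X → ∃[ x ] Maximal x
    maximal x₀ with excludedMiddle (∃[ x ] Maximal x)
    ... | inj₁ found = found
    ... | inj₂ none = x₀ , λ y _ a _ → trivial⇒∈ trivial (J x₀) a
      where
      -- Strictness means that an inclusion back would make the ring trivial. If no strictly larger
      -- ideal lies above `x`, then `x` is maximal, and `none` yields triviality, so `x` may serve
      -- as its own successor.
      next : ∀ x → ∃[ y ] J x ⊆ J y × (J y ⊆ J x → Trivial)
      next x with excludedMiddle (∃[ y ] DecRel._≤_ X x y × (J y ⊆ J x → Trivial))
      ... | inj₁ (y , x≤y , n) = y , mono x≤y , n
      ... | inj₂ h = x , (λ _ p → p) , λ _ → none (x , λ y x≤y → case excludedMiddle (J y ⊆ J x) of λ
        { (inj₁ p) → p ; (inj₂ n) → λ a _ → trivial⇒∈ (h (y , x≤y , n)) (J x) a })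
      chain : ℕ → Carrier X
      chain zero    = x₀
      chain (suc n) = proj₁ (next (chain n))
      trivial : Trivial
      trivial with stabilises (λ n → J (chain n)) (λ n → proj₁ (proj₂ (next (chain n))))
      ... | n , p = proj₂ (proj₂ (next (chain n))) p

  -- A maximal `x` accounts for every `y` above it, since `J y` is then contained in `J x`. The
  -- remaining elements form `X ∖ x`, and the recursion on `WQO` makes the list finite.
  finiteBasis : ∀ {X} → WQO X → (J : Carrier X → Ideal k) → (∀ {x y} → DecRel._≤_ X x y → J x ⊆ J y) →
    Σ[ xs ∈ List (Carrier X) ] (∀ y → (∃[ x ] x ∈ˡ xs × DecRel._≤_ X x y × J y ⊆ J x) ⊎ Trivial)
  finiteBasis {X} (wqo h) J mono with excludedMiddle (Level.Lift (c ⊔ ℓ) (Carrier X))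
  ... | inj₂ empty = [] , λ y → inj₂ (empty (Level.lift y))
  ... | inj₁ (Level.lift x₀) with maximal X J mono x₀
  ...   | x , max with finiteBasis (h x) (λ y → J (proj₁ y)) mono
  ...     | xs , basis = x ∷ List.map proj₁ xs , covers
    where
    covers : ∀ y → (∃[ z ] z ∈ˡ x ∷ List.map proj₁ xs × DecRel._≤_ X z y × J y ⊆ J z) ⊎ Trivial
    covers y with DecRel._≤?_ X x y
    ... | yes x≤y = inj₁ (x , Any.here refl , x≤y , max y x≤y)
    ... | no  x≰y with basis (y , x≰y)
    ...   | inj₁ ((z , n) , z∈ , z≤y , p) = inj₁ (z , Any.there (∈ₚ.∈-map⁺ proj₁ z∈) , z≤y , p)
    ...   | inj₂ t = inj₂ t

-- Leading coefficients

⨄ᴿ : ∀ n → (Fin n → DecRel) → DecRel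
⨄ᴿ zero    X = ⊥ᴿ
⨄ᴿ (suc n) X = X zero ⊎ᴿ ⨄ᴿ n (λ i → X (suc i))

wqo-⨄ : ∀ n {X} → (∀ i → WQO (X i)) → WQO (⨄ᴿ n X)
wqo-⨄ zero    h = wqo-⊥
wqo-⨄ (suc n) h = wqo-⊎ (h zero) (wqo-⨄ n (λ i → h (suc i)))

inject : ∀ {n} X (i : Fin n) → Carrier (X i) → Carrier (⨄ᴿ n X)
inject X zero    a = inj₁ a
inject X (suc i) a = inj₂ (inject (λ i → X (suc i)) i a)

inject-reflects : ∀ {n} X (i j : Fin n) a b → DecRel._≤_ (⨄ᴿ n X) (inject X i a) (inject X j b) →
                  Σ[ eq ∈ i ≡ j ] DecRel._≤_ (X j) (subst (λ i → Carrier (X i)) eq a) b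
inject-reflects X zero    zero    a b (inj₁ p) = refl , p
inject-reflects X (suc i) (suc j) a b (inj₂ p) with inject-reflects (λ i → X (suc i)) i j a b p
... | refl , q = refl , q

-- What Gröbner's argument needs of a category.  `encode` need only reflect the
-- order of C_x, which therefore need not be decidable itself.
record GröbnerOrders (C : Category 0ℓ 0ℓ 0ℓ) : Set₁ where
  open Category C
  open Gröbner C using (Under) renaming (_≤_ to _≤ᵁ_)
  field
    ν           : ∀ {x y} → Hom x y → ℕ
    ν-cong      : ∀ {x y} {f g : Hom x y} → f ≈ g → ν f ≡ ν g
    ν-injective : ∀ {x y} {f g : Hom x y} → ν f ≡ ν g → f ≈ g
    ν-mono      : ∀ {x y z} (h : Hom y z) {f g : Hom x y} → ν f ℕ.< ν g → ν (h ∘ f) ℕ.< ν (h ∘ g)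
    underRel    : Obj → DecRel
    underWQO    : ∀ x → WQO (underRel x)
    encode  : ∀ {x} → Under x → Carrier (underRel x)
    encode-reflects : ∀ {x} (f g : Under x) → DecRel._≤_ (underRel x) (encode f) (encode g) → f ≤ᵁ g

𝓕-gröbnerOrders : ∀ g → GröbnerOrders (𝓕 g)
𝓕-gröbnerOrders g = record
  { ν           = λ f → code (Embedding.κ f)
  ; ν-cong      = code-cong
  ; ν-injective = λ {x} {y} {f} {f′} → code-injective {f = Embedding.κ f} {Embedding.κ f′}
  ; ν-mono      = λ h {f} {f′} → code-mono (Embedding.κ h) (Embedding.mono h) {Embedding.κ f} {Embedding.κ f′}
  ; underRel    = Underᴿ
  ; underWQO    = wqo-Under
  ; encode      = λ {x} → underCode x
  ; encode-reflects = λ {x} → underCode-reflects x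
  }

-- Gröbner's argument for submodules

module Transfer {c ℓ} (k : CommutativeRing c ℓ) (noetherian : IsNoetherian k)
  {C C′ : Category 0ℓ 0ℓ 0ℓ} (orders : GröbnerOrders C′) (Φ : Functor C′ C)
  (surjective : EssentiallySurjective Φ) (propertyF : PropertyF Φ)
  (M : Rep k C) (fg : FinitelyGenerated k C M) (S : Submodule k C M) where

  private
    module k = CommutativeRing k
    module C = Category C
    module C′ = Category C′
    module Φ = Functor Φ
    module M = Rep M
    module S = Submodule S
    module N = Rep S.N
    module V z = Module (M.F₀ (Φ.F₀ z))
    module W z = Module (N.F₀ (Φ.F₀ z))
    module MF {x y} (f : C.Hom x y) = ModuleMorphisms.IsModuleHomomorphism (M.isLinear f)
    module NF {x y} (f : C.Hom x y) = ModuleMorphisms.IsModuleHomomorphism (N.isLinear f)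
    module ι {x} = ModuleMorphisms.IsModuleMonomorphism (S.isMono x)
  open NoetherianRing k noetherian
  open GröbnerOrders orders
  open Gröbner C′ using (Under) renaming (_≤_ to _≤ᵁ_)

  Generator : Set (c ⊔ ℓ)
  Generator = Σ[ y ∈ C′.Obj ] M.F₀.Carrierᴹ (Φ.F₀ y)

  private
    r = proj₁ fg
    x = proj₁ (proj₂ fg)
    v = proj₁ (proj₂ (proj₂ fg))
    spans = proj₂ (proj₂ (proj₂ fg))

  -- Property (F) makes the composite of `M` with `Φ` finitely generated: every morphism from `x i`
  -- to an object `Φ z` factors through one of finitely many `f j`, so the images of `v i` under
  -- these suffice.
  generatorsFor : Fin r → List Generator
  generatorsFor i = let r′ , y , f , _ = propertyF (x i) in List.tabulate {n = r′} λ j → y j , M.F₁ (f j) (v i)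

  generators : List Generator
  generators = List.concatMap generatorsFor (List.allFin r)

  #gen : ℕ
  #gen = List.length generators

  Y : Fin #gen → C′.Obj
  Y p = proj₁ (List.lookup generators p)

  w : ∀ p → M.F₀.Carrierᴹ (Φ.F₀ (Y p))
  w p = proj₂ (List.lookup generators p)

  Term : C′.Obj → Set
  Term z = Σ[ p ∈ Fin #gen ] C′.Hom (Y p) z

  eval : ∀ {z} → Term z → V.Carrierᴹ z
  eval (p , f) = M.F₁ (Φ.F₁ f) (w p)

  infix 4 _precedes_
  -- Lexicographic order, first by generator and then by code. Bounds are pairs of numbers rather
  -- than terms, so that there are also limits such as `(#gen , 0)`, which exceeds every term.
  _precedes_ : ∀ {z} → Term z → ℕ × ℕ → Set
  (p , f) precedes (a , b) = toℕ p ℕ.< a ⊎ (toℕ p ≡ a × ν f ℕ.< b)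

  Lower : ∀ z → ℕ × ℕ → V.Carrierᴹ z → Set (c ⊔ ℓ)
  Lower z ab = InSpan (M.F₀ (Φ.F₀ z)) (λ u → ∃[ t ] t precedes ab × V._≈ᴹ_ z u (eval t))

  rank : ∀ {z} → Term z → ℕ × ℕ
  rank (p , f) = toℕ p , ν f

  lower-all : ∀ z u → Lower z (#gen , 0) u
  lower-all z u = Span-elim (M.F₀ (Φ.F₀ z)) (Lower z (#gen , 0))
    (Span-resp _) (Span-0 _) (Span-+ _) (Span-* _)
    (λ { (i , g , refl) → Span-∈ (M.F₀ (Φ.F₀ z)) (term i g) })
    (inSpan {S = λ u → ∃[ i ] Σ[ g ∈ C.Hom (x i) (Φ.F₀ z) ] u ≡ M.F₁ g (v i)} (spans (Φ.F₀ z) u))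
    where
    index : ∀ (y : C′.Obj) m (h : C′.Hom y z) {g} → (y , m) ≡ g →
            Σ[ f ∈ C′.Hom (proj₁ g) z ] V._≈ᴹ_ z (M.F₁ (Φ.F₁ h) m) (M.F₁ (Φ.F₁ f) (proj₂ g))
    index y m h refl = h , V.≈ᴹ-refl z
    term : ∀ i (g : C.Hom (x i) (Φ.F₀ z)) → ∃[ t ] t precedes (#gen , 0) × V._≈ᴹ_ z (M.F₁ g (v i)) (eval t)
    term i g with proj₂ (proj₂ (proj₂ (propertyF (x i)))) z g
    ... | j , h , g≈ =
      let r′ , y , f , _ = propertyF (x i)
          m = M.F₁ (f j) (v i)
          p : (y j , m) ∈ˡ generators
          p = ∈-bind (∈ₚ.∈-allFin i) (∈ₚ.∈-tabulate⁺ {f = λ j → y j , M.F₁ (f j) (v i)} j)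
          h′ , eq = index (y j) m h (Anyₚ.lookup-index p)
      in (Any.index p , h′) , inj₁ (Finₚ.toℕ<n (Any.index p)) ,
         V.≈ᴹ-trans z (M.F-resp-≈ g≈ (v i)) (V.≈ᴹ-trans z (M.homomorphism (Φ.F₁ h) (f j) (v i)) eq)

  Lower-mono : ∀ z {ab ab′ u} → (∀ {t} → t precedes ab → t precedes ab′) → Lower z ab u → Lower z ab′ u
  Lower-mono z h (inSpan (n , a , s , s∈ , eq)) =
    inSpan (n , a , s , (λ i → let t , p , e = s∈ i in t , h p , e) , eq)

  eval-∘ : ∀ {y z p} (h : C′.Hom y z) (f : C′.Hom (Y p) y) (f′ : C′.Hom (Y p) z) → C′._≈_ (h C′.∘ f) f′ →
           V._≈ᴹ_ z (M.F₁ (Φ.F₁ h) (eval (p , f))) (eval (p , f′))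
  eval-∘ {z = z} {p} h f f′ eq = V.≈ᴹ-trans z (V.≈ᴹ-sym z (M.homomorphism (Φ.F₁ h) (Φ.F₁ f) (w p)))
    (M.F-resp-≈ (IsEquivalence.trans C.isEquiv (IsEquivalence.sym C.isEquiv (Φ.homomorphism h f)) (Φ.F-resp-≈ eq)) (w p))

  -- Composition with `h` strictly preserves codes among terms with the same generator and does not
  -- change the generator, so smaller terms stay smaller.
  Lower-∘ : ∀ {y z p} (h : C′.Hom y z) (f : C′.Hom (Y p) y) (f′ : C′.Hom (Y p) z) → C′._≈_ (h C′.∘ f) f′ →
            ∀ {u} → Lower y (rank (p , f)) u → Lower z (rank (p , f′)) (M.F₁ (Φ.F₁ h) u)
  Lower-∘ {y} {z} {p} h f f′ eq = Span-elim (M.F₀ (Φ.F₀ y)) (λ u → Lower z (rank (p , f′)) (M.F₁ (Φ.F₁ h) u))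
    (λ e → Span-resp _ (MF.⟦⟧-cong (Φ.F₁ h) e))
    (Span-resp _ (V.≈ᴹ-sym z (MF.0ᴹ-homo (Φ.F₁ h))) (Span-0 _))
    (λ q q′ → Span-resp _ (V.≈ᴹ-sym z (MF.+ᴹ-homo (Φ.F₁ h) _ _)) (Span-+ _ q q′))
    (λ a q → Span-resp _ (V.≈ᴹ-sym z (MF.*ₗ-homo (Φ.F₁ h) a _)) (Span-* _ a q))
    λ { ((q , g) , before , e) → Span-∈ (M.F₀ (Φ.F₀ z))
          ((q , h C′.∘ g) , shift {q} g before ,
           V.≈ᴹ-trans z (MF.⟦⟧-cong (Φ.F₁ h) e) (eval-∘ h g (h C′.∘ g) (IsEquivalence.refl C′.isEquiv))) }
    where
    shift : ∀ {q} g → (q , g) precedes rank (p , f) → (q , h C′.∘ g) precedes rank (p , f′)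
    shift g (inj₁ lt)        = inj₁ lt
    shift {q} g (inj₂ (e , lt)) with Finₚ.toℕ-injective e
    ... | refl = inj₂ (refl , subst (ν (h C′.∘ g) ℕ.<_) (ν-cong eq) (ν-mono h lt))

  -- A presentation of `n` rather than a function of it: the terms may be linearly dependent in `M`,
  -- and the coefficient `a` may be zero. Allowing zero is what makes the coefficients at a term an
  -- ideal.
  record Leading {z} (t : Term z) (a : k.Carrier) (n : W.Carrierᴹ z) : Set (c ⊔ ℓ) where
    constructor leading
    field
      tail       : V.Carrierᴹ z
      tail-lower : Lower z (rank t) tail
      expansion  : V._≈ᴹ_ z (S.ι _ n) (V._+ᴹ_ z (V._*ₗ_ z a (eval t)) tail)

  module _ {z} {t : Term z} where
    private
      module Vz = V z
      module Wz = W z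

    Leading-resp : ∀ {a b n} → a k.≈ b → Leading t a n → Leading t b n
    Leading-resp eq (leading d d∈ e) = leading d d∈ (Vz.≈ᴹ-trans e (Vz.+ᴹ-congʳ (Vz.*ₗ-congʳ eq)))

    Leading-0 : Leading t k.0# Wz.0ᴹ
    Leading-0 = leading Vz.0ᴹ (Span-0 _) (Vz.≈ᴹ-trans ι.0ᴹ-homo
      (Vz.≈ᴹ-sym (Vz.≈ᴹ-trans (Vz.+ᴹ-identityʳ _) (Vz.*ₗ-zeroˡ _))))

    Leading-+ : ∀ {a b m n} → Leading t a m → Leading t b n → Leading t (a k.+ b) (m Wz.+ᴹ n)
    Leading-+ {a} {b} {m} {n} (leading d d∈ e) (leading d′ d′∈ e′) = leading (d Vz.+ᴹ d′) (Span-+ _ d∈ d′∈) (begin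
      S.ι _ (m Wz.+ᴹ n)                                                 ≈⟨ ι.+ᴹ-homo m n ⟩
      S.ι _ m Vz.+ᴹ S.ι _ n                                             ≈⟨ Vz.+ᴹ-cong e e′ ⟩
      (a Vz.*ₗ eval t Vz.+ᴹ d) Vz.+ᴹ (b Vz.*ₗ eval t Vz.+ᴹ d′)          ≈⟨ interchange _ _ _ _ ⟩
      (a Vz.*ₗ eval t Vz.+ᴹ b Vz.*ₗ eval t) Vz.+ᴹ (d Vz.+ᴹ d′)          ≈⟨ Vz.+ᴹ-congʳ (Vz.*ₗ-distribʳ (eval t) a b) ⟨
      (a k.+ b) Vz.*ₗ eval t Vz.+ᴹ (d Vz.+ᴹ d′)                         ∎)
      where
      open ≈-Reasoning Vz.≈ᴹ-setoid
      open CommutativeSemigroup (CommutativeMonoid.commutativeSemigroup Vz.+ᴹ-commutativeMonoid) using (interchange)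

    Leading-* : ∀ b {a n} → Leading t a n → Leading t (b k.* a) (b Wz.*ₗ n)
    Leading-* b {a} {n} (leading d d∈ e) = leading (b Vz.*ₗ d) (Span-* _ b d∈) (Vz.≈ᴹ-trans (ι.*ₗ-homo b n)
      (Vz.≈ᴹ-trans (Vz.*ₗ-congˡ e) (Vz.≈ᴹ-trans (Vz.*ₗ-distribˡ b _ _) (Vz.+ᴹ-congʳ (Vz.≈ᴹ-sym (Vz.*ₗ-assoc b a (eval t)))))))

  Leading-∘ : ∀ {y z p} (h : C′.Hom y z) (f : C′.Hom (Y p) y) (f′ : C′.Hom (Y p) z) → C′._≈_ (h C′.∘ f) f′ →
              ∀ {a n} → Leading (p , f) a n → Leading (p , f′) a (N.F₁ (Φ.F₁ h) n)
  Leading-∘ {y} {z} {p} h f f′ eq {a} {n} (leading d d∈ e) = leading (M.F₁ (Φ.F₁ h) d) (Lower-∘ h f f′ eq d∈) (begin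
    S.ι _ (N.F₁ (Φ.F₁ h) n)                                              ≈⟨ S.natural (Φ.F₁ h) n ⟩
    M.F₁ (Φ.F₁ h) (S.ι _ n)                                              ≈⟨ MF.⟦⟧-cong (Φ.F₁ h) e ⟩
    M.F₁ (Φ.F₁ h) (V._+ᴹ_ y (V._*ₗ_ y a (eval (p , f))) d)               ≈⟨ MF.+ᴹ-homo (Φ.F₁ h) _ _ ⟩
    M.F₁ (Φ.F₁ h) (V._*ₗ_ y a (eval (p , f))) Vz.+ᴹ M.F₁ (Φ.F₁ h) d      ≈⟨ Vz.+ᴹ-congʳ (MF.*ₗ-homo (Φ.F₁ h) a _) ⟩
    a Vz.*ₗ M.F₁ (Φ.F₁ h) (eval (p , f)) Vz.+ᴹ M.F₁ (Φ.F₁ h) d           ≈⟨ Vz.+ᴹ-congʳ (Vz.*ₗ-congˡ (eval-∘ h f f′ eq)) ⟩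
    a Vz.*ₗ eval (p , f′) Vz.+ᴹ M.F₁ (Φ.F₁ h) d                          ∎)
    where
    module Vz = V z
    open ≈-Reasoning Vz.≈ᴹ-setoid

  leadingIdeal : ∀ {z} → Term z → Ideal k
  leadingIdeal {z} t = record
    { I        = λ a → ∃[ n ] Leading t a n
    ; resp-≈   = λ eq (n , l) → n , Leading-resp eq l
    ; 0∈       = _ , Leading-0
    ; +-closed = λ (_ , l) (_ , l′) → _ , Leading-+ l l′
    ; *-closed = λ b (_ , l) → _ , Leading-* b l
    }

  Position : Set
  Position = Σ[ p ∈ Fin #gen ] Under (Y p)

  ideal : Position → Ideal k
  ideal (p , z , f) = leadingIdeal {z} (p , f)

  -- An indexed family, so that matching identifies the generators of the two positions and leaves
  -- no transport.
  data Divides : Position → Position → Set where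
    divides : ∀ {p u u′} → u ≤ᵁ u′ → Divides (p , u) (p , u′)

  positionRel : DecRel
  positionRel = record
    { Carrier = Position
    ; _≤_     = λ a b → DecRel._≤_ sums (position a) (position b)
    ; _≤?_    = λ a b → DecRel._≤?_ sums (position a) (position b)
    }
    where
    sums : DecRel
    sums = ⨄ᴿ #gen (λ p → underRel (Y p))
    position : Position → Carrier sums
    position (p , u) = inject (λ p → underRel (Y p)) p (encode u)

  positionWQO : WQO positionRel
  positionWQO = wqo-comap _ (λ le → le) (wqo-⨄ #gen (λ p → underWQO (Y p)))

  position-divides : ∀ {a b} → DecRel._≤_ positionRel a b → Divides a b
  position-divides {p , u} {q , u′} le with inject-reflects (λ p → underRel (Y p)) p q (encode u) (encode u′) le
  ... | refl , le′ = divides (encode-reflects u u′ le′)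

  ideal-mono : ∀ {a b} → DecRel._≤_ positionRel a b → ideal a ⊆ ideal b
  ideal-mono le a (n , l) with position-divides le
  ... | divides {u = y , f} {z , f′} (h , eq) = _ , Leading-∘ h f f′ eq l

  Element : Set (c ⊔ ℓ)
  Element = Σ[ y ∈ C′.Obj ] W.Carrierᴹ y

  private
    basis = finiteBasis positionWQO ideal ideal-mono

  leadingGenerators : (a : Position) → List Element
  leadingGenerators a@(p , z , f) = let s , _ , mem , _ = noetherian (ideal a) in
    List.tabulate {n = s} λ i → z , proj₁ (mem i)

  submoduleGenerators : List Element
  submoduleGenerators = List.concatMap leadingGenerators (proj₁ basis)

  IsImage : ∀ z → W.Carrierᴹ z → Set (c ⊔ ℓ)
  IsImage z u = Σ[ q ∈ Element ] q ∈ˡ submoduleGenerators × Σ[ h ∈ C′.Hom (proj₁ q) z ] W._≈ᴹ_ z u (N.F₁ (Φ.F₁ h) (proj₂ q))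

  Generated : ∀ z → W.Carrierᴹ z → Set (c ⊔ ℓ)
  Generated z = InSpan (N.F₀ (Φ.F₀ z)) (IsImage z)

  -- Some basis position divides that of `t` and its ideal contains the leading ideal at `t`. Thus
  -- `a` is a combination of the chosen generators of that ideal; the same combination of the
  -- corresponding elements, moved to `z` along `h`, has leading coefficient `a` at `t`.
  reduction : ∀ {z} (t : Term z) {a n} → Leading t a n → (∃[ n′ ] Generated z n′ × Leading t a n′) ⊎ Trivial
  reduction {z} (p , f′) {a} {n} l with proj₂ basis (p , z , f′)
  ... | inj₂ trivial = inj₂ trivial
  ... | inj₁ (b , b∈ , le , sub) with position-divides le
  ...   | divides {u = y , f} (h , eq) =
    let s , gs , mem , spanned = noetherian (ideal b) in inj₁
    (Span-elim (TensorUnit.⟨module⟩ {R = k}) (λ a → ∃[ n′ ] Generated z n′ × Leading (p , f′) a n′)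
      (λ e (n , g , l) → n , g , Leading-resp e l)
      (_ , Span-0 _ , Leading-0)
      (λ (_ , g , l) (_ , g′ , l′) → _ , Span-+ _ g g′ , Leading-+ l l′)
      (λ c (_ , g , l) → _ , Span-* _ c g , Leading-* c l)
      (λ { (i , refl) → N.F₁ (Φ.F₁ h) (proj₁ (mem i)) ,
             Span-∈ (N.F₀ (Φ.F₀ z)) ((y , proj₁ (mem i)) ,
               ∈-bind b∈ (∈ₚ.∈-tabulate⁺ {f = λ i → y , proj₁ (mem i)} i) , h , W.≈ᴹ-refl z) ,
             Leading-∘ h f f′ eq (proj₂ (mem i)) })
      (inSpan {S = λ c → ∃[ i ] c ≡ gs i} (spanned a (sub a (n , l)))))

  Bounded : ∀ z → ℕ → ℕ → V.Carrierᴹ z → Set (c ⊔ ℓ)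
  Bounded z a b u = Lower z (a , b) u ⊎
    (∃[ t ] rank t ≡ (a , b) × ∃[ e ] ∃[ d ] Lower z (a , b) d × V._≈ᴹ_ z u (V._+ᴹ_ z (V._*ₗ_ z e (eval t)) d))

  -- Codes are injective on morphisms, so all terms of rank `(a , b)` have the same value and their
  -- coefficients can be collected into one.
  lower-suc : ∀ z a b {u} → Lower z (a , suc b) u → Bounded z a b u
  lower-suc z a b = Span-elim (M.F₀ (Φ.F₀ z)) (Bounded z a b)
    (λ { eq (inj₁ d) → inj₁ (Span-resp _ eq d)
       ; eq (inj₂ (t , κ , e , d , d∈ , p)) → inj₂ (t , κ , e , d , d∈ , ≈ᴹ-trans (≈ᴹ-sym eq) p) })
    (inj₁ (Span-0 _))
    (λ { (inj₁ d) (inj₁ d′) → inj₁ (Span-+ _ d d′)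
       ; {x} {y} (inj₁ d′∈) (inj₂ (t , κ , e , d , d∈ , p)) → inj₂ (t , κ , e , x +ᴹ d , Span-+ _ d′∈ d∈ ,
           ≈ᴹ-trans (+ᴹ-congˡ p) (x∙yz≈y∙xz _ _ _))
       ; (inj₂ (t , κ , e , d , d∈ , p)) (inj₁ d′∈) → inj₂ (t , κ , e , d +ᴹ _ , Span-+ _ d∈ d′∈ ,
           ≈ᴹ-trans (+ᴹ-congʳ p) (+ᴹ-assoc _ _ _))
       ; (inj₂ (t , κ , e , d , d∈ , p)) (inj₂ (t′ , κ′ , e′ , d′ , d′∈ , p′)) →
           inj₂ (t , κ , e k.+ e′ , d +ᴹ d′ , Span-+ _ d∈ d′∈ ,
             ≈ᴹ-trans (+ᴹ-cong p (≈ᴹ-trans p′ (+ᴹ-congʳ (*ₗ-congˡ (eval-rank t′ t (trans κ′ (sym κ)))))))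
               (≈ᴹ-trans (interchange _ _ _ _) (+ᴹ-congʳ (≈ᴹ-sym (*ₗ-distribʳ (eval t) e e′))))) })
    (λ { a (inj₁ d) → inj₁ (Span-* _ a d)
       ; a (inj₂ (t , κ , e , d , d∈ , p)) → inj₂ (t , κ , a k.* e , a *ₗ d , Span-* _ a d∈ ,
           ≈ᴹ-trans (*ₗ-congˡ p) (≈ᴹ-trans (*ₗ-distribˡ a _ _) (+ᴹ-congʳ (≈ᴹ-sym (*ₗ-assoc a e (eval t)))))) })
    (λ { ((p , f) , inj₁ lt , eq) → inj₁ (Span-∈ (M.F₀ (Φ.F₀ z)) ((p , f) , inj₁ lt , eq))
       ; ((p , f) , inj₂ (κ , s≤s le) , eq) → case ℕₚ.m≤n⇒m<n∨m≡n le of λ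
           { (inj₁ lt) → inj₁ (Span-∈ (M.F₀ (Φ.F₀ z)) ((p , f) , inj₂ (κ , lt) , eq))
           ; (inj₂ κ′) → inj₂ ((p , f) , cong₂ _,_ κ κ′ , k.1# , 0ᴹ , Span-0 _ ,
               ≈ᴹ-trans eq (≈ᴹ-sym (≈ᴹ-trans (+ᴹ-identityʳ _) (*ₗ-identityˡ _)))) } })
    where
    open V z
    open CommutativeSemigroup (CommutativeMonoid.commutativeSemigroup +ᴹ-commutativeMonoid) using (interchange; x∙yz≈y∙xz)
    eval-rank : ∀ t t′ → rank t ≡ rank t′ → eval t ≈ᴹ eval t′
    eval-rank (p , f) (p′ , f′) eq with Finₚ.toℕ-injective (cong proj₁ eq)
    ... | refl = M.F-resp-≈ (Φ.F-resp-≈ (ν-injective (cong proj₂ eq))) (w p)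

  -- Descent from a limit: a combination involves finitely many terms with generator `a`, so their
  -- codes have a common bound.
  lower-zero : ∀ z a {u} → Lower z (suc a , 0) u → ∃[ b ] Lower z (a , b) u
  lower-zero z a = Span-elim (M.F₀ (Φ.F₀ z)) (λ u → ∃[ b ] Lower z (a , b) u)
    (λ eq (b , d) → b , Span-resp _ eq d) (0 , Span-0 _)
    (λ (b , d) (b′ , d′) → b ℕ.⊔ b′ ,
      Span-+ _ (Lower-mono z (weaken (ℕₚ.m≤m⊔n b b′)) d) (Lower-mono z (weaken (ℕₚ.m≤n⊔m b b′)) d′))
    (λ c (b , d) → b , Span-* _ c d)
    λ { ((p , f) , inj₁ (s≤s le) , eq) → case ℕₚ.m≤n⇒m<n∨m≡n le of λ
          { (inj₁ lt) → 0 , Span-∈ (M.F₀ (Φ.F₀ z)) ((p , f) , inj₁ lt , eq)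
          ; (inj₂ κ)  → suc (ν f) , Span-∈ (M.F₀ (Φ.F₀ z)) ((p , f) , inj₂ (κ , ℕₚ.≤-refl) , eq) }
      ; ((p , f) , inj₂ (_ , ()) , eq) }
    where
    weaken : ∀ {b b′} → b ℕ.≤ b′ → ∀ {t} → t precedes (a , b) → t precedes (a , b′)
    weaken le (inj₁ lt)       = inj₁ lt
    weaken le (inj₂ (κ , lt)) = inj₂ (κ , ℕₚ.<-≤-trans lt le)

  trivial⇒generated : Trivial → ∀ z n → Generated z n
  trivial⇒generated trivial z n = Span-resp _ (W.≈ᴹ-sym z n≈0) (Span-0 _)
    where
    n≈0 : W._≈ᴹ_ z n (W.0ᴹ z)
    n≈0 = W.≈ᴹ-trans z (W.≈ᴹ-sym z (W.*ₗ-identityˡ z n)) (W.≈ᴹ-trans z (W.*ₗ-congʳ z trivial) (W.*ₗ-zeroˡ z n))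

  -- Subtracting a generated element with the same leading coefficient at `t` leaves an element of
  -- the submodule with only lower terms, to which the hypothesis `ih` applies.
  generates-suc : ∀ z a b → (∀ n → Lower z (a , b) (S.ι _ n) → Generated z n) →
                  ∀ n → Lower z (a , suc b) (S.ι _ n) → Generated z n
  generates-suc z a b ih n low with lower-suc z a b low
  ... | inj₁ low′ = ih n low′
  ... | inj₂ (t , refl , e , d , d∈ , eq) with reduction t (leading d d∈ eq)
  ...   | inj₂ trivial = trivial⇒generated trivial z n
  ...   | inj₁ (n′ , n′-generated , leading d′ d′∈ eq′) =
    Span-resp _ restore (Span-+ _ (ih (n Wz.+ᴹ k.- k.1# Wz.*ₗ n′) difference) n′-generated)
    where
    module Vz = V z
    module Wz = W z
    -- Subtraction is written as multiplication by minus one, so that linearity of `ι` and closure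
    -- of spans under scalars cover it.
    cancelᴹ : ∀ (P : Module k (c ⊔ ℓ) (c ⊔ ℓ)) y → let open Module P in k.- k.1# *ₗ y +ᴹ y ≈ᴹ 0ᴹ
    cancelᴹ P y = ≈ᴹ-trans (+ᴹ-congˡ (≈ᴹ-sym (*ₗ-identityˡ y))) (≈ᴹ-trans (≈ᴹ-sym (*ₗ-distribʳ y (k.- k.1#) k.1#))
      (≈ᴹ-trans (*ₗ-congʳ (k.-‿inverseˡ k.1#)) (*ₗ-zeroˡ y)))
      where open Module P
    restore : (n Wz.+ᴹ k.- k.1# Wz.*ₗ n′) Wz.+ᴹ n′ Wz.≈ᴹ n
    restore = Wz.≈ᴹ-trans (Wz.+ᴹ-assoc _ _ _) (Wz.≈ᴹ-trans (Wz.+ᴹ-congˡ (cancelᴹ (N.F₀ (Φ.F₀ z)) n′)) (Wz.+ᴹ-identityʳ n))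
    difference : Lower z (a , b) (S.ι _ (n Wz.+ᴹ k.- k.1# Wz.*ₗ n′))
    difference = Span-resp _ (Vz.≈ᴹ-sym (begin
      S.ι _ (n Wz.+ᴹ k.- k.1# Wz.*ₗ n′)                                  ≈⟨ ι.+ᴹ-homo _ _ ⟩
      S.ι _ n Vz.+ᴹ S.ι _ (k.- k.1# Wz.*ₗ n′)                            ≈⟨ Vz.+ᴹ-cong eq (Vz.≈ᴹ-trans (ι.*ₗ-homo _ n′) (Vz.*ₗ-congˡ eq′)) ⟩
      (X Vz.+ᴹ d) Vz.+ᴹ k.- k.1# Vz.*ₗ (X Vz.+ᴹ d′)                      ≈⟨ Vz.+ᴹ-congˡ (Vz.*ₗ-distribˡ _ X d′) ⟩
      (X Vz.+ᴹ d) Vz.+ᴹ (k.- k.1# Vz.*ₗ X Vz.+ᴹ k.- k.1# Vz.*ₗ d′)       ≈⟨ interchange _ _ _ _ ⟩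
      (X Vz.+ᴹ k.- k.1# Vz.*ₗ X) Vz.+ᴹ (d Vz.+ᴹ k.- k.1# Vz.*ₗ d′)       ≈⟨ Vz.+ᴹ-congʳ (Vz.≈ᴹ-trans (Vz.+ᴹ-comm _ _) (cancelᴹ (M.F₀ (Φ.F₀ z)) X)) ⟩
      Vz.0ᴹ Vz.+ᴹ (d Vz.+ᴹ k.- k.1# Vz.*ₗ d′)                            ≈⟨ Vz.+ᴹ-identityˡ _ ⟩
      d Vz.+ᴹ k.- k.1# Vz.*ₗ d′                                          ∎))
      (Span-+ _ d∈ (Span-* _ (k.- k.1#) d′∈))
      where
      X = e Vz.*ₗ eval t
      open ≈-Reasoning Vz.≈ᴹ-setoid
      open CommutativeSemigroup (CommutativeMonoid.commutativeSemigroup Vz.+ᴹ-commutativeMonoid) using (interchange)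

  generates : ∀ z a b n → Lower z (a , b) (S.ι _ n) → Generated z n
  generates z zero zero n low = Span-resp _ (W.≈ᴹ-sym z (ι.injective (V.≈ᴹ-trans z ιn≈0 (V.≈ᴹ-sym z ι.0ᴹ-homo)))) (Span-0 _)
    where
    ιn≈0 : V._≈ᴹ_ z (S.ι _ n) (V.0ᴹ z)
    ιn≈0 = Span-elim (M.F₀ (Φ.F₀ z)) (λ u → V._≈ᴹ_ z u (V.0ᴹ z))
      (λ eq p → V.≈ᴹ-trans z (V.≈ᴹ-sym z eq) p) (V.≈ᴹ-refl z)
      (λ p q → V.≈ᴹ-trans z (V.+ᴹ-cong z p q) (V.+ᴹ-identityˡ z _))
      (λ c p → V.≈ᴹ-trans z (V.*ₗ-congˡ z p) (V.*ₗ-zeroʳ z c))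
      (λ { (_ , inj₁ () , _) ; (_ , inj₂ (_ , ()) , _) }) low
  generates z (suc a) zero    n low = generates z a (proj₁ (lower-zero z a low)) n (proj₂ (lower-zero z a low))
  generates z a       (suc b) n low = generates-suc z a b (generates z a b) n low

  submodule-finitelyGenerated : FinitelyGenerated k C S.N
  submodule-finitelyGenerated = List.length submoduleGenerators ,
    (λ i → Φ.F₀ (proj₁ (List.lookup submoduleGenerators i))) , (λ i → proj₂ (List.lookup submoduleGenerators i)) , spanning
    where
    IsImageᶜ : ∀ X → N.F₀.Carrierᴹ X → Set (c ⊔ ℓ)
    IsImageᶜ X u = ∃[ i ] Σ[ f ∈ C.Hom (Φ.F₀ (proj₁ (List.lookup submoduleGenerators i))) X ] u ≡ N.F₁ f (proj₂ (List.lookup submoduleGenerators i))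
    spanning : ∀ X u → Span (N.F₀ X) (IsImageᶜ X) u
    spanning X u with surjective X
    -- Essential surjectivity reduces an arbitrary object to one of the form `Φ y`: `u` is carried
    -- there by `f⁻¹`, expressed by the generators, and the expression is carried back by `f`.
    ... | y , f , f⁻¹ , _ , ff⁻¹≈id = span (Span-resp (N.F₀ X) restore (Span-elim (N.F₀ (Φ.F₀ y))
        (λ s → InSpan (N.F₀ X) (IsImageᶜ X) (N.F₁ f s))
        (λ eq → Span-resp _ (NF.⟦⟧-cong f eq))
        (Span-resp _ (≈ᴹ-sym (NF.0ᴹ-homo f)) (Span-0 _))
        (λ p q → Span-resp _ (≈ᴹ-sym (NF.+ᴹ-homo f _ _)) (Span-+ _ p q))
        (λ a p → Span-resp _ (≈ᴹ-sym (NF.*ₗ-homo f a _)) (Span-* _ a p))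
        image (generates y #gen 0 (N.F₁ f⁻¹ u) (lower-all y (S.ι _ (N.F₁ f⁻¹ u))))))
      where
      open Module (N.F₀ X)
      restore : N.F₁ f (N.F₁ f⁻¹ u) ≈ᴹ u
      restore = ≈ᴹ-trans (≈ᴹ-sym (N.homomorphism f f⁻¹ u)) (≈ᴹ-trans (N.F-resp-≈ ff⁻¹≈id u) (N.identity u))
      along : ∀ {q q′ : Element} → q ≡ q′ → (h : C′.Hom (proj₁ q) y) →
              Σ[ g ∈ C.Hom (Φ.F₀ (proj₁ q′)) X ] N.F₁ (f C.∘ Φ.F₁ h) (proj₂ q) ≈ᴹ N.F₁ g (proj₂ q′)
      along refl h = f C.∘ Φ.F₁ h , ≈ᴹ-refl
      image : ∀ {s} → IsImage y s → InSpan (N.F₀ X) (IsImageᶜ X) (N.F₁ f s)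
      image {s} (q , q∈ , h , s≈) with along (Anyₚ.lookup-index q∈) h
      ... | g , eq = Span-resp _ (≈ᴹ-sym (≈ᴹ-trans (NF.⟦⟧-cong f s≈) (≈ᴹ-trans (≈ᴹ-sym (N.homomorphism f (Φ.F₁ h) (proj₂ q))) eq)))
        (Span-∈ (N.F₀ X) (Any.index q∈ , g , refl))

theorem1p1 : ∀ {c ℓ} (g : ℕ) →
    QuasiGröbner ((𝒢 g) ᵒᵖ) ×
    ((k : CommutativeRing c ℓ) → IsNoetherian k → RepLocallyNoetherian k ((𝒢 g) ᵒᵖ))
theorem1p1 g =
  (𝓕 g , 𝓕-isGröbner g , Φ g , Φ-essentiallySurjective g , Φ-propertyF g) ,
  λ k noetherian M fg S → Transfer.submodule-finitelyGenerated k noetherian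
    (𝓕-gröbnerOrders g) (Φ g) (Φ-essentiallySurjective g) (Φ-propertyF g) M fg S
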